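{- For every integer $k\geq 1$ there is a polynomial $S_k(n)$ in $n$ of degree $4k$ with rational coefficients such that \[ \pi=\sum_{n=0}^\infty \frac{S_k(n)}{\binom{8kn}{4kn}(-4)^{kn}}. \] -}

module Defs where

open import Data.Bool.Base using (true; false; if_then_else_)
open import Data.Fin.Base using (toℕ)
open import Data.Integer.Base as ℤ using (ℤ; +_; -[1+_])
import Data.Integer.Properties as ℤ
open import Data.Nat.Base as ℕ using (ℕ; zero; suc; _+_; _*_; _∸_; _≤_; _<_; z≤n; s≤s)
open import Data.Nat.Combinatorics using (_C_; nCk≡n!/k![n-k]!; k![n∸k]!∣n!)
open import Data.Nat.DivMod using (m≥n⇒m/n>0)
open import Data.Nat.Divisibility using (∣⇒≤)
import Data.Nat.Properties as ℕ
open import Data.Nat.Tactic.RingSolver using (solve-∀)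
open import Data.Product.Base using (∃-syntax)
open import Data.Rational.Base as ℚ
  using (ℚ; 0ℚ; ∣_∣; toℚᵘ)
  renaming (_+_ to _+ℚ_; _-_ to _-ℚ_; _*_ to _*ℚ_; -_ to -ℚ_; _≤_ to _≤ℚ_; _<_ to _<ℚ_)
import Data.Rational.Properties as ℚ
open import Data.Rational.Unnormalised.Base as ℚᵘ using (mkℚᵘ; *≡*; *≤*)
import Data.Rational.Unnormalised.Properties as ℚᵘ
open import Data.Sum.Base using (inj₁; inj₂)
open import Data.Vec.Base using (Vec; foldr′; last)
open import Function.Base using (_∘_)
open import Relation.Binary.PropositionalEquality
open import Relation.Nullary.Negation.Core using (contradiction)

open import Algebra.Properties.Group ℚ.+-0-group using (⁻¹-involutive)
open import Algebra.Properties.Monoid.Sum ℕ.+-0-monoid using (sum-syntax)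
open import Algebra.Properties.Monoid.Sum ℚ.+-0-monoid
  using () renaming (sum to sumℚ)

ℤ→ℚ : ℤ → ℚ
ℤ→ℚ i = i ℚ./ 1

1/1+_ : ℕ → ℚ
1/1+ n = + 1 ℚ./ suc n

-- Real numbers are Bishop's regular sequences of rationals.

record ℝ : Set where
  field
    approx  : ℕ → ℚ
    regular : ∀ m n → ∣ approx m -ℚ approx n ∣ ≤ℚ (1/1+ m) +ℚ (1/1+ n)

-- Since ∣ x - approx x n ∣ ≤ 1/(n+1), this says that ∣ q - x ∣ ≤ ε.

∣_-_∣≤_ : ℚ → ℝ → ℚ → Set
∣ q - x ∣≤ ε = ∀ n → ∣ q -ℚ ℝ.approx x n ∣ ≤ℚ ε +ℚ (1/1+ n)

partialSum : (ℕ → ℚ) → ℕ → ℚ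
partialSum a N = sumℚ {N} (a ∘ toℕ)

-- The series a 0 + a 1 + a 2 + … converges to x.

HasSum : (ℕ → ℚ) → ℝ → Set
HasSum a x =
  ∀ ε → 0ℚ <ℚ ε → ∃[ N ] (∀ m → N ≤ m → ∣ partialSum a m - x ∣≤ ε)

-- Coefficients are listed from the constant term up.

record Polynomial (degree : ℕ) : Set where
  field
    coefficients : Vec ℚ (suc degree)
    leading≢0    : last coefficients ≢ 0ℚ

eval : ∀ {d} → Polynomial d → ℚ → ℚ
eval S x = foldr′ (λ c acc → c +ℚ x *ℚ acc) 0ℚ (Polynomial.coefficients S)

denominator : ℕ → ℕ → ℤ
denominator k n = + ((8 * k * n) C (4 * k * n)) ℤ.* (ℤ.- (+ 4)) ℤ.^ (k * n)

nCk≢0 : ∀ {n k} → k ≤ n → ℕ.NonZero (n C k)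
nCk≢0 {n} {k} k≤n rewrite nCk≡n!/k![n-k]! k≤n =
  ℕ.>-nonZero (m≥n⇒m/n>0 {{k ℕ.!* (n ∸ k) !≢0}}
    (∣⇒≤ {{n ℕ.!≢0}} (k![n∸k]!∣n! k≤n)))

denominator≢0 : ∀ k n → denominator k n ≢ ℤ.0ℤ
denominator≢0 k n eq with ℤ.i*j≡0⇒i≡0∨j≡0 (+ ((8 * k * n) C (4 * k * n))) eq
... | inj₁ p = ℕ.≢-nonZero⁻¹ _ {{nCk≢0 4kn≤8kn}} (ℤ.+-injective p)
  where
  4kn≤8kn : 4 * k * n ≤ 8 * k * n
  4kn≤8kn = ℕ.*-monoˡ-≤ n (ℕ.*-monoˡ-≤ k (ℕ.m≤m+n 4 4))
... | inj₂ p = contradiction (ℤ.i^n≡0⇒i≡0 (ℤ.- (+ 4)) (k * n) p) λ ()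

ℤ→ℚ-nonZero : ∀ {i} → i ≢ ℤ.0ℤ → ℚ.NonZero (ℤ→ℚ i)
ℤ→ℚ-nonZero {i} i≢0 = ℚ.≢-nonZero λ eq → i≢0 (begin
  i            ≡⟨ ℤ.*-identityʳ i ⟨
  i ℤ.* + 1    ≡⟨ ℚᵘ.drop-*≡* (ℚ./-injective-≃ (mkℚᵘ i 0) (mkℚᵘ ℤ.0ℤ 0) eq) ⟩
  ℤ.0ℤ         ∎)
  where open ≡-Reasoning

summand : ∀ {d} → ℕ → Polynomial d → ℕ → ℚ
summand k S n = ℚ._÷_ (eval S (ℤ→ℚ (+ n))) (ℤ→ℚ (denominator k n))
  {{ℤ→ℚ-nonZero (denominator≢0 k n)}}

-- π is defined as the area of the unit disc. Divide the first quadrant into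
-- squares of side 1/N. The square [i/N,(i+1)/N] × [j/N,(j+1)/N] lies in the
-- disc iff its corner ((i+1)/N,(j+1)/N) does.

indicator[_≤_] : ℕ → ℕ → ℕ
indicator[ m ≤ n ] = if m ℕ.≤ᵇ n then 1 else 0

squaresInside : ℕ → ℕ
squaresInside N = ∑[ i < N ] ∑[ j < N ]
  indicator[ suc (toℕ i) * suc (toℕ i) + suc (toℕ j) * suc (toℕ j) ≤ N * N ]

-- The area covered by the squares inside the disc, over all four quadrants.

innerArea : (N : ℕ) .{{_ : ℕ.NonZero N}} → ℚ
innerArea N = ℚ._/_ (+ (4 * squaresInside N)) (N * N) {{ℕ.m*n≢0 N N}}

-- The error of innerArea N is at most 8/N. This is proved by comparing the grid
-- of side 1/N with its refinement of side 1/(N * M), and with the squares whose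
-- near corner (i/N,j/N) lies in the disc.

Σ< : ℕ → (ℕ → ℕ) → ℕ
Σ< n f = ∑[ i < n ] f (toℕ i)

Σ-mono : ∀ n {f g} → (∀ i → i < n → f i ≤ g i) → Σ< n f ≤ Σ< n g
Σ-mono zero    f≤g = z≤n
Σ-mono (suc n) f≤g =
  ℕ.+-mono-≤ (f≤g 0 (s≤s z≤n)) (Σ-mono n λ i i<n → f≤g (suc i) (s≤s i<n))

Σ-const : ∀ n c → Σ< n (λ _ → c) ≡ n * c
Σ-const zero    c = refl
Σ-const (suc n) c = cong (_+_ c) (Σ-const n c)

Σ-cong : ∀ n {f g} → (∀ i → f i ≡ g i) → Σ< n f ≡ Σ< n g
Σ-cong zero    f≡g = refl
Σ-cong (suc n) f≡g = cong₂ _+_ (f≡g 0) (Σ-cong n (f≡g ∘ suc))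

Σ-suc : ∀ n f → Σ< n (suc ∘ f) ≡ n + Σ< n f
Σ-suc zero    f = refl
Σ-suc (suc n) f = cong suc (trans (cong (_+_ (f 0)) (Σ-suc n (f ∘ suc)))
  (exchange (f 0) n (Σ< n (f ∘ suc))))
  where
  exchange : ∀ a b c → a + (b + c) ≡ b + (a + c)
  exchange = solve-∀

*-distribˡ-Σ : ∀ c n f → c * Σ< n f ≡ Σ< n (λ i → c * f i)
*-distribˡ-Σ c zero    f = ℕ.*-zeroʳ c
*-distribˡ-Σ c (suc n) f = trans (ℕ.*-distribˡ-+ c (f 0) (Σ< n (f ∘ suc)))
  (cong (_+_ (c * f 0)) (*-distribˡ-Σ c n (f ∘ suc)))

Σ-++ : ∀ m n f → Σ< (m + n) f ≡ Σ< m f + Σ< n (λ i → f (m + i))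
Σ-++ zero    n f = refl
Σ-++ (suc m) n f = trans (cong (_+_ (f 0)) (Σ-++ m n (f ∘ suc)))
  (sym (ℕ.+-assoc (f 0) _ _))

Σ-block : ∀ n m f → Σ< (n * m) f ≡ Σ< n (λ i → Σ< m (λ a → f (i * m + a)))
Σ-block zero    m f = refl
Σ-block (suc n) m f = trans (Σ-++ m (n * m) f) (cong (_+_ (Σ< m f))
  (trans (Σ-block n m (λ i → f (m + i)))
    (Σ-cong n λ i → Σ-cong m λ a → cong f (sym (ℕ.+-assoc m (i * m) a)))))

block-upper : ∀ n m {f g} → (∀ i a → a < m → f (i * m + a) ≤ g i) →
              Σ< (n * m) f ≤ m * Σ< n g
block-upper n m {f} {g} f≤g = begin
  Σ< (n * m) f                             ≡⟨ Σ-block n m f ⟩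
  Σ< n (λ i → Σ< m (λ a → f (i * m + a)))  ≤⟨ Σ-mono n (λ i _ → Σ-mono m (f≤g i)) ⟩
  Σ< n (λ i → Σ< m (λ _ → g i))            ≡⟨ Σ-cong n (λ i → Σ-const m (g i)) ⟩
  Σ< n (λ i → m * g i)                     ≡⟨ *-distribˡ-Σ m n g ⟨
  m * Σ< n g                               ∎
  where open ℕ.≤-Reasoning

block-lower : ∀ n m {f g} → (∀ i a → a < m → g i ≤ f (i * m + a)) →
              m * Σ< n g ≤ Σ< (n * m) f
block-lower n m {f} {g} g≤f = begin
  m * Σ< n g                               ≡⟨ *-distribˡ-Σ m n g ⟩
  Σ< n (λ i → m * g i)                     ≡⟨ Σ-cong n (λ i → Σ-const m (g i)) ⟨
  Σ< n (λ i → Σ< m (λ _ → g i))            ≤⟨ Σ-mono n (λ i _ → Σ-mono m (g≤f i)) ⟩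
  Σ< n (λ i → Σ< m (λ a → f (i * m + a)))  ≡⟨ Σ-block n m f ⟨
  Σ< (n * m) f                             ∎
  where open ℕ.≤-Reasoning

indicator≤1 : ∀ m n → indicator[ m ≤ n ] ≤ 1
indicator≤1 m n with m ℕ.≤ᵇ n
... | true  = ℕ.≤-refl
... | false = z≤n

indicator-mono : ∀ m n m′ n′ → (m ≤ n → m′ ≤ n′) →
                 indicator[ m ≤ n ] ≤ indicator[ m′ ≤ n′ ]
indicator-mono m n m′ n′ imp with m ℕ.≤ᵇ n | ℕ.≤ᵇ⇒≤ m n
... | false | _   = z≤n
... | true  | m≤n with m′ ℕ.≤ᵇ n′ | ℕ.≤⇒≤ᵇ (imp (m≤n _))
...   | true  | _ = ℕ.≤-refl

inside meets : ℕ → ℕ → ℕ → ℕ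
inside N i j = indicator[ suc i * suc i + suc j * suc j ≤ N * N ]
meets  N i j = indicator[ i * i + j * j ≤ N * N ]

insideColumn meetsColumn : ℕ → ℕ → ℕ
insideColumn N i = Σ< N (inside N i)
meetsColumn  N i = Σ< N (meets N i)

squaresMeeting : ℕ → ℕ
squaresMeeting N = Σ< N (meetsColumn N)

scale : ∀ i j m → (i * m) * (i * m) + (j * m) * (j * m) ≡ (i * i + j * j) * (m * m)
scale = solve-∀

scale₁ : ∀ n m → (n * m) * (n * m) ≡ (n * n) * (m * m)
scale₁ = solve-∀

block-end : ∀ i a m → a < m → suc (i * m + a) ≤ suc i * m
block-end i a m a<m = begin
  suc (i * m + a)  ≡⟨ ℕ.+-suc (i * m) a ⟨
  i * m + suc a    ≤⟨ ℕ.+-monoʳ-≤ (i * m) a<m ⟩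
  i * m + m        ≡⟨ ℕ.+-comm (i * m) m ⟩
  suc i * m        ∎
  where open ℕ.≤-Reasoning

block-start : ∀ i a m → i * m ≤ suc (i * m + a)
block-start i a m = ℕ.m≤n⇒m≤1+n (ℕ.m≤m+n (i * m) a)

sq-mono : ∀ {a b c d} → a ≤ c → b ≤ d → a * a + b * b ≤ c * c + d * d
sq-mono a≤c b≤d = ℕ.+-mono-≤ (ℕ.*-mono-≤ a≤c a≤c) (ℕ.*-mono-≤ b≤d b≤d)

inside-refine : ∀ N M i j a b → a < M → b < M →
                inside N i j ≤ inside (N * M) (i * M + a) (j * M + b)
inside-refine N M i j a b a<M b<M = indicator-mono
  (suc i * suc i + suc j * suc j) (N * N)
  (suc (i * M + a) * suc (i * M + a) + suc (j * M + b) * suc (j * M + b))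
  (N * M * (N * M)) λ p → begin
  suc (i * M + a) * suc (i * M + a) + suc (j * M + b) * suc (j * M + b)
    ≤⟨ sq-mono (block-end i a M a<M) (block-end j b M b<M) ⟩
  (suc i * M) * (suc i * M) + (suc j * M) * (suc j * M)
    ≡⟨ scale (suc i) (suc j) M ⟩
  (suc i * suc i + suc j * suc j) * (M * M)
    ≤⟨ ℕ.*-monoˡ-≤ (M * M) p ⟩
  (N * N) * (M * M)
    ≡⟨ scale₁ N M ⟨
  (N * M) * (N * M) ∎
  where open ℕ.≤-Reasoning

meets-coarsen : ∀ N M .{{_ : ℕ.NonZero M}} i j a b →
                inside (N * M) (i * M + a) (j * M + b) ≤ meets N i j
meets-coarsen N M i j a b = indicator-mono
  (suc (i * M + a) * suc (i * M + a) + suc (j * M + b) * suc (j * M + b))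
  (N * M * (N * M)) (i * i + j * j) (N * N) λ p →
  ℕ.*-cancelʳ-≤ (i * i + j * j) (N * N) (M * M) {{ℕ.m*n≢0 M M}} (begin
    (i * i + j * j) * (M * M)
      ≡⟨ scale i j M ⟨
    (i * M) * (i * M) + (j * M) * (j * M)
      ≤⟨ sq-mono (block-start i a M) (block-start j b M) ⟩
    suc (i * M + a) * suc (i * M + a) + suc (j * M + b) * suc (j * M + b)
      ≤⟨ p ⟩
    (N * M) * (N * M)
      ≡⟨ scale₁ N M ⟩
    (N * N) * (M * M) ∎)
  where open ℕ.≤-Reasoning

refine-lower : ∀ N M → M * (M * squaresInside N) ≤ squaresInside (N * M)
refine-lower N M = begin
  M * (M * squaresInside N)
    ≡⟨ cong (M *_) (*-distribˡ-Σ M N (insideColumn N)) ⟩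
  M * Σ< N (λ i → M * insideColumn N i)
    ≤⟨ block-lower N M {insideColumn (N * M)} (λ i a a<M →
         block-lower N M {inside (N * M) (i * M + a)} {inside N i} (λ j b b<M →
           inside-refine N M i j a b a<M b<M)) ⟩
  squaresInside (N * M) ∎
  where open ℕ.≤-Reasoning

refine-upper : ∀ N M .{{_ : ℕ.NonZero M}} →
               squaresInside (N * M) ≤ M * (M * squaresMeeting N)
refine-upper N M = begin
  squaresInside (N * M)
    ≤⟨ block-upper N M {insideColumn (N * M)} (λ i a _ →
         block-upper N M {inside (N * M) (i * M + a)} {meets N i} (λ j b _ →
           meets-coarsen N M i j a b)) ⟩
  M * Σ< N (λ i → M * meetsColumn N i)
    ≡⟨ cong (M *_) (*-distribˡ-Σ M N (meetsColumn N)) ⟨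
  M * (M * squaresMeeting N) ∎
  where open ℕ.≤-Reasoning

Σ-shift : ∀ n f → Σ< n f ≤ f 0 + Σ< n (f ∘ suc)
Σ-shift zero    f = z≤n
Σ-shift (suc n) f = ℕ.+-monoʳ-≤ (f 0) (Σ-shift n (f ∘ suc))

meeting≤inside : ∀ N → squaresMeeting N ≤ squaresInside N + 2 * N
meeting≤inside N = begin
  squaresMeeting N
    ≤⟨ Σ-shift N (meetsColumn N) ⟩
  meetsColumn N 0 + Σ< N (λ i → meetsColumn N (suc i))
    ≤⟨ ℕ.+-mono-≤ (Σ-mono N {meets N 0} λ j _ → indicator≤1 (j * j) (N * N))
         (Σ-mono N {λ i → meetsColumn N (suc i)} {λ i → suc (insideColumn N i)} λ i _ → ℕ.≤-trans (Σ-shift N (meets N (suc i)))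
           (ℕ.+-monoˡ-≤ _ (indicator≤1 (suc i * suc i + 0) (N * N)))) ⟩
  Σ< N (λ _ → 1) + Σ< N (λ i → suc (insideColumn N i))
    ≡⟨ cong₂ _+_ (Σ-const N 1) (Σ-suc N (insideColumn N)) ⟩
  N * 1 + (N + squaresInside N)
    ≡⟨ rearrange N (squaresInside N) ⟩
  squaresInside N + 2 * N ∎
  where
  open ℕ.≤-Reasoning
  rearrange : ∀ n c → n * 1 + (n + c) ≡ c + 2 * n
  rearrange = solve-∀

compare : ∀ N M .{{_ : ℕ.NonZero N}} →
          squaresInside N * (M * M) ≤ (squaresInside M + 2 * M) * (N * N)
compare N M = begin
  squaresInside N * (M * M)            ≡⟨ reassoc (squaresInside N) M ⟩
  M * (M * squaresInside N)            ≤⟨ refine-lower N M ⟩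
  squaresInside (N * M)                ≡⟨ cong squaresInside (ℕ.*-comm N M) ⟩
  squaresInside (M * N)                ≤⟨ refine-upper M N ⟩
  N * (N * squaresMeeting M)           ≤⟨ ℕ.*-monoʳ-≤ N (ℕ.*-monoʳ-≤ N (meeting≤inside M)) ⟩
  N * (N * (squaresInside M + 2 * M))  ≡⟨ reassoc _ N ⟨
  (squaresInside M + 2 * M) * (N * N)  ∎
  where
  open ℕ.≤-Reasoning
  reassoc : ∀ c m → c * (m * m) ≡ m * (m * c)
  reassoc = solve-∀

/-≤-+ : ∀ a b c d e .{{_ : ℕ.NonZero b}} .{{_ : ℕ.NonZero d}} →
        a * (d * suc e) ≤ (c * suc e + d) * b →
        + a ℚ./ b ≤ℚ (+ c ℚ./ d) +ℚ (1/1+ e)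
/-≤-+ a b@(suc b-1) c d@(suc d-1) e le = ℚ.toℚᵘ-cancel-≤ (begin
  toℚᵘ (+ a ℚ./ b)
    ≃⟨ ℚ.toℚᵘ-fromℚᵘ (mkℚᵘ (+ a) b-1) ⟩
  mkℚᵘ (+ a) b-1
    ≤⟨ *≤* cross ⟩
  mkℚᵘ (+ c) d-1 ℚᵘ.+ mkℚᵘ (+ 1) e
    ≃⟨ ℚᵘ.+-cong (ℚ.toℚᵘ-fromℚᵘ (mkℚᵘ (+ c) d-1)) (ℚ.toℚᵘ-fromℚᵘ (mkℚᵘ (+ 1) e)) ⟨
  toℚᵘ (+ c ℚ./ d) ℚᵘ.+ toℚᵘ (1/1+ e)
    ≃⟨ ℚ.toℚᵘ-homo-+ (+ c ℚ./ d) (1/1+ e) ⟨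
  toℚᵘ ((+ c ℚ./ d) +ℚ (1/1+ e)) ∎)
  where
  open ℚᵘ.≤-Reasoning
  cross : + a ℤ.* + (d * suc e) ℤ.≤ (+ c ℤ.* + suc e ℤ.+ + 1 ℤ.* + d) ℤ.* + b
  cross = subst₂ ℤ._≤_ (ℤ.pos-* a (d * suc e))
    (trans (ℤ.pos-* (c * suc e + d) b) (cong (ℤ._* + b)
      (trans (ℤ.pos-+ (c * suc e) d)
        (cong₂ ℤ._+_ (ℤ.pos-* c (suc e)) (sym (ℤ.*-identityˡ (+ d)))))))
    (ℤ.+≤+ le)

innerArea-compare : ∀ m n →
  innerArea (8 * suc m) ≤ℚ innerArea (8 * suc n) +ℚ (1/1+ n)
innerArea-compare m n = /-≤-+ (4 * cN) (N * N) (4 * cM) (M * M) n (begin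
  4 * cN * (M * M * suc n)               ≡⟨ eq₁ cN M (suc n) ⟩
  4 * suc n * (cN * (M * M))             ≤⟨ ℕ.*-monoʳ-≤ (4 * suc n) (compare N M) ⟩
  4 * suc n * ((cM + 2 * M) * (N * N))   ≡⟨ eq₂ cM (suc n) N ⟩
  (4 * cM * suc n + M * M) * (N * N)     ∎)
  where
  open ℕ.≤-Reasoning
  N = 8 * suc m
  M = 8 * suc n
  cN = squaresInside N
  cM = squaresInside M
  eq₁ : ∀ c k s → 4 * c * (k * k * s) ≡ 4 * s * (c * (k * k))
  eq₁ = solve-∀
  eq₂ : ∀ c s k → 4 * s * ((c + 2 * (8 * s)) * (k * k)) ≡
                  (4 * c * s + 8 * s * (8 * s)) * (k * k)
  eq₂ = solve-∀

≤+⇒-≤ : ∀ {p q r} → p ≤ℚ q +ℚ r → p -ℚ q ≤ℚ r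
≤+⇒-≤ {p} {q} {r} p≤q+r = begin
  p -ℚ q              ≤⟨ ℚ.+-monoˡ-≤ (-ℚ q) p≤q+r ⟩
  (q +ℚ r) -ℚ q       ≡⟨ cong (_-ℚ q) (ℚ.+-comm q r) ⟩
  (r +ℚ q) -ℚ q       ≡⟨ ℚ.+-assoc r q (-ℚ q) ⟩
  r +ℚ (q -ℚ q)       ≡⟨ cong (r +ℚ_) (ℚ.+-inverseʳ q) ⟩
  r +ℚ 0ℚ             ≡⟨ ℚ.+-identityʳ r ⟩
  r                   ∎
  where open ℚ.≤-Reasoning

∣-∣≤+ : ∀ {p q r s} → p ≤ℚ q +ℚ s → q ≤ℚ p +ℚ r → 0ℚ ≤ℚ r → 0ℚ ≤ℚ s →
        ∣ p -ℚ q ∣ ≤ℚ r +ℚ s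
∣-∣≤+ {p} {q} {r} {s} p≤q+s q≤p+r 0≤r 0≤s with ℚ.∣p∣≡p∨∣p∣≡-p (p -ℚ q)
... | inj₁ eq = begin
  ∣ p -ℚ q ∣   ≡⟨ eq ⟩
  p -ℚ q       ≤⟨ ≤+⇒-≤ p≤q+s ⟩
  s            ≡⟨ ℚ.+-identityˡ s ⟨
  0ℚ +ℚ s      ≤⟨ ℚ.+-monoˡ-≤ s 0≤r ⟩
  r +ℚ s       ∎
  where open ℚ.≤-Reasoning
... | inj₂ eq = begin
  ∣ p -ℚ q ∣   ≡⟨ eq ⟩
  -ℚ (p -ℚ q)  ≡⟨ neg-sub ⟩
  q -ℚ p       ≤⟨ ≤+⇒-≤ q≤p+r ⟩
  r            ≡⟨ ℚ.+-identityʳ r ⟨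
  r +ℚ 0ℚ      ≤⟨ ℚ.+-monoʳ-≤ r 0≤s ⟩
  r +ℚ s       ∎
  where
  open ℚ.≤-Reasoning
  neg-sub : -ℚ (p -ℚ q) ≡ q -ℚ p
  neg-sub = trans (ℚ.neg-distrib-+ p (-ℚ q))
    (trans (ℚ.+-comm (-ℚ p) (-ℚ (-ℚ q))) (cong (_-ℚ p) (⁻¹-involutive q)))

0≤1/1+ : ∀ n → 0ℚ ≤ℚ (1/1+ n)
0≤1/1+ n = ℚ.nonNegative⁻¹ (1/1+ n) {{ℚ.normalize-nonNeg 1 (suc n)}}

π : ℝ
π = record
  { approx  = λ n → innerArea (8 * suc n)
  ; regular = λ m n → ∣-∣≤+ (innerArea-compare m n) (innerArea-compare n m)
                            (0≤1/1+ m) (0≤1/1+ n)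
  }

{-# OPTIONS --safe #-}
-- Let b N = 1 / ((2N + 1) (2N choose N)) be the integral of w ^ N over [0, 1], where
-- w = x - x ^ 2. Expanding 4 / (1 + x ^ 2) in powers of w, with coefficients linear in
-- x, and integrating gives π = Σ f N * b N, where f N = Re ((3 + i) c ^ N) and
-- c = (1 + i) / 2.
--
-- Put q = 1 - 4 / c = (1 + 2i) ^ 2 and Π m N = ∏ (1 - 2N / (2i + 1)) over i < m. Then
--
--   h d N = - 4 Re ((3 + i) c ^ (N - 1) Σ q ^ m / (2m + 1) * Π m N) / (2N choose N),
--
-- summed over m < d, is a truncated antidifference of - f N * b N. For d = 4k its defect
-- on the block 4kn ≤ N < 4k(n + 1) is a polynomial in n of degree less than 4k divided
-- by (8kn choose 4kn) (-4) ^ (kn), since c ^ 4 = - 1 / 4. Hence the corresponding series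
-- has sum π - h d 0. The series of χ, of degree exactly 4k, telescopes to -1, and
-- subtracting h d 0 * χ corrects the sum to π.
--
-- The degree stays 4k because h d 0 ≠ 0: this is, up to a factor, the sum of
-- Im ((1 + 2i) ^ (2m + 1)) / (2m + 1) over m < d, whose numerators are prime to 3, so
-- that the largest power of 3 among the denominators survives.
--
-- The area of the disc enters through the lattice points on a circle whose radius is a
-- common multiple of the M ^ 2 + j ^ 2: they cut the quarter disc into thin sectors,
-- which yields Riemann sums of 4 / (1 + x ^ 2) over [0, 1].
module Submission where

open import Defs
open import Algebra.Bundles using (CommutativeRing)
open import Data.Bool.Base using (true; false)
open import Data.Integer.Base as ℤ using (ℤ)
open import Data.Integer.Divisibility.Signed using (divides; ∣⇒∣ᵤ)
import Data.Integer.Properties as ℤ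
import Data.Integer.Tactic.RingSolver as ℤ-Solver
open import Data.Nat.Base as ℕ using (ℕ; zero; suc; z≤n; s≤s; _!)
open import Data.Nat.Combinatorics using (_C_; nCk≡n!/k![n-k]!; k![n∸k]!∣n!)
import Data.Nat.DivMod as ℕ
import Data.Nat.Divisibility as ℕ
open import Data.Nat.Divisibility using (_∣_; m∣m*n; n∣m*n; ∣-trans)
import Data.Nat.Properties as ℕ
import Data.Nat.Tactic.RingSolver as ℕ-Solver
open import Data.Product.Base using (_×_; _,_; ∃-syntax; proj₁; proj₂)
import Data.Rational.Properties as ℚ
open import Data.Rational.Unnormalised.Base as ℚᵘ using (mkℚᵘ; *≡*; *≤*)
import Data.Rational.Unnormalised.Properties as ℚᵘ
open import Data.Sum.Base using (_⊎_; inj₁; inj₂; [_,_]′)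
open import Data.Vec.Base using (Vec; []; _∷_; _∷ʳ_; last; map; zipWith; foldr′)
open import Data.Vec.Properties using (last-∷ʳ)
open import Function.Base using (_∘_)
open import Level using (0ℓ)
open import Relation.Binary.PropositionalEquality
open import Relation.Nullary.Decidable using (yes; no; from-no)
open import Relation.Nullary.Decidable.Core using (dec⇒maybe)
open import Relation.Nullary.Negation.Core using (¬_; contradiction)
open import Tactic.RingSolver using (solve-∀)
open import Tactic.RingSolver.Core.AlmostCommutativeRing using (AlmostCommutativeRing; fromCommutativeRing)

-- The substitution `w` works because `(1 + x ^ 2) (1 + (1 - x) ^ 2) = w ^ 2 - 2 w + 2`; the part of
-- the expansion with the factor `w′` integrates to powers of `w`, which vanish at 0 and 1, so only
-- `y 0` survives. The base `q` is fixed by `c q = c - 4`: this matches the summands of `h` at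
-- `N + 1` with those at `N` and makes the difference of `h` telescope in `m`. What truncation
-- leaves behind is governed by a second cancellation. Shifting `N` in `Π` releases a factor
-- `2 N + 1`, which cancels the denominator of `β (N + 1) / β N` or of `b N`, at the price of one
-- factor of `Π`. A block of `d` indices needs up to `d` such cancellations, hence truncation order
-- and block length agree, and everything on the block is a polynomial times the single `β` at its
-- start. That polynomial has degree below `d`; the term with `χ` repairs the sum and raises the
-- degree at once, so `h d 0` must not vanish. As π is known only through rational approximations,
-- derivatives and integrals are replaced by Taylor estimates at rational points.

-- Rational arithmetic: casts, inverses of odd numbers, inequalities, finite sums.

module Arithmetic where

  open import Data.Rational.Base public
    using (ℚ; 0ℚ; 1ℚ; ½; _+_; _*_; -_; _-_; _≤_; _<_; _/_; _÷_; 1/_; ∣_∣; NonZero; ≢-nonZero; nonNegative; toℚᵘ)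
  open import Algebra.Properties.Semiring.Exp (CommutativeRing.semiring ℚ.+-*-commutativeRing) public
    using (_^_; ^-homo-*; ^-assocʳ)

  ring : AlmostCommutativeRing 0ℓ 0ℓ
  ring = fromCommutativeRing ℚ.+-*-commutativeRing λ p → dec⇒maybe (0ℚ ℚ.≟ p)

  toℚᵘ-ℤ→ℚ : ∀ i → toℚᵘ (ℤ→ℚ i) ℚᵘ.≃ mkℚᵘ i 0
  toℚᵘ-ℤ→ℚ i = ℚ.toℚᵘ-fromℚᵘ (mkℚᵘ i 0)

  ℤ→ℚ-+ : ∀ i j → ℤ→ℚ (i ℤ.+ j) ≡ ℤ→ℚ i + ℤ→ℚ j
  ℤ→ℚ-+ i j = ℚ.toℚᵘ-injective (begin
    toℚᵘ (ℤ→ℚ (i ℤ.+ j))              ≈⟨ toℚᵘ-ℤ→ℚ (i ℤ.+ j) ⟩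
    mkℚᵘ (i ℤ.+ j) 0
      ≈⟨ *≡* (cong (ℤ._* ℤ.+ 1) (cong₂ ℤ._+_ (ℤ.*-identityʳ i) (ℤ.*-identityʳ j))) ⟨
    mkℚᵘ i 0 ℚᵘ.+ mkℚᵘ j 0            ≈⟨ ℚᵘ.+-cong (toℚᵘ-ℤ→ℚ i) (toℚᵘ-ℤ→ℚ j) ⟨
    toℚᵘ (ℤ→ℚ i) ℚᵘ.+ toℚᵘ (ℤ→ℚ j)    ≈⟨ ℚ.toℚᵘ-homo-+ (ℤ→ℚ i) (ℤ→ℚ j) ⟨
    toℚᵘ (ℤ→ℚ i + ℤ→ℚ j)              ∎)
    where open ℚᵘ.≃-Reasoning

  ℤ→ℚ-* : ∀ i j → ℤ→ℚ (i ℤ.* j) ≡ ℤ→ℚ i * ℤ→ℚ j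
  ℤ→ℚ-* i j = ℚ.toℚᵘ-injective (begin
    toℚᵘ (ℤ→ℚ (i ℤ.* j))              ≈⟨ toℚᵘ-ℤ→ℚ (i ℤ.* j) ⟩
    mkℚᵘ i 0 ℚᵘ.* mkℚᵘ j 0            ≈⟨ ℚᵘ.*-cong (toℚᵘ-ℤ→ℚ i) (toℚᵘ-ℤ→ℚ j) ⟨
    toℚᵘ (ℤ→ℚ i) ℚᵘ.* toℚᵘ (ℤ→ℚ j)    ≈⟨ ℚ.toℚᵘ-homo-* (ℤ→ℚ i) (ℤ→ℚ j) ⟨
    toℚᵘ (ℤ→ℚ i * ℤ→ℚ j)              ∎)
    where open ℚᵘ.≃-Reasoning

  ℤ→ℚ-neg : ∀ i → ℤ→ℚ (ℤ.- i) ≡ - ℤ→ℚ i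
  ℤ→ℚ-neg i = begin
    ℤ→ℚ (ℤ.- i)               ≡⟨ cong ℤ→ℚ (ℤ.-1*i≡-i i) ⟨
    ℤ→ℚ (ℤ.-1ℤ ℤ.* i)         ≡⟨ ℤ→ℚ-* ℤ.-1ℤ i ⟩
    ℤ→ℚ ℤ.-1ℤ * ℤ→ℚ i         ≡⟨ neg (ℤ→ℚ i) ⟩
    - ℤ→ℚ i                   ∎
    where
    open ≡-Reasoning
    neg : ∀ x → ℤ→ℚ ℤ.-1ℤ * x ≡ - x
    neg = solve-∀ ring

  ℤ→ℚ-injective : ∀ {i j} → ℤ→ℚ i ≡ ℤ→ℚ j → i ≡ j
  ℤ→ℚ-injective {i} {j} eq = begin
    i            ≡⟨ ℤ.*-identityʳ i ⟨
    i ℤ.* ℤ.+ 1    ≡⟨ ℚᵘ.drop-*≡* (ℚ./-injective-≃ (mkℚᵘ i 0) (mkℚᵘ j 0) eq) ⟩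
    j ℤ.* ℤ.+ 1    ≡⟨ ℤ.*-identityʳ j ⟩
    j            ∎
    where open ≡-Reasoning

  2ℚ 3ℚ 4ℚ 7ℚ 8ℚ 16ℚ 20ℚ 32ℚ ⅓ ¼ : ℚ
  2ℚ  = ℤ→ℚ (ℤ.+ 2)
  3ℚ  = ℤ→ℚ (ℤ.+ 3)
  4ℚ  = ℤ→ℚ (ℤ.+ 4)
  7ℚ  = ℤ→ℚ (ℤ.+ 7)
  8ℚ  = ℤ→ℚ (ℤ.+ 8)
  16ℚ = ℤ→ℚ (ℤ.+ 16)
  20ℚ = ℤ→ℚ (ℤ.+ 20)
  32ℚ = ℤ→ℚ (ℤ.+ 32)
  ⅓   = 1/1+ 2
  ¼   = 1/1+ 3

  2n+1 : ℚ → ℚ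
  2n+1 x = 2ℚ * x + 1ℚ

  /-*-cancel : ∀ i n → (i / suc n) * ℤ→ℚ (ℤ.+ suc n) ≡ ℤ→ℚ i
  /-*-cancel i n = ℚ.toℚᵘ-injective (begin
    toℚᵘ ((i / suc n) * ℤ→ℚ (ℤ.+ suc n))              ≈⟨ ℚ.toℚᵘ-homo-* (i / suc n) (ℤ→ℚ (ℤ.+ suc n)) ⟩
    toℚᵘ (i / suc n) ℚᵘ.* toℚᵘ (ℤ→ℚ (ℤ.+ suc n))
      ≈⟨ ℚᵘ.*-cong (ℚ.toℚᵘ-fromℚᵘ (mkℚᵘ i n)) (toℚᵘ-ℤ→ℚ (ℤ.+ suc n)) ⟩
    mkℚᵘ i n ℚᵘ.* mkℚᵘ (ℤ.+ suc n) 0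
      ≈⟨ *≡* (trans (ℤ.*-identityʳ (i ℤ.* ℤ.+ suc n))
          (cong (λ m → i ℤ.* ℤ.+ m) (sym (ℕ.*-identityʳ (suc n))))) ⟩
    mkℚᵘ i 0                                          ≈⟨ toℚᵘ-ℤ→ℚ i ⟨
    toℚᵘ (ℤ→ℚ i)                                      ∎)
    where open ℚᵘ.≃-Reasoning

  1/1+-inverse : ∀ n → 1/1+ n * ℤ→ℚ (ℤ.+ suc n) ≡ 1ℚ
  1/1+-inverse = /-*-cancel (ℤ.+ 1)

  -- Opaque, so that unification does not unfold the normalisation of fractions.

  opaque
    nat : ℕ → ℚ
    nat n = ℤ→ℚ (ℤ.+ n)

    1/odd : ℕ → ℚ
    1/odd m = 1/1+ (2 ℕ.* m)

    nat≡ : ∀ n → nat n ≡ ℤ→ℚ (ℤ.+ n)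
    nat≡ n = refl

    nat-+ : ∀ m n → nat (m ℕ.+ n) ≡ nat m + nat n
    nat-+ m n = ℤ→ℚ-+ (ℤ.+ m) (ℤ.+ n)

    nat-* : ∀ m n → nat (m ℕ.* n) ≡ nat m * nat n
    nat-* m n = trans (cong ℤ→ℚ (ℤ.pos-* m n)) (ℤ→ℚ-* (ℤ.+ m) (ℤ.+ n))

    nat-suc : ∀ n → nat (suc n) ≡ 1ℚ + nat n
    nat-suc = nat-+ 1

    0≤nat : ∀ n → 0ℚ ≤ nat n
    0≤nat n = ℚ.nonNegative⁻¹ (nat n) {{ℚ.normalize-nonNeg n 1}}

    0≤1/odd : ∀ m → 0ℚ ≤ 1/odd m
    0≤1/odd m = 0≤1/1+ (2 ℕ.* m)

    1/odd≡ : ∀ m → 1/odd m ≡ 1/1+ (2 ℕ.* m)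
    1/odd≡ m = refl

  1/1+-inverse-nat : ∀ n → 1/1+ n * nat (suc n) ≡ 1ℚ
  1/1+-inverse-nat n = trans (cong (1/1+ n *_) (nat≡ (suc n))) (1/1+-inverse n)

  nat-odd : ∀ m → nat (suc (2 ℕ.* m)) ≡ 2n+1 (nat m)
  nat-odd m = begin
    nat (suc (2 ℕ.* m))    ≡⟨ nat-suc (2 ℕ.* m) ⟩
    1ℚ + nat (2 ℕ.* m)     ≡⟨ cong (1ℚ +_) (nat-* 2 m) ⟩
    1ℚ + nat 2 * nat m     ≡⟨ cong (λ x → 1ℚ + x * nat m) (nat≡ 2) ⟩
    1ℚ + 2ℚ * nat m        ≡⟨ ℚ.+-comm 1ℚ (2ℚ * nat m) ⟩
    2n+1 (nat m)           ∎
    where open ≡-Reasoning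

  1/odd-inverse : ∀ m → 1/odd m * 2n+1 (nat m) ≡ 1ℚ
  1/odd-inverse m = trans (cong₂ _*_ (1/odd≡ m) (sym (nat-odd m))) (1/1+-inverse-nat (2 ℕ.* m))

  -- Identities that hold modulo a relation a ≡ b, such as i * n ≡ 1 for an inverse i.

  modulo : ∀ {l r a b} c → a ≡ b → l - r ≡ c * (a - b) → l ≡ r
  modulo {l} {r} {a} {b} c refl eq = begin
    l              ≡⟨ split l r ⟩
    (l - r) + r    ≡⟨ cong (_+ r) eq ⟩
    c * (a - a) + r ≡⟨ vanish c a r ⟩
    r              ∎
    where
    open ≡-Reasoning
    split : ∀ l r → l ≡ (l - r) + r
    split = solve-∀ ring
    vanish : ∀ c a r → c * (a - a) + r ≡ r
    vanish = solve-∀ ring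

  modulo₂ : ∀ {l r a b a′ b′} c c′ → a ≡ b → a′ ≡ b′ →
            l - r ≡ c * (a - b) + c′ * (a′ - b′) → l ≡ r
  modulo₂ {a′ = a′} c c′ a≡b refl eq = modulo c a≡b (trans eq (vanish c′ a′ _))
    where
    vanish : ∀ c a x → x + c * (a - a) ≡ x
    vanish = solve-∀ ring

  nat-mono : ∀ {m n} → m ℕ.≤ n → nat m ≤ nat n
  nat-mono {m} {n} m≤n = begin
    nat m                   ≡⟨ ℚ.+-identityʳ (nat m) ⟨
    nat m + 0ℚ              ≤⟨ ℚ.+-monoʳ-≤ (nat m) (0≤nat (n ℕ.∸ m)) ⟩
    nat m + nat (n ℕ.∸ m)   ≡⟨ nat-+ m (n ℕ.∸ m) ⟨
    nat (m ℕ.+ (n ℕ.∸ m))   ≡⟨ cong nat (ℕ.m+[n∸m]≡n m≤n) ⟩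
    nat n                   ∎
    where open ℚ.≤-Reasoning

  0≤1 : 0ℚ ≤ 1ℚ
  0≤1 = ℚ.nonNegative⁻¹ 1ℚ

  0<1 : 0ℚ < 1ℚ
  0<1 = ℚ.positive⁻¹ 1ℚ

  0≤+ : ∀ {p q} → 0ℚ ≤ p → 0ℚ ≤ q → 0ℚ ≤ p + q
  0≤+ = ℚ.+-mono-≤

  *-mono : ∀ {p q r s} → 0ℚ ≤ q → 0ℚ ≤ r → p ≤ q → r ≤ s → p * r ≤ q * s
  *-mono {p} {q} {r} {s} 0≤q 0≤r p≤q r≤s = ℚ.≤-trans
    (ℚ.*-monoʳ-≤-nonNeg r {{nonNegative 0≤r}} p≤q)
    (ℚ.*-monoˡ-≤-nonNeg q {{nonNegative 0≤q}} r≤s)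

  *-monoʳ : ∀ {r p q} → 0ℚ ≤ r → p ≤ q → r * p ≤ r * q
  *-monoʳ {r} 0≤r = ℚ.*-monoˡ-≤-nonNeg r {{nonNegative 0≤r}}

  *-monoˡ : ∀ {r p q} → 0ℚ ≤ r → p ≤ q → p * r ≤ q * r
  *-monoˡ {r} 0≤r = ℚ.*-monoʳ-≤-nonNeg r {{nonNegative 0≤r}}

  0≤* : ∀ {p q} → 0ℚ ≤ p → 0ℚ ≤ q → 0ℚ ≤ p * q
  0≤* {p} {q} 0≤p 0≤q = ℚ.≤-trans (ℚ.≤-reflexive (sym (ℚ.*-zeroʳ p))) (*-monoʳ 0≤p 0≤q)

  0≤^ : ∀ {p} n → 0ℚ ≤ p → 0ℚ ≤ p ^ n
  0≤^ zero    0≤p = 0≤1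
  0≤^ (suc n) 0≤p = 0≤* 0≤p (0≤^ n 0≤p)

  0≤² : ∀ p → 0ℚ ≤ p * p
  0≤² p with ℚ.≤-total 0ℚ p
  ... | inj₁ 0≤p = 0≤* 0≤p 0≤p
  ... | inj₂ p≤0 = subst (0ℚ ≤_) (square p) (0≤* (ℚ.neg-antimono-≤ p≤0) (ℚ.neg-antimono-≤ p≤0))
    where
    square : ∀ p → - p * - p ≡ p * p
    square = solve-∀ ring

  ≤-+ : ∀ {p q} r → 0ℚ ≤ r → q ≡ p + r → p ≤ q
  ≤-+ {p} r 0≤r refl = subst (_≤ p + r) (ℚ.+-identityʳ p) (ℚ.+-monoʳ-≤ p 0≤r)

  0≤∸ : ∀ {p q} → p ≤ q → 0ℚ ≤ q - p
  0≤∸ {p} {q} p≤q = subst (_≤ q - p) (ℚ.+-inverseʳ p) (ℚ.+-monoˡ-≤ (- p) p≤q)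

  0≤∸⁻¹ : ∀ {p q} → 0ℚ ≤ q - p → p ≤ q
  0≤∸⁻¹ {p} {q} le = ≤-+ (q - p) le (split p q)
    where
    split : ∀ p q → q ≡ p + (q - p)
    split = solve-∀ ring

  p≤∣p∣ : ∀ p → p ≤ ∣ p ∣
  p≤∣p∣ p with ℚ.≤-total 0ℚ p
  ... | inj₁ 0≤p = ℚ.≤-reflexive (sym (ℚ.0≤p⇒∣p∣≡p 0≤p))
  ... | inj₂ p≤0 = ℚ.≤-trans p≤0 (ℚ.0≤∣p∣ p)

  ∣∣≤ : ∀ {p c} → p ≤ c → - p ≤ c → ∣ p ∣ ≤ c
  ∣∣≤ {p} {c} p≤c -p≤c with ℚ.∣p∣≡p∨∣p∣≡-p p
  ... | inj₁ eq = subst (_≤ c) (sym eq) p≤c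
  ... | inj₂ eq = subst (_≤ c) (sym eq) -p≤c

  ∣+∣≤ : ∀ {p q a b} → ∣ p ∣ ≤ a → ∣ q ∣ ≤ b → ∣ p + q ∣ ≤ a + b
  ∣+∣≤ {p} {q} h h′ = ℚ.≤-trans (ℚ.∣p+q∣≤∣p∣+∣q∣ p q) (ℚ.+-mono-≤ h h′)

  ∣-∣≤ : ∀ {p q a b} → ∣ p ∣ ≤ a → ∣ q ∣ ≤ b → ∣ p - q ∣ ≤ a + b
  ∣-∣≤ {p} {q} h h′ = ℚ.≤-trans (ℚ.∣p-q∣≤∣p∣+∣q∣ p q) (ℚ.+-mono-≤ h h′)

  ∣*∣≤ : ∀ {p q a b} → ∣ p ∣ ≤ a → ∣ q ∣ ≤ b → ∣ p * q ∣ ≤ a * b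
  ∣*∣≤ {p} {q} {a} {b} h h′ = subst (_≤ a * b) (sym (ℚ.∣p*q∣≡∣p∣*∣q∣ p q))
    (*-mono (ℚ.≤-trans (ℚ.0≤∣p∣ p) h) (ℚ.0≤∣p∣ q) h h′)

  ∣p-q∣≡∣q-p∣ : ∀ p q → ∣ p - q ∣ ≡ ∣ q - p ∣
  ∣p-q∣≡∣q-p∣ p q = trans (cong ∣_∣ (flip p q)) (ℚ.∣-p∣≡∣p∣ (q - p))
    where
    flip : ∀ p q → p - q ≡ - (q - p)
    flip = solve-∀ ring

  ∣-∣-triangle : ∀ {p r a b} q → ∣ p - q ∣ ≤ a → ∣ q - r ∣ ≤ b → ∣ p - r ∣ ≤ a + b
  ∣-∣-triangle {p} {r} {a} {b} q h h′ = subst (λ x → ∣ x ∣ ≤ a + b) (split p q r) (∣+∣≤ h h′)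
    where
    split : ∀ p q r → (p - q) + (q - r) ≡ p - r
    split = solve-∀ ring

  partialSum-suc : ∀ f n → partialSum f (suc n) ≡ partialSum f n + f n
  partialSum-suc f zero    = ℚ.+-comm (f 0) 0ℚ
  partialSum-suc f (suc n) = trans (cong (f 0 +_) (partialSum-suc (f ∘ suc) n))
    (sym (ℚ.+-assoc (f 0) (partialSum (f ∘ suc) n) (f (suc n))))

  partialSum-++ : ∀ f m n → partialSum f (m ℕ.+ n) ≡ partialSum f m + partialSum (f ∘ (m ℕ.+_)) n
  partialSum-++ f zero    n = sym (ℚ.+-identityˡ (partialSum f n))
  partialSum-++ f (suc m) n = trans (cong (f 0 +_) (partialSum-++ (f ∘ suc) m n))
    (sym (ℚ.+-assoc (f 0) (partialSum (f ∘ suc) m) (partialSum (f ∘ (suc m ℕ.+_)) n)))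

  *-partialSum : ∀ c f n → c * partialSum f n ≡ partialSum (λ i → c * f i) n
  *-partialSum c f zero    = ℚ.*-zeroʳ c
  *-partialSum c f (suc n) =
    trans (ℚ.*-distribˡ-+ c (f 0) (partialSum (f ∘ suc) n)) (cong (c * f 0 +_) (*-partialSum c (f ∘ suc) n))

  partialSum-cong< : ∀ {f g : ℕ → ℚ} n → (∀ i → i ℕ.< n → f i ≡ g i) → partialSum f n ≡ partialSum g n
  partialSum-cong< zero    f≗g = refl
  partialSum-cong< (suc n) f≗g =
    cong₂ _+_ (f≗g 0 (s≤s z≤n)) (partialSum-cong< n (λ i i<n → f≗g (suc i) (s≤s i<n)))

  ∣^∣≤ : ∀ {p q} n → ∣ p ∣ ≤ q → ∣ p ^ n ∣ ≤ q ^ n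
  ∣^∣≤ zero    ∣p∣≤q = ℚ.≤-refl
  ∣^∣≤ (suc n) ∣p∣≤q = ∣*∣≤ ∣p∣≤q (∣^∣≤ n ∣p∣≤q)

  ∣^∣≤1 : ∀ {p} n → ∣ p ∣ ≤ 1ℚ → ∣ p ^ n ∣ ≤ 1ℚ
  ∣^∣≤1 zero    ∣p∣≤1 = ℚ.≤-refl
  ∣^∣≤1 (suc n) ∣p∣≤1 = ∣*∣≤ {a = 1ℚ} {b = 1ℚ} ∣p∣≤1 (∣^∣≤1 n ∣p∣≤1)

  ^-mono : ∀ {p q} n → 0ℚ ≤ p → p ≤ q → p ^ n ≤ q ^ n
  ^-mono zero    0≤p p≤q = ℚ.≤-refl
  ^-mono (suc n) 0≤p p≤q = *-mono (ℚ.≤-trans 0≤p p≤q) (0≤^ n 0≤p) p≤q (^-mono n 0≤p p≤q)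

-- The truncated antidifference `h` of the series for π.

module Series where

  open Arithmetic

  -¼ -4ℚ : ℚ
  -¼  = - ¼
  -4ℚ = - 4ℚ

  nat0 : nat 0 ≡ 0ℚ
  nat0 = nat≡ 0

  -- y m N is the real part of (4 - 2i) c ^ N (1 - 4 / c) ^ m for c = (1 + i) / 2. The
  -- row y 0, shifted by one, is the power series of (6 - 4 w) / (w ^ 2 - 2 w + 2) in w.

  y : ℕ → ℕ → ℚ
  y zero    zero          = 4ℚ
  y zero    (suc zero)    = 3ℚ
  y zero    (suc (suc N)) = y zero (suc N) - ½ * y zero N
  y (suc m) N             = 8ℚ * y m (suc N) - 7ℚ * y m N

  y-recurrence : ∀ m N → y m (suc (suc N)) ≡ y m (suc N) - ½ * y m N
  y-recurrence zero    N = refl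
  y-recurrence (suc m) N
    rewrite y-recurrence m (suc N) | y-recurrence m N = identity (y m N) (y m (suc N))
    where
    identity : ∀ a b → 8ℚ * ((b - ½ * a) - ½ * b) - 7ℚ * (b - ½ * a) ≡
      (8ℚ * (b - ½ * a) - 7ℚ * b) - ½ * (8ℚ * b - 7ℚ * a)
    identity = solve-∀ ring

  -- In terms of `q = 1 - 4 / c` this is `c q = c - 4`, the relation that drives the induction in
  -- `h-difference`.
  y-diagonal : ∀ m N → y (suc m) (suc N) ≡ y m (suc N) - 4ℚ * y m N
  y-diagonal m N rewrite y-recurrence m N = identity (y m N) (y m (suc N))
    where
    identity : ∀ a b → 8ℚ * (b - ½ * a) - 7ℚ * b ≡ b - 4ℚ * a
    identity = solve-∀ ring

  y-period : ∀ m N → y m (4 ℕ.+ N) ≡ -¼ * y m N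
  y-period m N
    rewrite y-recurrence m (suc (suc N)) | y-recurrence m (suc N) | y-recurrence m N
    = identity (y m N) (y m (suc N))
    where
    identity : ∀ a b → ((b - ½ * a) - ½ * b) - ½ * (b - ½ * a) ≡ -¼ * a
    identity = solve-∀ ring

  y-periodic : ∀ m k N → y m (k ℕ.* 4 ℕ.+ N) ≡ -¼ ^ k * y m N
  y-periodic m zero    N = sym (ℚ.*-identityˡ (y m N))
  y-periodic m (suc k) N = begin
    y m (4 ℕ.+ (k ℕ.* 4 ℕ.+ N))     ≡⟨ y-period m (k ℕ.* 4 ℕ.+ N) ⟩
    -¼ * y m (k ℕ.* 4 ℕ.+ N)        ≡⟨ cong (-¼ *_) (y-periodic m k N) ⟩
    -¼ * (-¼ ^ k * y m N)           ≡⟨ ℚ.*-assoc -¼ (-¼ ^ k) (y m N) ⟨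
    -¼ ^ suc k * y m N              ∎
    where open ≡-Reasoning

  -- β N = 1 / (2N choose N) and b N is the integral of (x - x ^ 2) ^ N over [0, 1].

  β : ℕ → ℚ
  β zero    = 1ℚ
  β (suc N) = β N * ((1ℚ + nat N) * ½ * 1/odd N)

  b : ℕ → ℚ
  b N = β N * 1/odd N

  -- The quotient of rising factorials `(1/2 - x)_m / (1/2)_m`.
  Π : ℕ → ℚ → ℚ
  Π zero    x = 1ℚ
  Π (suc m) x = Π m x * (1ℚ - 2ℚ * x * 1/odd m)

  1/odd-suc-inverse : ∀ m → 1/odd (suc m) * 2n+1 (1ℚ + nat m) ≡ 1ℚ
  1/odd-suc-inverse m = trans (cong (λ x → 1/odd (suc m) * 2n+1 x) (sym (nat-suc m))) (1/odd-inverse (suc m))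

  1/odd-difference : ∀ m → 1/odd m ≡ 1/odd (suc m) + 2ℚ * (1/odd m * 1/odd (suc m))
  1/odd-difference m = trans (expand (1/odd m) (1/odd (suc m)) (nat m)) (trans
    (cong₂ (λ u v → 1/odd m * (1ℚ - u) + 1/odd (suc m) * v + 2ℚ * (1/odd m * 1/odd (suc m)))
        (1/odd-suc-inverse m) (1/odd-inverse m))
    (collapse (1/odd m) (1/odd (suc m))))
    where
    expand : ∀ i i′ x → i ≡ i * (1ℚ - i′ * (2ℚ * (1ℚ + x) + 1ℚ)) + i′ * (i * (2ℚ * x + 1ℚ)) + 2ℚ * (i * i′)
    expand = solve-∀ ring
    collapse : ∀ i i′ → i * (1ℚ - 1ℚ) + i′ * 1ℚ + 2ℚ * (i * i′) ≡ i′ + 2ℚ * (i * i′)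
    collapse = solve-∀ ring

  1/odd-zero : 1/odd 0 ≡ 1ℚ
  1/odd-zero = 1/odd≡ 0

  Π-shift : ∀ m x → Π (suc m) (1ℚ + x) ≡ - (2ℚ * x + 1ℚ) * 1/odd m * Π m x
  Π-shift zero x rewrite 1/odd-zero = identity x
    where
    identity : ∀ x → 1ℚ * (1ℚ - 2ℚ * (1ℚ + x) * 1ℚ) ≡ - (2ℚ * x + 1ℚ) * 1ℚ * 1ℚ
    identity = solve-∀ ring
  Π-shift (suc m) x = trans
    (cong (_* (1ℚ - 2ℚ * (1ℚ + x) * 1/odd (suc m))) (Π-shift m x))
    (modulo (- (2ℚ * x + 1ℚ) * Π m x) (1/odd-difference m) (identity (Π m x) (1/odd m) (1/odd (suc m)) x))
    where
    identity : ∀ p i i′ x →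
      - (2ℚ * x + 1ℚ) * i * p * (1ℚ - 2ℚ * (1ℚ + x) * i′) - - (2ℚ * x + 1ℚ) * i′ * (p * (1ℚ - 2ℚ * x * i)) ≡
      (- (2ℚ * x + 1ℚ) * p) * (i - (i′ + 2ℚ * (i * i′)))
    identity = solve-∀ ring

  Π-shift-nat : ∀ m N → Π (suc m) (nat (suc N)) ≡ - (2n+1 (nat N)) * 1/odd m * Π m (nat N)
  Π-shift-nat m N = trans (cong (Π (suc m)) (nat-suc N)) (Π-shift m (nat N))

  -- For d → ∞, h d N would be an exact antidifference of - b N * y 0 (suc N); truncation
  -- leaves a defect that is hypergeometric in N.

  τ h : ℕ → ℕ → ℚ
  τ d N = partialSum (λ m → y m N * 1/odd m * Π m (nat N)) d
  h d N = -4ℚ * β N * τ d N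

  -- For `d = 0` both sides are trivial since `Π 0` is 1. Each further summand of `τ`, taken at `N`
  -- and at `suc N`, turns the defect of order `d` into that of order `suc d`: `y-diagonal` handles
  -- the factor `y`, and `Π-shift-nat` the factor `Π`.
  h-difference : ∀ d N → h d (suc N) ≡ h d N + b N * (y d (suc N) * Π d (nat (suc N)) - y 0 (suc N))
  h-difference zero N = identity (β N) (β (suc N)) (b N) (y 0 (suc N))
    where
    identity : ∀ B B′ b y → -4ℚ * B′ * 0ℚ ≡ -4ℚ * B * 0ℚ + b * (y * 1ℚ - y)
    identity = solve-∀ ring
  h-difference (suc d) N = begin
    -4ℚ * β (suc N) * τ (suc d) (suc N)
      ≡⟨ cong (-4ℚ * β (suc N) *_) (partialSum-suc (λ m → y m (suc N) * 1/odd m * Π m (nat (suc N))) d) ⟩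
    -4ℚ * β (suc N) * (τ d (suc N) + Y₁ * i * P′)
      ≡⟨ ℚ.*-distribˡ-+ (-4ℚ * β (suc N)) (τ d (suc N)) (Y₁ * i * P′) ⟩
    h d (suc N) + -4ℚ * β (suc N) * (Y₁ * i * P′)
      ≡⟨ cong (_+ -4ℚ * β (suc N) * (Y₁ * i * P′)) (h-difference d N) ⟩
    h d N + b N * (Y₁ * P′ - y 0 (suc N)) + -4ℚ * β (suc N) * (Y₁ * i * P′)
      ≡⟨ rearrange (h d N) (β N) j i Y₀ Y₁ P P′ (nat N) (y 0 (suc N)) (1/odd-inverse N) shift ⟩
    h d N + -4ℚ * β N * (Y₀ * i * P) + b N * ((Y₁ - 4ℚ * Y₀) * (- (2n+1 (nat N)) * i * P) - y 0 (suc N))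
      ≡⟨ cong₂ (λ u v → h d N + -4ℚ * β N * (Y₀ * i * P) + b N * (u * v - y 0 (suc N)))
        (sym (y-diagonal d N)) (sym (Π-shift-nat d N)) ⟩
    h d N + -4ℚ * β N * (Y₀ * i * P) + b N * (y (suc d) (suc N) * Π (suc d) (nat (suc N)) - y 0 (suc N))
      ≡⟨ cong (_+ b N * (y (suc d) (suc N) * Π (suc d) (nat (suc N)) - y 0 (suc N)))
        (ℚ.*-distribˡ-+ (-4ℚ * β N) (τ d N) (Y₀ * i * P)) ⟨
    -4ℚ * β N * (τ d N + Y₀ * i * P) + b N * (y (suc d) (suc N) * Π (suc d) (nat (suc N)) - y 0 (suc N))
      ≡⟨ cong (λ t → -4ℚ * β N * t + b N * (y (suc d) (suc N) * Π (suc d) (nat (suc N)) - y 0 (suc N)))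
        (partialSum-suc (λ m → y m N * 1/odd m * Π m (nat N)) d) ⟨
    h (suc d) N + b N * (y (suc d) (suc N) * Π (suc d) (nat (suc N)) - y 0 (suc N)) ∎
    where
    open ≡-Reasoning
    i j Y₀ Y₁ P P′ : ℚ
    i  = 1/odd d
    j  = 1/odd N
    Y₀ = y d N
    Y₁ = y d (suc N)
    P  = Π d (nat N)
    P′ = Π d (nat (suc N))
    shift : P′ * (1ℚ - 2ℚ * (1ℚ + nat N) * i) ≡ - (2n+1 (nat N)) * i * P
    shift = trans (cong (λ x → P′ * (1ℚ - 2ℚ * x * i)) (sym (nat-suc N))) (Π-shift-nat d N)
    identity : ∀ H B j i Y₀ Y₁ P P′ n y₀ →
      H + B * j * (Y₁ * P′ - y₀) + -4ℚ * (B * ((1ℚ + n) * ½ * j)) * (Y₁ * i * P′) -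
      (H + -4ℚ * B * (Y₀ * i * P) + B * j * ((Y₁ - 4ℚ * Y₀) * (- (2ℚ * n + 1ℚ) * i * P) - y₀)) ≡
      (B * j * Y₁) * (P′ * (1ℚ - 2ℚ * (1ℚ + n) * i) - - (2ℚ * n + 1ℚ) * i * P) +
      (-4ℚ * B * Y₀ * i * P) * (j * (2ℚ * n + 1ℚ) - 1ℚ)
    identity = solve-∀ ring
    rearrange : ∀ H B j i Y₀ Y₁ P P′ n y₀ → j * (2ℚ * n + 1ℚ) ≡ 1ℚ →
      P′ * (1ℚ - 2ℚ * (1ℚ + n) * i) ≡ - (2ℚ * n + 1ℚ) * i * P →
      H + B * j * (Y₁ * P′ - y₀) + -4ℚ * (B * ((1ℚ + n) * ½ * j)) * (Y₁ * i * P′) ≡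
      H + -4ℚ * B * (Y₀ * i * P) + B * j * ((Y₁ - 4ℚ * Y₀) * (- (2ℚ * n + 1ℚ) * i * P) - y₀)
    rearrange H B j i Y₀ Y₁ P P′ n y₀ inv sh =
      modulo₂ (B * j * Y₁) (-4ℚ * B * Y₀ * i * P) sh inv (identity H B j i Y₀ Y₁ P P′ n y₀)

  -- Q r m is the polynomial β (r + N) * Π m (r + N) / β N in N, for r ≤ m only.

  Q : ℕ → ℕ → ℚ → ℚ
  Q zero    m       x = Π m x
  Q (suc r) zero    x = 0ℚ
  Q (suc r) (suc m) x = (- ½ * 1/odd m) * ((x + nat (suc r)) * Q r m x)

  -- The factor `2N + 1` released by `Π-shift-nat` cancels the denominator of `β (suc N) / β N`, so
  -- the quotient stays polynomial in `N`.
  β-Π-suc : ∀ m N → β (suc N) * Π (suc m) (nat (suc N)) ≡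
      (- ½ * 1/odd m) * ((1ℚ + nat N) * (β N * Π m (nat N)))
  β-Π-suc m N = trans (cong (β (suc N) *_) (Π-shift-nat m N))
    (modulo (- ½ * 1/odd m * (1ℚ + nat N) * β N * Π m (nat N)) (1/odd-inverse N)
      (identity (β N) (nat N) (1/odd N) (1/odd m) (Π m (nat N))))
    where
    identity : ∀ B n j i p →
      B * ((1ℚ + n) * ½ * j) * (- (2ℚ * n + 1ℚ) * i * p) - (- ½ * i) * ((1ℚ + n) * (B * p)) ≡
      (- ½ * i * (1ℚ + n) * B * p) * (j * (2ℚ * n + 1ℚ) - 1ℚ)
    identity = solve-∀ ring

  -- The same cancellation removes the `2N + 1` in `b N`. No linear factor comes in return for the
  -- lost factor of `Π`, which is why the block polynomial has degree `e` and not `suc e`.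
  b-Π-suc : ∀ m N → b N * Π (suc m) (nat (suc N)) ≡ - 1/odd m * (β N * Π m (nat N))
  b-Π-suc m N = trans (cong (b N *_) (Π-shift-nat m N))
    (modulo (- 1/odd m * β N * Π m (nat N)) (1/odd-inverse N)
      (identity (β N) (nat N) (1/odd N) (1/odd m) (Π m (nat N))))
    where
    identity : ∀ B n j i p →
      B * j * (- (2ℚ * n + 1ℚ) * i * p) - - i * (B * p) ≡
      (- i * B * p) * (j * (2ℚ * n + 1ℚ) - 1ℚ)
    identity = solve-∀ ring

  β-Π-Q : ∀ {r m} N → r ℕ.≤ m → β (r ℕ.+ N) * Π m (nat (r ℕ.+ N)) ≡ β N * Q r m (nat N)
  β-Π-Q {zero}          N z≤n       = refl
  β-Π-Q {suc r} {suc m} N (s≤s r≤m) = begin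
    β (suc (r ℕ.+ N)) * Π (suc m) (nat (suc (r ℕ.+ N)))
      ≡⟨ β-Π-suc m (r ℕ.+ N) ⟩
    (- ½ * 1/odd m) * ((1ℚ + nat (r ℕ.+ N)) * (β (r ℕ.+ N) * Π m (nat (r ℕ.+ N))))
      ≡⟨ cong₂ (λ u v → (- ½ * 1/odd m) * (u * v)) argument (β-Π-Q N r≤m) ⟩
    (- ½ * 1/odd m) * ((nat N + nat (suc r)) * (β N * Q r m (nat N)))
      ≡⟨ identity (- ½ * 1/odd m) (nat N + nat (suc r)) (β N) (Q r m (nat N)) ⟩
    β N * Q (suc r) (suc m) (nat N) ∎
    where
    open ≡-Reasoning
    argument : 1ℚ + nat (r ℕ.+ N) ≡ nat N + nat (suc r)
    argument = trans (sym (nat-suc (r ℕ.+ N))) (trans (cong nat (ℕ.+-comm (suc r) N)) (nat-+ N (suc r)))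
    identity : ∀ c u B q → c * (u * (B * q)) ≡ B * (c * (u * q))
    identity = solve-∀ ring

  -- The defect of h on a block of suc e consecutive indices, as a multiple of β N.

  s₀ : ℕ → ℚ → ℚ
  s₀ e x = partialSum (λ r → (y (suc e) (suc r) * - 1/odd e) * Q r e x) (suc e)

  3^ : ℕ → ℚ
  3^ N = 3ℚ ^ N

  Π-zero : ∀ m → Π m (nat 0) ≡ 1ℚ
  Π-zero zero    = refl
  Π-zero (suc m) = trans (cong₂ (λ p x → p * (1ℚ - 2ℚ * x * 1/odd m)) (Π-zero m) nat0) (identity (1/odd m))
    where
    identity : ∀ i → 1ℚ * (1ℚ - 2ℚ * 0ℚ * i) ≡ 1ℚ
    identity = solve-∀ ring

  1/odd≤1 : ∀ m → 1/odd m ≤ 1ℚ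
  1/odd≤1 m = ≤-+ (2ℚ * (1/odd m * nat m)) (0≤* (ℚ.nonNegative⁻¹ 2ℚ) (0≤* (0≤1/odd m) (0≤nat m)))
    (trans (sym (1/odd-inverse m)) (identity (1/odd m) (nat m)))
    where
    identity : ∀ i n → i * (2ℚ * n + 1ℚ) ≡ i + 2ℚ * (i * n)
    identity = solve-∀ ring

  -- The bound is uniform in `m`. Moving from `N` to `suc N` adds at most twice a value with the
  -- same bound, so it triples; the base 3 stays below 4, the growth rate of `1 / β`.
  ∣Π∣≤3^ : ∀ m N → ∣ Π m (nat N) ∣ ≤ 3^ N
  ∣Π∣≤3^ m       zero    = ℚ.≤-reflexive (cong ∣_∣ (Π-zero m))
  ∣Π∣≤3^ zero    (suc N) = ℚ.≤-trans (∣Π∣≤3^ zero N)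
    (≤-+ (2ℚ * 3^ N) (0≤* (ℚ.nonNegative⁻¹ 2ℚ) (0≤^ N (ℚ.nonNegative⁻¹ 3ℚ))) (identity (3^ N)))
    where
    identity : ∀ p → 3ℚ * p ≡ p + 2ℚ * p
    identity = solve-∀ ring
  ∣Π∣≤3^ (suc m) (suc N) = begin
    ∣ Π (suc m) (nat (suc N)) ∣
      ≡⟨ cong ∣_∣ (trans (Π-shift-nat m N) (split (nat N) (1/odd m) (Π m (nat N)))) ⟩
    ∣ Π (suc m) (nat N) - (1ℚ + 1/odd m) * Π m (nat N) ∣
      ≤⟨ ∣-∣≤ (∣Π∣≤3^ (suc m) N) (∣*∣≤ ∣1+i∣≤2 (∣Π∣≤3^ m N)) ⟩
    3^ N + 2ℚ * 3^ N
      ≡⟨ collect (3^ N) ⟩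
    3^ (suc N) ∎
    where
    open ℚ.≤-Reasoning
    split : ∀ n i p → - (2ℚ * n + 1ℚ) * i * p ≡ p * (1ℚ - 2ℚ * n * i) - (1ℚ + i) * p
    split = solve-∀ ring
    collect : ∀ p → p + 2ℚ * p ≡ 3ℚ * p
    collect = solve-∀ ring
    ∣1+i∣≤2 : ∣ 1ℚ + 1/odd m ∣ ≤ 2ℚ
    ∣1+i∣≤2 = subst (_≤ 2ℚ) (sym (ℚ.0≤p⇒∣p∣≡p (0≤+ 0≤1 (0≤1/odd m)))) (ℚ.+-monoʳ-≤ 1ℚ (1/odd≤1 m))

  0≤β : ∀ N → 0ℚ ≤ β N
  0≤β zero    = 0≤1
  0≤β (suc N) = 0≤* (0≤β N) (0≤* (0≤* (0≤+ 0≤1 (0≤nat N)) (ℚ.nonNegative⁻¹ ½)) (0≤1/odd N))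

  3/2 : ℚ
  3/2 = 3ℚ * ½

  -- Consecutive values have the ratio `3 (N + 1) / (2 (2N + 1))`, which is at most 1 only from
  -- `N = 1` on. The maximum 3/2 is attained at `N = 1`, which therefore is a base case of its own.
  β-3^ : ∀ N → β N * 3^ N ≤ 3/2
  β-3^ zero          = ℚ.≤ᵇ⇒≤ _
  β-3^ (suc zero)    =
    ℚ.≤-reflexive (trans (cong₂ (λ n i → 1ℚ * ((1ℚ + n) * ½ * i) * (3ℚ * 1ℚ)) nat0 1/odd-zero) refl)
  β-3^ (suc (suc N)) = begin
    β M * ((1ℚ + nat M) * ½ * j) * (3ℚ * 3^ M)
      ≡⟨ regroup (β M) (nat M) j (3^ M) ⟩
    (β M * 3^ M) * (3/2 * (1ℚ + nat M) * j)
      ≤⟨ *-mono (ℚ.nonNegative⁻¹ 3/2) (0≤* (0≤* (ℚ.nonNegative⁻¹ 3/2) (0≤+ 0≤1 (0≤nat M))) (0≤1/odd M))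
        (β-3^ (suc N))
           (≤-+ (½ * (nat N * j)) (0≤* (ℚ.nonNegative⁻¹ ½) (0≤* (0≤nat N) (0≤1/odd M))) ratio) ⟩
    3/2 * 1ℚ
      ≡⟨ ℚ.*-identityʳ 3/2 ⟩
    3/2 ∎
    where
    open ℚ.≤-Reasoning
    M : ℕ
    M = suc N
    j : ℚ
    j = 1/odd M
    regroup : ∀ B n j p → B * ((1ℚ + n) * ½ * j) * (3ℚ * p) ≡ (B * p) * (3ℚ * ½ * (1ℚ + n) * j)
    regroup = solve-∀ ring
    identity : ∀ n j → j * (2ℚ * (1ℚ + n) + 1ℚ) ≡ 3ℚ * ½ * (1ℚ + (1ℚ + n)) * j + ½ * (n * j)
    identity = solve-∀ ring
    ratio : 1ℚ ≡ 3/2 * (1ℚ + nat M) * j + ½ * (nat N * j)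
    ratio = trans (sym (1/odd-suc-inverse N)) (trans (identity (nat N) j)
      (cong (λ x → 3/2 * (1ℚ + x) * j + ½ * (nat N * j)) (sym (nat-suc N))))

  ∣β-Π∣≤ : ∀ m N → ∣ β N * Π m (nat N) ∣ ≤ 3/2
  ∣β-Π∣≤ m N = begin
    ∣ β N * Π m (nat N) ∣    ≤⟨ ∣*∣≤ (ℚ.≤-reflexive (ℚ.0≤p⇒∣p∣≡p (0≤β N))) (∣Π∣≤3^ m N) ⟩
    β N * 3^ N               ≤⟨ β-3^ N ⟩
    3/2                      ∎
    where open ℚ.≤-Reasoning

  -- The defect and the size of `h` on the block with number `n`.

  module Block (k e : ℕ) (d≡4k : suc e ≡ k ℕ.* 4) (n : ℕ) where

    d N : ℕ
    d = suc e
    N = n ℕ.* d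

    σ : ℚ
    σ = (-¼ ^ k) ^ n

    y-block : ∀ m r → y m (N ℕ.+ r) ≡ σ * y m r
    y-block m r = begin
      y m (n ℕ.* d ℕ.+ r)               ≡⟨ cong (λ p → y m (p ℕ.+ r)) length≡ ⟩
      y m (k ℕ.* n ℕ.* 4 ℕ.+ r)         ≡⟨ y-periodic m (k ℕ.* n) r ⟩
      -¼ ^ (k ℕ.* n) * y m r            ≡⟨ cong (_* y m r) (^-assocʳ -¼ k n) ⟨
      σ * y m r                         ∎
      where
      open ≡-Reasoning
      length≡ : n ℕ.* d ≡ k ℕ.* n ℕ.* 4
      length≡ = trans (cong (n ℕ.*_) d≡4k) (trans (sym (ℕ.*-assoc n k 4)) (cong (ℕ._* 4) (ℕ.*-comm n k)))

    -- One of the `suc e` factors of `Π` is spent by `b-Π-suc` and `r ≤ e` more by `β-Π-Q`, so a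
    -- block of length `suc e` just fits.
    block-term : ∀ r → r ℕ.≤ e →
      b (N ℕ.+ r) * (y d (suc (N ℕ.+ r)) * Π d (nat (suc (N ℕ.+ r)))) ≡
      (σ * β N) * ((y d (suc r) * - 1/odd e) * Q r e (nat N))
    block-term r r≤e = begin
      b M * (y d (suc M) * Π d (nat (suc M)))
        ≡⟨ swap (b M) (y d (suc M)) (Π d (nat (suc M))) ⟩
      y d (suc M) * (b M * Π d (nat (suc M)))
        ≡⟨ cong₂ _*_ (trans (cong (y d) (sym (ℕ.+-suc N r))) (y-block d (suc r))) (b-Π-suc e M) ⟩
      σ * y d (suc r) * (- 1/odd e * (β M * Π e (nat M)))
        ≡⟨ cong (λ z → σ * y d (suc r) * (- 1/odd e * z)) (trans
             (cong (λ p → β p * Π e (nat p)) (ℕ.+-comm N r)) (β-Π-Q N r≤e)) ⟩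
      σ * y d (suc r) * (- 1/odd e * (β N * Q r e (nat N)))
        ≡⟨ collect σ (y d (suc r)) (1/odd e) (β N) (Q r e (nat N)) ⟩
      (σ * β N) * ((y d (suc r) * - 1/odd e) * Q r e (nat N)) ∎
      where
      open ≡-Reasoning
      M : ℕ
      M = N ℕ.+ r
      swap : ∀ a b c → a * (b * c) ≡ b * (a * c)
      swap = solve-∀ ring
      collect : ∀ s y i B q → s * y * (- i * (B * q)) ≡ (s * B) * ((y * - i) * q)
      collect = solve-∀ ring

    block-sum : (σ * β N) * s₀ e (nat N) + h d N ≡
      partialSum (λ r → b (N ℕ.+ r) * y 0 (suc (N ℕ.+ r))) d + h d (N ℕ.+ d)
    block-sum = begin
      (σ * β N) * s₀ e (nat N) + h d N
        ≡⟨ cong (_+ h d N) (*-partialSum (σ * β N)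
            (λ r → (y (suc e) (suc r) * - 1/odd e) * Q r e (nat N)) d) ⟩
      partialSum (λ r → (σ * β N) * ((y d (suc r) * - 1/odd e) * Q r e (nat N))) d + h d N
        ≡⟨ cong (_+ h d N) (partialSum-cong< d (λ { r (s≤s r≤e) → sym (block-term r r≤e) })) ⟩
      partialSum (λ r → b (N ℕ.+ r) * (y d (suc (N ℕ.+ r)) * Π d (nat (suc (N ℕ.+ r))))) d + h d N
        ≡⟨ sweep d ⟩
      partialSum (λ r → b (N ℕ.+ r) * y 0 (suc (N ℕ.+ r))) d + h d (N ℕ.+ d) ∎
      where
      open ≡-Reasoning
      F G : ℕ → ℚ
      F r = b (N ℕ.+ r) * (y d (suc (N ℕ.+ r)) * Π d (nat (suc (N ℕ.+ r))))
      G r = b (N ℕ.+ r) * y 0 (suc (N ℕ.+ r))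
      sweep : ∀ c → partialSum F c + h d N ≡ partialSum G c + h d (N ℕ.+ c)
      sweep zero    = cong (λ M → 0ℚ + h d M) (sym (ℕ.+-identityʳ N))
      sweep (suc c) = begin
        partialSum F (suc c) + h d N
          ≡⟨ cong (_+ h d N) (partialSum-suc F c) ⟩
        partialSum F c + F c + h d N
          ≡⟨ swap (partialSum F c) (F c) (h d N) ⟩
        (partialSum F c + h d N) + F c
          ≡⟨ cong (_+ F c) (sweep c) ⟩
        (partialSum G c + h d M) + F c
          ≡⟨ regroup (partialSum G c) (h d M) (b M) (y d (suc M) * Π d (nat (suc M))) (y 0 (suc M)) ⟩
        (partialSum G c + G c) + (h d M + b M * (y d (suc M) * Π d (nat (suc M)) - y 0 (suc M)))
          ≡⟨ cong₂ _+_ (partialSum-suc G c) (trans (cong (h d) (ℕ.+-suc N c)) (h-difference d M)) ⟨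
        partialSum G (suc c) + h d (N ℕ.+ suc c) ∎
        where
        M : ℕ
        M = N ℕ.+ c
        swap : ∀ a b c → a + b + c ≡ (a + c) + b
        swap = solve-∀ ring
        regroup : ∀ s h b p q → (s + h) + b * p ≡ (s + b * q) + (h + b * (p - q))
        regroup = solve-∀ ring

    -- This is the reciprocal of `denominator k n`, as `t-denominator` shows.
    t : ℚ
    t = σ * β N

    ∣σ∣≤ : 1 ℕ.≤ k → ∣ σ ∣ ≤ ¼ ^ n
    ∣σ∣≤ (s≤s {n = k′} _) = ∣^∣≤ n (∣*∣≤ { -¼} { -¼ ^ k′} {¼} {1ℚ} ℚ.≤-refl (∣^∣≤1 { -¼} k′ (ℚ.≤ᵇ⇒≤ _)))

    ∣t-Π∣≤ : 1 ℕ.≤ k → ∀ m → ∣ t * Π m (nat N) ∣ ≤ ¼ ^ n * 3/2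
    ∣t-Π∣≤ 1≤k m = subst (λ x → ∣ x ∣ ≤ ¼ ^ n * 3/2) (sym (ℚ.*-assoc σ (β N) (Π m (nat N))))
      (∣*∣≤ (∣σ∣≤ 1≤k) (∣β-Π∣≤ m N))

    -- All decay in `n` comes from `σ`, because `y c N = σ * y c 0`; the products of `β` and `Π` are
    -- merely bounded. The number `c` of summands is fixed, so the sum of the `∣ y m 0 ∣` is a
    -- constant.
    h-decay : 1 ℕ.≤ k → ∀ c → ∣ h c N ∣ ≤ ¼ ^ n * (4ℚ * 3/2 * partialSum (λ m → ∣ y m 0 ∣) c)
    h-decay 1≤k zero = ℚ.≤-reflexive (trans (cong ∣_∣ (ℚ.*-zeroʳ (-4ℚ * β N)))
      (sym (trans (cong (¼ ^ n *_) (ℚ.*-zeroʳ (4ℚ * 3/2))) (ℚ.*-zeroʳ (¼ ^ n)))))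
    h-decay 1≤k (suc c) = begin
      ∣ h (suc c) N ∣
        ≡⟨ cong ∣_∣ (trans (cong (-4ℚ * β N *_)
            (trans (partialSum-suc (λ m → y m N * 1/odd m * Π m (nat N)) c)
             (cong (λ z → τ c N + z * 1/odd c * Π c (nat N)) y≡)))
             (expand (β N) (τ c N) σ (y c 0) (1/odd c) (Π c (nat N)))) ⟩
      ∣ h c N + -4ℚ * (y c 0 * 1/odd c) * (t * Π c (nat N)) ∣
        ≤⟨ ∣+∣≤ (h-decay 1≤k c) (∣*∣≤ (∣*∣≤ { -4ℚ} {y c 0 * 1/odd c} {4ℚ} {∣ y c 0 ∣ * 1ℚ} ℚ.≤-refl
             (∣*∣≤ {y c 0} ℚ.≤-refl (subst (_≤ 1ℚ) (sym (ℚ.0≤p⇒∣p∣≡p (0≤1/odd c))) (1/odd≤1 c))))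
               (∣t-Π∣≤ 1≤k c)) ⟩
      ¼ ^ n * (4ℚ * 3/2 * partialSum (λ m → ∣ y m 0 ∣) c) + 4ℚ * (∣ y c 0 ∣ * 1ℚ) * (¼ ^ n * 3/2)
        ≡⟨ collect (¼ ^ n) (partialSum (λ m → ∣ y m 0 ∣) c) ∣ y c 0 ∣ ⟩
      ¼ ^ n * (4ℚ * 3/2 * (partialSum (λ m → ∣ y m 0 ∣) c + ∣ y c 0 ∣))
        ≡⟨ cong (λ s → ¼ ^ n * (4ℚ * 3/2 * s)) (partialSum-suc (λ m → ∣ y m 0 ∣) c) ⟨
      ¼ ^ n * (4ℚ * 3/2 * partialSum (λ m → ∣ y m 0 ∣) (suc c)) ∎
      where
      open ℚ.≤-Reasoning
      y≡ : y c N ≡ σ * y c 0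
      y≡ = trans (cong (y c) (sym (ℕ.+-identityʳ N))) (y-block c 0)
      expand : ∀ B T s y i p → -4ℚ * B * (T + s * y * i * p) ≡ -4ℚ * B * T + -4ℚ * (y * i) * ((s * B) * p)
      expand = solve-∀ ring
      collect : ∀ q s y → q * (4ℚ * 3/2 * s) + 4ℚ * (y * 1ℚ) * (q * 3/2) ≡ q * (4ℚ * 3/2 * (s + y))
      collect = solve-∀ ring

  -- Summation over the blocks and the correction by `χ`.

  module Telescope (k e : ℕ) (d≡4k : suc e ≡ k ℕ.* 4) where
    open Block k e d≡4k

    -- The first term of `χ` carries `t * Π (suc e)` one full block ahead, the extreme case `r = m`
    -- of `Q`. So `t n * χ` is the forward difference of a sequence that starts at 1 and tends to 0.
    χ S : ℚ → ℚ
    χ x = -¼ ^ k * Q (suc e) (suc e) x - Π (suc e) x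
    S x = s₀ e x - h (suc e) 0 * χ x

    F : ℕ → ℚ
    F N = b N * y 0 (suc N)

    χ-telescopes : ∀ n → t n * χ (nat (N n)) + t n * Π (suc e) (nat (N n)) ≡
                   t (suc n) * Π (suc e) (nat (N (suc n)))
    χ-telescopes n = begin
      t n * χ (nat (N n)) + t n * Π (suc e) (nat (N n))
        ≡⟨ collect (-¼ ^ k) (σ n) (β (N n)) (Q (suc e) (suc e) (nat (N n))) (Π (suc e) (nat (N n))) ⟩
      (-¼ ^ k * σ n) * (β (N n) * Q (suc e) (suc e) (nat (N n)))
        ≡⟨ cong ((-¼ ^ k * σ n) *_) (β-Π-Q {suc e} {suc e} (N n) ℕ.≤-refl) ⟨
      σ (suc n) * (β (N (suc n)) * Π (suc e) (nat (N (suc n))))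
        ≡⟨ ℚ.*-assoc (σ (suc n)) (β (N (suc n))) (Π (suc e) (nat (N (suc n)))) ⟨
      t (suc n) * Π (suc e) (nat (N (suc n))) ∎
      where
      open ≡-Reasoning
      collect : ∀ a s B q p → (s * B) * (a * q - p) + (s * B) * p ≡ (a * s) * (B * q)
      collect = solve-∀ ring

    partialSum-S : ∀ m → partialSum (λ n → t n * S (nat (N n))) m ≡
      partialSum F (m ℕ.* suc e) + h (suc e) (N m) - h (suc e) 0 * (t m * Π (suc e) (nat (N m)))
    -- The boundary terms cancel because `t 0` and `Π (suc e) 0` are 1. The coefficient of `χ` in
    -- `S` is chosen for this.
    partialSum-S zero = trans (identity (h (suc e) 0))
      (cong (λ p → 0ℚ + h (suc e) 0 - h (suc e) 0 * (1ℚ * 1ℚ * p)) (sym (Π-zero (suc e))))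
      where
      identity : ∀ x → 0ℚ ≡ 0ℚ + x - x * (1ℚ * 1ℚ * 1ℚ)
      identity = solve-∀ ring
    partialSum-S (suc m) = begin
      partialSum (λ n → t n * S (nat (N n))) (suc m)
        ≡⟨ partialSum-suc (λ n → t n * S (nat (N n))) m ⟩
      partialSum (λ n → t n * S (nat (N n))) m + t m * S (nat (N m))
        ≡⟨ cong (_+ t m * S (nat (N m))) (partialSum-S m) ⟩
      P + h₁ - h₀ * (t m * Π₁) + t m * S (nat (N m))
        ≡⟨ regroup P h₁ h₀ (t m) Π₁ (s₀ e (nat (N m))) (χ (nat (N m))) ⟩
      P + (t m * s₀ e (nat (N m)) + h₁) - h₀ * (t m * χ (nat (N m)) + t m * Π₁)
        ≡⟨ cong₂ (λ u v → P + u - h₀ * v) (block-sum m) (χ-telescopes m) ⟩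
      P + (partialSum (λ r → F (N m ℕ.+ r)) (suc e) + h (suc e) (N m ℕ.+ suc e)) - h₀ * H′
        ≡⟨ reassoc P (partialSum (λ r → F (N m ℕ.+ r)) (suc e)) (h (suc e) (N m ℕ.+ suc e)) (h₀ * H′) ⟩
      (P + partialSum (λ r → F (N m ℕ.+ r)) (suc e)) + h (suc e) (N m ℕ.+ suc e) - h₀ * H′
        ≡⟨ cong (λ s → s + h (suc e) (N m ℕ.+ suc e) - h₀ * H′) (partialSum-++ F (N m) (suc e)) ⟨
      partialSum F (N m ℕ.+ suc e) + h (suc e) (N m ℕ.+ suc e) - h₀ * H′
        ≡⟨ cong (λ M → partialSum F M + h (suc e) M - h₀ * H′) (ℕ.+-comm (N m) (suc e)) ⟩
      partialSum F (N (suc m)) + h (suc e) (N (suc m)) - h₀ * H′ ∎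
      where
      open ≡-Reasoning
      P h₁ h₀ Π₁ H′ : ℚ
      P  = partialSum F (m ℕ.* suc e)
      h₁ = h (suc e) (N m)
      h₀ = h (suc e) 0
      Π₁ = Π (suc e) (nat (N m))
      H′ = t (suc m) * Π (suc e) (nat (N (suc m)))
      regroup : ∀ P h₁ h₀ t p s c →
        P + h₁ - h₀ * (t * p) + t * (s - h₀ * c) ≡ P + (t * s + h₁) - h₀ * (t * c + t * p)
      regroup = solve-∀ ring
      reassoc : ∀ P s h z → P + (s + h) - z ≡ (P + s) + h - z
      reassoc = solve-∀ ring

    error-bound : ℚ
    error-bound = 4ℚ * 3/2 * partialSum (λ m → ∣ y m 0 ∣) (suc e) + ∣ h (suc e) 0 ∣ * 3/2

    partialSum-S-≈ : 1 ℕ.≤ k → ∀ m →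
      ∣ partialSum (λ n → t n * S (nat (N n))) m - partialSum F (m ℕ.* suc e) ∣ ≤ ¼ ^ m * error-bound
    partialSum-S-≈ 1≤k m = begin
      ∣ partialSum (λ n → t n * S (nat (N n))) m - P ∣
        ≡⟨ cong ∣_∣ (trans (cong (_- P) (partialSum-S m)) (cancel P (h (suc e) (N m)) (h₀ * H))) ⟩
      ∣ h (suc e) (N m) - h₀ * H ∣
        ≤⟨ ∣-∣≤ (h-decay m 1≤k (suc e)) (∣*∣≤ {h₀} {H} ℚ.≤-refl (∣t-Π∣≤ m 1≤k (suc e))) ⟩
      ¼ ^ m * c + ∣ h₀ ∣ * (¼ ^ m * 3/2)
        ≡⟨ collect (¼ ^ m) c ∣ h₀ ∣ 3/2 ⟩
      ¼ ^ m * error-bound ∎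
      where
      open ℚ.≤-Reasoning
      P h₀ H c : ℚ
      P  = partialSum F (m ℕ.* suc e)
      h₀ = h (suc e) 0
      H  = t m * Π (suc e) (nat (N m))
      c  = 4ℚ * 3/2 * partialSum (λ m → ∣ y m 0 ∣) (suc e)
      cancel : ∀ P a b → P + a - b - P ≡ a - b
      cancel = solve-∀ ring
      collect : ∀ q c h z → q * c + h * (q * z) ≡ q * (c + h * z)
      collect = solve-∀ ring

-- `h d 0` is not zero: a 3-adic descent.

module NonVanishing where

  open Arithmetic
  open Series

  1+3_ : ℤ → ℚ
  1+3 c = 1ℚ + 3ℚ * ℤ→ℚ c

  -- Denominators prime to 3 are normalised to be 1 mod 3.

  3-Integral 3-Divisible : ℚ → Set
  3-Integral  x = ∃[ c ] ∃[ a ] 1+3 c * x ≡ ℤ→ℚ a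
  3-Divisible x = ∃[ c ] ∃[ a ] 1+3 c * x ≡ 3ℚ * ℤ→ℚ a

  1+3-* : ∀ c c′ → 1+3 (c ℤ.+ c′ ℤ.+ ℤ.+ 3 ℤ.* c ℤ.* c′) ≡ 1+3 c * 1+3 c′
  1+3-* c c′ = trans (cong (λ x → 1ℚ + 3ℚ * x) hom) (identity (ℤ→ℚ c) (ℤ→ℚ c′))
    where
    hom : ℤ→ℚ (c ℤ.+ c′ ℤ.+ ℤ.+ 3 ℤ.* c ℤ.* c′) ≡ ℤ→ℚ c + ℤ→ℚ c′ + 3ℚ * ℤ→ℚ c * ℤ→ℚ c′
    hom = trans (ℤ→ℚ-+ (c ℤ.+ c′) (ℤ.+ 3 ℤ.* c ℤ.* c′)) (cong₂ _+_ (ℤ→ℚ-+ c c′)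
      (trans (ℤ→ℚ-* (ℤ.+ 3 ℤ.* c) c′) (cong (_* ℤ→ℚ c′) (ℤ→ℚ-* (ℤ.+ 3) c))))
    identity : ∀ c c′ → 1ℚ + 3ℚ * (c + c′ + 3ℚ * c * c′) ≡ (1ℚ + 3ℚ * c) * (1ℚ + 3ℚ * c′)
    identity = solve-∀ ring

  ℤ→ℚ-1+3* : ∀ c a → ℤ→ℚ (a ℤ.+ ℤ.+ 3 ℤ.* c ℤ.* a) ≡ 1+3 c * ℤ→ℚ a
  ℤ→ℚ-1+3* c a = trans (ℤ→ℚ-+ a (ℤ.+ 3 ℤ.* c ℤ.* a)) (trans
    (cong (ℤ→ℚ a +_) (trans (ℤ→ℚ-* (ℤ.+ 3 ℤ.* c) a) (cong (_* ℤ→ℚ a) (ℤ→ℚ-* (ℤ.+ 3) c))))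
    (identity (ℤ→ℚ c) (ℤ→ℚ a)))
    where
    identity : ∀ c a → a + 3ℚ * c * a ≡ (1ℚ + 3ℚ * c) * a
    identity = solve-∀ ring

  3-Integral-+ : ∀ {x x′} → 3-Integral x → 3-Integral x′ → 3-Integral (x + x′)
  3-Integral-+ {x} {x′} (c , a , eq) (c′ , a′ , eq′) =
    c ℤ.+ c′ ℤ.+ ℤ.+ 3 ℤ.* c ℤ.* c′ , (a ℤ.+ ℤ.+ 3 ℤ.* c′ ℤ.* a) ℤ.+ (a′ ℤ.+ ℤ.+ 3 ℤ.* c ℤ.* a′) , (begin
      1+3 (c ℤ.+ c′ ℤ.+ ℤ.+ 3 ℤ.* c ℤ.* c′) * (x + x′)  ≡⟨ cong (_* (x + x′)) (1+3-* c c′) ⟩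
      1+3 c * 1+3 c′ * (x + x′)                          ≡⟨ identity (1+3 c) (1+3 c′) x x′ ⟩
      1+3 c′ * (1+3 c * x) + 1+3 c * (1+3 c′ * x′)       ≡⟨ cong₂ (λ u v → 1+3 c′ * u + 1+3 c * v) eq eq′ ⟩
      1+3 c′ * ℤ→ℚ a + 1+3 c * ℤ→ℚ a′                    ≡⟨ cong₂ _+_ (ℤ→ℚ-1+3* c′ a) (ℤ→ℚ-1+3* c a′) ⟨
      ℤ→ℚ (a ℤ.+ ℤ.+ 3 ℤ.* c′ ℤ.* a) + ℤ→ℚ (a′ ℤ.+ ℤ.+ 3 ℤ.* c ℤ.* a′)
        ≡⟨ ℤ→ℚ-+ (a ℤ.+ ℤ.+ 3 ℤ.* c′ ℤ.* a) (a′ ℤ.+ ℤ.+ 3 ℤ.* c ℤ.* a′) ⟨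
      ℤ→ℚ ((a ℤ.+ ℤ.+ 3 ℤ.* c′ ℤ.* a) ℤ.+ (a′ ℤ.+ ℤ.+ 3 ℤ.* c ℤ.* a′)) ∎)
    where
    open ≡-Reasoning
    identity : ∀ u v x y → u * v * (x + y) ≡ v * (u * x) + u * (v * y)
    identity = solve-∀ ring

  -- Write `x` as `3 * ((A + ⅓ * x) - A)`: clearing the `⅓` itself produces the factor 3, so
  -- integrality of `A` suffices.
  3-Divisible-third : ∀ {A x} → 3-Integral A → 3-Divisible (A + ⅓ * x) → 3-Divisible x
  3-Divisible-third {A} {x} (c , a , eq) (c′ , a′ , eq′) =
    c ℤ.+ c′ ℤ.+ ℤ.+ 3 ℤ.* c ℤ.* c′ ,
    ℤ.+ 3 ℤ.* (a′ ℤ.+ ℤ.+ 3 ℤ.* c ℤ.* a′) ℤ.+ ℤ.- (a ℤ.+ ℤ.+ 3 ℤ.* c′ ℤ.* a) , (begin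
      1+3 (c ℤ.+ c′ ℤ.+ ℤ.+ 3 ℤ.* c ℤ.* c′) * x
        ≡⟨ cong (_* x) (1+3-* c c′) ⟩
      1+3 c * 1+3 c′ * x
        ≡⟨ identity (1+3 c) (1+3 c′) A x ⟩
      3ℚ * (1+3 c * (1+3 c′ * (A + ⅓ * x)) + - (1+3 c′ * (1+3 c * A)))
        ≡⟨ cong₂ (λ u v → 3ℚ * (1+3 c * u + - (1+3 c′ * v))) eq′ eq ⟩
      3ℚ * (1+3 c * (3ℚ * ℤ→ℚ a′) + - (1+3 c′ * ℤ→ℚ a))
        ≡⟨ cong (λ u → 3ℚ * (u + - (1+3 c′ * ℤ→ℚ a))) (swap (1+3 c) (ℤ→ℚ a′)) ⟩
      3ℚ * (3ℚ * (1+3 c * ℤ→ℚ a′) + - (1+3 c′ * ℤ→ℚ a))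
        ≡⟨ cong₂ (λ u v → 3ℚ * (3ℚ * u + - v)) (ℤ→ℚ-1+3* c a′) (ℤ→ℚ-1+3* c′ a) ⟨
      3ℚ * (3ℚ * ℤ→ℚ u + - ℤ→ℚ v)
        ≡⟨ cong (3ℚ *_) (trans (ℤ→ℚ-+ (ℤ.+ 3 ℤ.* u) (ℤ.- v)) (cong₂ _+_ (ℤ→ℚ-* (ℤ.+ 3) u) (ℤ→ℚ-neg v))) ⟨
      3ℚ * ℤ→ℚ (ℤ.+ 3 ℤ.* u ℤ.+ ℤ.- v) ∎)
    where
    open ≡-Reasoning
    u v : ℤ
    u = a′ ℤ.+ ℤ.+ 3 ℤ.* c ℤ.* a′
    v = a ℤ.+ ℤ.+ 3 ℤ.* c′ ℤ.* a
    identity : ∀ u v A x → u * v * x ≡ 3ℚ * (u * (v * (A + ⅓ * x)) + - (v * (u * A)))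
    identity = solve-∀ ring
    swap : ∀ u a → u * (3ℚ * a) ≡ 3ℚ * (u * a)
    swap = solve-∀ ring

  oddTerm : (ℕ → ℤ) → ℕ → ℚ
  oddTerm z m = ℤ→ℚ (z m) * 1/odd m

  3e : ∀ e r → nat (r ℕ.+ e ℕ.* 3) ≡ nat r + nat e * 3ℚ
  3e e r = trans (nat-+ r (e ℕ.* 3)) (cong (nat r +_) (trans (nat-* e 3) (cong (nat e *_) (nat≡ 3))))

  oddTerm-0 : ∀ z e → 3-Integral (oddTerm z (e ℕ.* 3))
  oddTerm-0 z e = ℤ.+ 2 ℤ.* ℤ.+ e , z (e ℕ.* 3) , (begin
    1+3 (ℤ.+ 2 ℤ.* ℤ.+ e) * (ζ * i)
      ≡⟨ cong (λ x → (1ℚ + 3ℚ * x) * (ζ * i)) (trans (ℤ→ℚ-* (ℤ.+ 2) (ℤ.+ e)) (cong (2ℚ *_) (sym (nat≡ e)))) ⟩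
    (1ℚ + 3ℚ * (2ℚ * nat e)) * (ζ * i)  ≡⟨ modulo ζ inverse (identity (nat e) ζ i) ⟩
    ζ                                   ∎)
    where
    open ≡-Reasoning
    ζ i : ℚ
    ζ = ℤ→ℚ (z (e ℕ.* 3))
    i = 1/odd (e ℕ.* 3)
    inverse : i * (2ℚ * (nat e * 3ℚ) + 1ℚ) ≡ 1ℚ
    inverse =
      trans (cong (λ x → i * 2n+1 x) (sym (trans (nat-* e 3) (cong (nat e *_) (nat≡ 3)))))
        (1/odd-inverse (e ℕ.* 3))
    identity : ∀ e z i → (1ℚ + 3ℚ * (2ℚ * e)) * (z * i) - z ≡ z * (i * (2ℚ * (e * 3ℚ) + 1ℚ) - 1ℚ)
    identity = solve-∀ ring

  oddTerm-2 : ∀ z e → 3-Integral (oddTerm z (2 ℕ.+ e ℕ.* 3))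
  -- The odd number is `6e + 5`, which is -1 modulo 3. Its negative `1 - 6 (e + 1)` has the
  -- normalised form, and the numerator changes sign with it.
  oddTerm-2 z e = ℤ.- (ℤ.+ 2 ℤ.* ℤ.+ suc e) , ℤ.- z (2 ℕ.+ e ℕ.* 3) , (begin
    1+3 (ℤ.- (ℤ.+ 2 ℤ.* ℤ.+ suc e)) * (ζ * i)
      ≡⟨ cong (λ x → (1ℚ + 3ℚ * x) * (ζ * i))
        (trans (ℤ→ℚ-neg (ℤ.+ 2 ℤ.* ℤ.+ suc e)) (cong -_ (trans (ℤ→ℚ-* (ℤ.+ 2) (ℤ.+ suc e))
           (cong (2ℚ *_) (trans (sym (nat≡ (suc e))) (nat-suc e)))))) ⟩
    (1ℚ + 3ℚ * - (2ℚ * (1ℚ + nat e))) * (ζ * i)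
      ≡⟨ modulo (- ζ) inverse (identity (nat e) ζ i) ⟩
    - ζ
      ≡⟨ ℤ→ℚ-neg (z (2 ℕ.+ e ℕ.* 3)) ⟨
    ℤ→ℚ (ℤ.- z (2 ℕ.+ e ℕ.* 3)) ∎)
    where
    open ≡-Reasoning
    ζ i : ℚ
    ζ = ℤ→ℚ (z (2 ℕ.+ e ℕ.* 3))
    i = 1/odd (2 ℕ.+ e ℕ.* 3)
    inverse : i * (2ℚ * (2ℚ + nat e * 3ℚ) + 1ℚ) ≡ 1ℚ
    inverse =
      trans (cong (λ x → i * 2n+1 x) (sym (trans (3e e 2) (cong (_+ nat e * 3ℚ) (nat≡ 2)))))
        (1/odd-inverse (2 ℕ.+ e ℕ.* 3))
    identity : ∀ e z i →
        (1ℚ + 3ℚ * - (2ℚ * (1ℚ + e))) * (z * i) - - z ≡ - z * (i * (2ℚ * (2ℚ + e * 3ℚ) + 1ℚ) - 1ℚ)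
    identity = solve-∀ ring

  third : (ℕ → ℤ) → ℕ → ℤ
  third z m = z (1 ℕ.+ m ℕ.* 3)

  -- For `m = 3e + 1` the odd number `2m + 1` is `3 (2e + 1)`.
  oddTerm-1 : ∀ z e → oddTerm z (1 ℕ.+ e ℕ.* 3) ≡ ⅓ * oddTerm (third z) e
  oddTerm-1 z e = modulo₂ (- (ζ * i′)) (⅓ * ζ * i) (1/odd-inverse e) inverse (identity (nat e) ζ (1/odd e) i′)
    where
    ζ i i′ : ℚ
    ζ  = ℤ→ℚ (third z e)
    i  = 1/odd e
    i′ = 1/odd (1 ℕ.+ e ℕ.* 3)
    inverse : i′ * (2ℚ * (1ℚ + nat e * 3ℚ) + 1ℚ) ≡ 1ℚ
    inverse =
      trans (cong (λ x → i′ * 2n+1 x) (sym (trans (3e e 1) (cong (_+ nat e * 3ℚ) (nat≡ 1)))))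
        (1/odd-inverse (1 ℕ.+ e ℕ.* 3))
    identity : ∀ e z i i′ →
        z * i′ - ⅓ * (z * i) ≡ - (z * i′) * (i * (2ℚ * e + 1ℚ) - 1ℚ) +
          ⅓ * z * i * (i′ * (2ℚ * (1ℚ + e * 3ℚ) + 1ℚ) - 1ℚ)
    identity = solve-∀ ring

  opaque
    oddSum : (ℕ → ℤ) → ℕ → ℚ
    oddSum z = partialSum (oddTerm z)

    oddSum-zero : ∀ z → oddSum z 0 ≡ 0ℚ
    oddSum-zero z = refl

    oddSum-suc : ∀ z n → oddSum z (suc n) ≡ oddSum z n + oddTerm z n
    oddSum-suc z n = partialSum-suc (oddTerm z) n

    oddSum≡ : ∀ z n → oddSum z n ≡ partialSum (oddTerm z) n
    oddSum≡ z n = refl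

  oddSum-split : ∀ z e → ∃[ A ] 3-Integral A × oddSum z (e ℕ.* 3) ≡ A + ⅓ * oddSum (third z) e
  oddSum-split z zero    = 0ℚ , (ℤ.+ 0 , ℤ.+ 0 , refl) ,
    trans (oddSum-zero z) (cong (λ s → 0ℚ + ⅓ * s) (sym (oddSum-zero (third z))))
  oddSum-split z (suc e) with oddSum-split z e
  ... | A , A-integral , eq = A + (oddTerm z m + oddTerm z (2 ℕ.+ m)) ,
    3-Integral-+ A-integral (3-Integral-+ (oddTerm-0 z e) (oddTerm-2 z e)) , (begin
      oddSum z (3 ℕ.+ m)
        ≡⟨ oddSum-suc z (2 ℕ.+ m) ⟩
      oddSum z (2 ℕ.+ m) + oddTerm z (2 ℕ.+ m)
        ≡⟨ cong (_+ oddTerm z (2 ℕ.+ m)) (oddSum-suc z (1 ℕ.+ m)) ⟩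
      oddSum z (1 ℕ.+ m) + oddTerm z (1 ℕ.+ m) + oddTerm z (2 ℕ.+ m)
        ≡⟨ cong (λ s → s + oddTerm z (1 ℕ.+ m) + oddTerm z (2 ℕ.+ m)) (oddSum-suc z m) ⟩
      oddSum z m + oddTerm z m + oddTerm z (1 ℕ.+ m) + oddTerm z (2 ℕ.+ m)
        ≡⟨ cong₂ (λ u v → u + oddTerm z m + v + oddTerm z (2 ℕ.+ m)) eq (oddTerm-1 z e) ⟩
      A + ⅓ * oddSum (third z) e + oddTerm z m + ⅓ * oddTerm (third z) e + oddTerm z (2 ℕ.+ m)
        ≡⟨ collect A (oddSum (third z) e) (oddTerm z m) (oddTerm (third z) e) (oddTerm z (2 ℕ.+ m)) ⟩
      A + (oddTerm z m + oddTerm z (2 ℕ.+ m)) + ⅓ * (oddSum (third z) e + oddTerm (third z) e)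
        ≡⟨ cong (λ s → A + (oddTerm z m + oddTerm z (2 ℕ.+ m)) + ⅓ * s) (oddSum-suc (third z) e) ⟨
      A + (oddTerm z m + oddTerm z (2 ℕ.+ m)) + ⅓ * oddSum (third z) (suc e) ∎)
    where
    open ≡-Reasoning
    m : ℕ
    m = e ℕ.* 3
    collect : ∀ A S a b c → A + ⅓ * S + a + ⅓ * b + c ≡ A + (a + c) + ⅓ * (S + b)
    collect = solve-∀ ring

  3∤_ : ℤ → Set
  3∤ z = ∀ q → z ≢ ℤ.+ 3 ℤ.* q

  -- The terms whose odd denominator is divisible by 3 sum to a third of a sum of
  -- the same shape, so the valuation of the sum drops with each reduction.

  oddSum-reduce₀ : ∀ z e → 3-Divisible (oddSum z (e ℕ.* 3)) → 3-Divisible (oddSum (third z) e)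
  oddSum-reduce₀ z e div = let (A , A-integral , eq) = oddSum-split z e in
    3-Divisible-third A-integral (subst 3-Divisible eq div)

  oddSum-reduce₁ : ∀ z e → 3-Divisible (oddSum z (1 ℕ.+ e ℕ.* 3)) → 3-Divisible (oddSum (third z) e)
  oddSum-reduce₁ z e div = let (A , A-integral , eq) = oddSum-split z e in
    3-Divisible-third (3-Integral-+ A-integral (oddTerm-0 z e)) (subst 3-Divisible
      (trans (oddSum-suc z (e ℕ.* 3)) (trans (cong (_+ oddTerm z (e ℕ.* 3)) eq)
        (swap A (⅓ * oddSum (third z) e) (oddTerm z (e ℕ.* 3))))) div)
    where
    swap : ∀ a b c → a + b + c ≡ a + c + b
    swap = solve-∀ ring

  -- Among the indices below `3e + 2` there are `e + 1` that are 1 modulo 3, hence `suc e` in the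
  -- reduced sum.
  oddSum-reduce₂ : ∀ z e → 3-Divisible (oddSum z (2 ℕ.+ e ℕ.* 3)) → 3-Divisible (oddSum (third z) (suc e))
  oddSum-reduce₂ z e div = let (A , A-integral , eq) = oddSum-split z e in
    3-Divisible-third (3-Integral-+ A-integral (oddTerm-0 z e)) (subst 3-Divisible (begin
      oddSum z (2 ℕ.+ m)
        ≡⟨ oddSum-suc z (1 ℕ.+ m) ⟩
      oddSum z (1 ℕ.+ m) + oddTerm z (1 ℕ.+ m)
        ≡⟨ cong₂ _+_ (oddSum-suc z m) (oddTerm-1 z e) ⟩
      oddSum z m + oddTerm z m + ⅓ * oddTerm (third z) e
        ≡⟨ cong (λ s → s + oddTerm z m + ⅓ * oddTerm (third z) e) eq ⟩
      A + ⅓ * oddSum (third z) e + oddTerm z m + ⅓ * oddTerm (third z) e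
        ≡⟨ collect A (oddSum (third z) e) (oddTerm z m) (oddTerm (third z) e) ⟩
      A + oddTerm z m + ⅓ * (oddSum (third z) e + oddTerm (third z) e)
        ≡⟨ cong (λ s → A + oddTerm z m + ⅓ * s) (oddSum-suc (third z) e) ⟨
      A + oddTerm z m + ⅓ * oddSum (third z) (suc e) ∎) div)
    where
    open ≡-Reasoning
    m : ℕ
    m = e ℕ.* 3
    collect : ∀ A S a b → A + ⅓ * S + a + ⅓ * b ≡ A + a + ⅓ * (S + b)
    collect = solve-∀ ring

  oddSum-1 : ∀ z → 3∤ z 0 → ¬ 3-Divisible (oddSum z 1)
  oddSum-1 z 3∤z₀ (c , a , eq) = 3∤z₀ (a ℤ.- c ℤ.* z 0) (ℤ→ℚ-injective (begin
      ζ                                           ≡⟨ modulo 1ℚ eq′ (identity ζ (ℤ→ℚ c) (ℤ→ℚ a)) ⟩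
      3ℚ * (ℤ→ℚ a + - (ℤ→ℚ c * ζ))
        ≡⟨ cong (λ x → 3ℚ * (ℤ→ℚ a + x)) (trans (ℤ→ℚ-neg (c ℤ.* z 0)) (cong -_ (ℤ→ℚ-* c (z 0)))) ⟨
      3ℚ * (ℤ→ℚ a + ℤ→ℚ (ℤ.- (c ℤ.* z 0)))        ≡⟨ cong (3ℚ *_) (ℤ→ℚ-+ a (ℤ.- (c ℤ.* z 0))) ⟨
      3ℚ * ℤ→ℚ (a ℤ.- c ℤ.* z 0)                  ≡⟨ ℤ→ℚ-* (ℤ.+ 3) (a ℤ.- c ℤ.* z 0) ⟨
      ℤ→ℚ (ℤ.+ 3 ℤ.* (a ℤ.- c ℤ.* z 0))           ∎))
    where
    open ≡-Reasoning
    ζ : ℚ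
    ζ = ℤ→ℚ (z 0)
    eq′ : 1+3 c * (0ℚ + ζ * 1ℚ) ≡ 3ℚ * ℤ→ℚ a
    eq′ = trans (cong₂ (λ s i → 1+3 c * (s + ζ * i)) (sym (oddSum-zero z)) (sym 1/odd-zero))
      (trans (cong (1+3 c *_) (sym (oddSum-suc z 0))) eq)
    identity : ∀ z c a → z - 3ℚ * (a + - (c * z)) ≡ 1ℚ * ((1ℚ + 3ℚ * c) * (0ℚ + z * 1ℚ) - 3ℚ * a)
    identity = solve-∀ ring

  data Mod3 : ℕ → Set where
    _*3+0 : ∀ e → Mod3 (e ℕ.* 3)
    _*3+1 : ∀ e → Mod3 (1 ℕ.+ e ℕ.* 3)
    _*3+2 : ∀ e → Mod3 (2 ℕ.+ e ℕ.* 3)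

  mod3 : ∀ n → Mod3 n
  mod3 zero = 0 *3+0
  mod3 (suc n) with mod3 n
  ... | e *3+0 = e *3+1
  ... | e *3+1 = e *3+2
  ... | e *3+2 = suc e *3+0

  -- Each reduction passes to the subsequence `third z`, again with no term divisible by 3, and to
  -- about a third of the length without ever reaching 0. The descent ends with the single term
  -- `z 0`. The shorter length is not structurally smaller, so `fuel` bounds the recursion.
  oddSum-¬3-Divisible : ∀ fuel {n} z → Mod3 n → 1 ℕ.≤ n → n ℕ.≤ fuel → (∀ m → 3∤ z m) →
      ¬ 3-Divisible (oddSum z n)
  oddSum-¬3-Divisible (suc fuel) z (zero *3+1)  1≤n n≤fuel 3∤z div = oddSum-1 z (3∤z 0) div
  oddSum-¬3-Divisible (suc fuel) z (suc e *3+0) 1≤n (s≤s n≤fuel) 3∤z div =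
    oddSum-¬3-Divisible fuel (third z) (mod3 (suc e)) (s≤s z≤n)
      (ℕ.≤-trans (s≤s (ℕ.m≤n⇒m≤1+n (ℕ.m≤m*n e 3))) n≤fuel)
      (λ m → 3∤z (1 ℕ.+ m ℕ.* 3)) (oddSum-reduce₀ z (suc e) div)
  oddSum-¬3-Divisible (suc fuel) z (suc e *3+1) 1≤n (s≤s n≤fuel) 3∤z div =
    oddSum-¬3-Divisible fuel (third z) (mod3 (suc e)) (s≤s z≤n)
      (ℕ.≤-trans (ℕ.m≤m*n (suc e) 3) n≤fuel)
      (λ m → 3∤z (1 ℕ.+ m ℕ.* 3)) (oddSum-reduce₁ z (suc e) div)
  oddSum-¬3-Divisible (suc fuel) z (e *3+2)     1≤n (s≤s n≤fuel) 3∤z div =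
    oddSum-¬3-Divisible fuel (third z) (mod3 (suc e)) (s≤s z≤n)
      (ℕ.≤-trans (s≤s (ℕ.m≤m*n e 3)) n≤fuel)
      (λ m → 3∤z (1 ℕ.+ m ℕ.* 3)) (oddSum-reduce₂ z e div)

  -- The columns 0 and 1 of `y` as integers. With `y-diagonal` the two columns close up under
  -- passing to the next row.
  y₀ y₁ : ℕ → ℤ
  y₀ zero    = ℤ.+ 4
  y₀ (suc m) = ℤ.+ 8 ℤ.* y₁ m ℤ.- ℤ.+ 7 ℤ.* y₀ m
  y₁ zero    = ℤ.+ 3
  y₁ (suc m) = y₁ m ℤ.- ℤ.+ 4 ℤ.* y₀ m

  ℤ→ℚ-y₀ : ∀ m → y m 0 ≡ ℤ→ℚ (y₀ m)
  ℤ→ℚ-y₁ : ∀ m → y m 1 ≡ ℤ→ℚ (y₁ m)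
  ℤ→ℚ-- : ∀ i j → ℤ→ℚ (i ℤ.- j) ≡ ℤ→ℚ i - ℤ→ℚ j
  ℤ→ℚ-- i j = trans (ℤ→ℚ-+ i (ℤ.- j)) (cong (ℤ→ℚ i +_) (ℤ→ℚ-neg j))
  ℤ→ℚ-y₀ zero    = refl
  ℤ→ℚ-y₀ (suc m) = trans (cong₂ (λ u v → 8ℚ * u - 7ℚ * v) (ℤ→ℚ-y₁ m) (ℤ→ℚ-y₀ m))
    (sym (trans (ℤ→ℚ-- (ℤ.+ 8 ℤ.* y₁ m) (ℤ.+ 7 ℤ.* y₀ m))
        (cong₂ _-_ (ℤ→ℚ-* (ℤ.+ 8) (y₁ m)) (ℤ→ℚ-* (ℤ.+ 7) (y₀ m)))))
  ℤ→ℚ-y₁ zero    = refl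
  ℤ→ℚ-y₁ (suc m) = trans (y-diagonal m 0) (trans (cong₂ (λ u v → u - 4ℚ * v) (ℤ→ℚ-y₁ m) (ℤ→ℚ-y₀ m))
    (sym (trans (ℤ→ℚ-- (y₁ m) (ℤ.+ 4 ℤ.* y₀ m)) (cong (λ x → ℤ→ℚ (y₁ m) - x) (ℤ→ℚ-* (ℤ.+ 4) (y₀ m))))))

  -- The two cases alternate. In the first `y₀ (suc m)` is `- y₀ m` modulo 3, in the second it is
  -- `y₀ m`, so `y₀` never becomes divisible by 3.
  y₁-mod3 : ∀ m → (∃[ q ] y₁ m ≡ ℤ.+ 3 ℤ.* q) ⊎ (∃[ q ] y₁ m ≡ y₀ m ℤ.+ ℤ.+ 3 ℤ.* q)
  y₁-mod3 zero = inj₁ (ℤ.+ 1 , refl)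
  y₁-mod3 (suc m) with y₁-mod3 m
  ... | inj₁ (q , eq) =
    inj₂ (y₀ m ℤ.- ℤ.+ 7 ℤ.* q , trans (cong (ℤ._- ℤ.+ 4 ℤ.* y₀ m) eq) (trans (identity q (y₀ m))
      (cong (λ x → ℤ.+ 8 ℤ.* x ℤ.- ℤ.+ 7 ℤ.* y₀ m ℤ.+ ℤ.+ 3 ℤ.* (y₀ m ℤ.- ℤ.+ 7 ℤ.* q)) (sym eq))))
    where
    identity : ∀ q p →
        ℤ.+ 3 ℤ.* q ℤ.- ℤ.+ 4 ℤ.* p ≡
          ℤ.+ 8 ℤ.* (ℤ.+ 3 ℤ.* q) ℤ.- ℤ.+ 7 ℤ.* p ℤ.+ ℤ.+ 3 ℤ.* (p ℤ.- ℤ.+ 7 ℤ.* q)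
    identity = ℤ-Solver.solve-∀
  ... | inj₂ (q , eq) = inj₁ (q ℤ.- y₀ m , trans (cong (ℤ._- ℤ.+ 4 ℤ.* y₀ m) eq) (identity q (y₀ m)))
    where
    identity : ∀ q p → p ℤ.+ ℤ.+ 3 ℤ.* q ℤ.- ℤ.+ 4 ℤ.* p ≡ ℤ.+ 3 ℤ.* (q ℤ.- p)
    identity = ℤ-Solver.solve-∀

  3∤y₀ : ∀ m → 3∤ y₀ m
  3∤y₀ zero    q eq = from-no (3 ℕ.∣? 4) (∣⇒∣ᵤ (divides q (trans eq (ℤ.*-comm (ℤ.+ 3) q))))
  3∤y₀ (suc m) q eq with y₁-mod3 m
  ... | inj₁ (q′ , eq′) = 3∤y₀ m (ℤ.+ 8 ℤ.* q′ ℤ.- q ℤ.- ℤ.+ 2 ℤ.* y₀ m) (trans (split (y₀ m) (y₁ m))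
    (trans (cong₂ (λ u v → ℤ.+ 8 ℤ.* u ℤ.- v ℤ.- ℤ.+ 6 ℤ.* y₀ m) eq′ eq) (collect (y₀ m) q q′)))
    where
    split : ∀ p r → p ≡ ℤ.+ 8 ℤ.* r ℤ.- (ℤ.+ 8 ℤ.* r ℤ.- ℤ.+ 7 ℤ.* p) ℤ.- ℤ.+ 6 ℤ.* p
    split = ℤ-Solver.solve-∀
    collect : ∀ p q q′ →
        ℤ.+ 8 ℤ.* (ℤ.+ 3 ℤ.* q′) ℤ.- ℤ.+ 3 ℤ.* q ℤ.- ℤ.+ 6 ℤ.* p ≡
          ℤ.+ 3 ℤ.* (ℤ.+ 8 ℤ.* q′ ℤ.- q ℤ.- ℤ.+ 2 ℤ.* p)
    collect = ℤ-Solver.solve-∀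
  ... | inj₂ (q′ , eq′) = 3∤y₀ m (q ℤ.- ℤ.+ 8 ℤ.* q′) (trans (split (y₀ m) (y₁ m))
    (trans (cong₂ (λ u v → v ℤ.- ℤ.+ 8 ℤ.* (u ℤ.- y₀ m)) eq′ eq) (collect (y₀ m) q q′)))
    where
    split : ∀ p r → p ≡ (ℤ.+ 8 ℤ.* r ℤ.- ℤ.+ 7 ℤ.* p) ℤ.- ℤ.+ 8 ℤ.* (r ℤ.- p)
    split = ℤ-Solver.solve-∀
    collect : ∀ p q q′ → ℤ.+ 3 ℤ.* q ℤ.- ℤ.+ 8 ℤ.* (p ℤ.+ ℤ.+ 3 ℤ.* q′ ℤ.- p) ≡ ℤ.+ 3 ℤ.* (q ℤ.- ℤ.+ 8 ℤ.* q′)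
    collect = ℤ-Solver.solve-∀

  h-zero : ∀ d → h d 0 ≡ -4ℚ * oddSum y₀ d
  h-zero d = cong (-4ℚ *_) (trans (partialSum-cong< d λ m _ →
    trans (cong₂ (λ u v → u * 1/odd m * v) (ℤ→ℚ-y₀ m) (Π-zero m)) (ℚ.*-identityʳ (oddTerm y₀ m)))
      (sym (oddSum≡ y₀ d)))

  h≢0 : ∀ d → 1 ℕ.≤ d → h d 0 ≢ 0ℚ
  h≢0 d 1≤d h≡0 = oddSum-¬3-Divisible d y₀ (mod3 d) 1≤d ℕ.≤-refl 3∤y₀
    (ℤ.+ 0 , ℤ.+ 0 , trans (identity (oddSum y₀ d)) (cong (- ¼ *_) (trans (sym (h-zero d)) h≡0)))
    where
    identity : ∀ x → (1ℚ + 3ℚ * 0ℚ) * x ≡ - ¼ * (-4ℚ * x)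
    identity = solve-∀ ring

-- Degree and top coefficient of the numerator.

module Polynomials where

  open Arithmetic
  open Series
  open NonVanishing using (h≢0)

  infix 4 _IsPoly[_,_]

  evalVec : ∀ {n} → Vec ℚ n → ℚ → ℚ
  evalVec cs x = foldr′ (λ c acc → c + x * acc) 0ℚ cs

  -- The coefficient `ℓ` at degree `d` may be 0. So polynomials of lower degree can be added by way
  -- of `isPoly-raise`, and only the final top coefficient has to be shown nonzero.
  record _IsPoly[_,_] (f : ℚ → ℚ) (d : ℕ) (ℓ : ℚ) : Set where
    constructor isPoly
    field
      coefficients : Vec ℚ (suc d)
      leading      : last coefficients ≡ ℓ
      evaluates    : ∀ x → evalVec coefficients x ≡ f x

  isPoly-cong : ∀ {f g d ℓ ℓ′} → (∀ x → f x ≡ g x) → ℓ ≡ ℓ′ → f IsPoly[ d , ℓ ] → g IsPoly[ d , ℓ′ ]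
  isPoly-cong f≗g refl (isPoly cs l e) = isPoly cs l λ x → trans (e x) (f≗g x)

  isPoly-const : ∀ c → (λ _ → c) IsPoly[ 0 , c ]
  isPoly-const c = isPoly (c ∷ []) refl λ x → trans (cong (c +_) (ℚ.*-zeroʳ x)) (ℚ.+-identityʳ c)

  isPoly-+ : ∀ {f g d ℓ ℓ′} → f IsPoly[ d , ℓ ] → g IsPoly[ d , ℓ′ ] → (λ x → f x + g x) IsPoly[ d , ℓ + ℓ′ ]
  isPoly-+ (isPoly cs l e) (isPoly cs′ l′ e′) = isPoly (zipWith _+_ cs cs′)
    (trans (last-zipWith cs cs′) (cong₂ _+_ l l′)) λ x → trans (eval-zipWith cs cs′ x)
      (cong₂ _+_ (e x) (e′ x))
    where
    last-zipWith : ∀ {n} (us vs : Vec ℚ (suc n)) → last (zipWith _+_ us vs) ≡ last us + last vs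
    last-zipWith (u ∷ [])          (v ∷ [])          = refl
    last-zipWith (u ∷ us@(_ ∷ _)) (v ∷ vs@(_ ∷ _)) = last-zipWith us vs
    eval-zipWith : ∀ {n} (us vs : Vec ℚ n) x → evalVec (zipWith _+_ us vs) x ≡ evalVec us x + evalVec vs x
    eval-zipWith []       []       x = refl
    eval-zipWith (u ∷ us) (v ∷ vs) x = trans (cong (λ a → u + v + x * a) (eval-zipWith us vs x))
      (identity u v x (evalVec us x) (evalVec vs x))
      where
      identity : ∀ u v x a b → u + v + x * (a + b) ≡ (u + x * a) + (v + x * b)
      identity = solve-∀ ring

  isPoly-scale : ∀ {f d ℓ} c → f IsPoly[ d , ℓ ] → (λ x → c * f x) IsPoly[ d , c * ℓ ]
  isPoly-scale c (isPoly cs l e) = isPoly (map (c *_) cs)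
    (trans (last-map cs) (cong (c *_) l)) λ x → trans (eval-map cs x) (cong (c *_) (e x))
    where
    last-map : ∀ {n} (us : Vec ℚ (suc n)) → last (map (c *_) us) ≡ c * last us
    last-map (u ∷ [])         = refl
    last-map (u ∷ us@(_ ∷ _)) = last-map us
    eval-map : ∀ {n} (us : Vec ℚ n) x → evalVec (map (c *_) us) x ≡ c * evalVec us x
    eval-map []       x = sym (ℚ.*-zeroʳ c)
    eval-map (u ∷ us) x = trans (cong (λ a → c * u + x * a) (eval-map us x)) (identity c u x (evalVec us x))
      where
      identity : ∀ c u x a → c * u + x * (c * a) ≡ c * (u + x * a)
      identity = solve-∀ ring

  isPoly-raise : ∀ {f d ℓ} → f IsPoly[ d , ℓ ] → f IsPoly[ suc d , 0ℚ ]
  isPoly-raise (isPoly cs l e) = isPoly (cs ∷ʳ 0ℚ) (last-∷ʳ 0ℚ cs) λ x → trans (eval-∷ʳ cs x) (e x)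
    where
    eval-∷ʳ : ∀ {n} (us : Vec ℚ n) x → evalVec (us ∷ʳ 0ℚ) x ≡ evalVec us x
    eval-∷ʳ []       x = trans (ℚ.+-identityˡ (x * 0ℚ)) (ℚ.*-zeroʳ x)
    eval-∷ʳ (u ∷ us) x = cong (λ a → u + x * a) (eval-∷ʳ us x)

  isPoly-x* : ∀ {f d ℓ} → f IsPoly[ d , ℓ ] → (λ x → x * f x) IsPoly[ suc d , ℓ ]
  isPoly-x* (isPoly cs@(_ ∷ _) l e) = isPoly (0ℚ ∷ cs) l λ x →
    trans (ℚ.+-identityˡ (x * evalVec cs x)) (cong (x *_) (e x))

  isPoly-linear : ∀ {f d ℓ} a b → f IsPoly[ d , ℓ ] → (λ x → (a * x + b) * f x) IsPoly[ suc d , a * ℓ ]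
  isPoly-linear {f} {ℓ = ℓ} a b p = isPoly-cong (λ x → sym (identity a b x (f x))) (ℚ.+-identityʳ (a * ℓ))
    (isPoly-+ (isPoly-scale a (isPoly-x* p)) (isPoly-raise (isPoly-scale b p)))
    where
    identity : ∀ a b x y → (a * x + b) * y ≡ a * (x * y) + b * y
    identity = solve-∀ ring

  -- The scale `c` enters because the functions are evaluated at `n * suc e`, whereas the polynomial
  -- sought is one in `n`.
  leadΠ : ℚ → ℕ → ℚ
  leadΠ c zero    = 1ℚ
  leadΠ c (suc m) = (- 2ℚ * c * 1/odd m) * leadΠ c m

  Π-isPoly : ∀ c m → (λ x → Π m (x * c)) IsPoly[ m , leadΠ c m ]
  Π-isPoly c zero    = isPoly-const 1ℚ
  Π-isPoly c (suc m) = isPoly-cong (λ x → identity c x (1/odd m) (Π m (x * c))) refl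
    (isPoly-linear (- 2ℚ * c * 1/odd m) 1ℚ (Π-isPoly c m))
    where
    identity : ∀ c x i p → (- 2ℚ * c * i * x + 1ℚ) * p ≡ p * (1ℚ - 2ℚ * (x * c) * i)
    identity = solve-∀ ring

  -- The degree stays `m` since each step of `r` trades a factor of `Π` for a linear one. The `¼`
  -- per step reflects that `β (suc N) / β N` tends to 1/4.
  Q-isPoly : ∀ c {r m} → r ℕ.≤ m → (λ x → Q r m (x * c)) IsPoly[ m , ¼ ^ r * leadΠ c m ]
  Q-isPoly c {m = m} z≤n = isPoly-cong (λ _ → refl) (sym (ℚ.*-identityˡ (leadΠ c m))) (Π-isPoly c m)
  Q-isPoly c {suc r} {suc m} (s≤s r≤m) = isPoly-cong
    (λ x → cong (λ u → (- ½ * 1/odd m) * ((u + nat (suc r)) * Q r m (x * c))) (ℚ.*-comm c x))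
    (identity c (1/odd m) (¼ ^ r) (leadΠ c m))
    (isPoly-scale (- ½ * 1/odd m) (isPoly-linear c (nat (suc r)) (Q-isPoly c r≤m)))
    where
    identity : ∀ c i q l → (- ½ * i) * (c * (q * l)) ≡ (¼ * q) * ((- 2ℚ * c * i) * l)
    identity = solve-∀ ring

  isPoly-partialSum : ∀ {d} (f : ℕ → ℚ → ℚ) n → (∀ i → i ℕ.< n → ∃[ ℓ ] f i IsPoly[ d , ℓ ]) →
    ∃[ ℓ ] (λ x → partialSum (λ i → f i x) n) IsPoly[ d , ℓ ]
  isPoly-partialSum {d} f zero    p = zeroPoly d
    where
    zeroPoly : ∀ d → ∃[ ℓ ] (λ _ → 0ℚ) IsPoly[ d , ℓ ]
    zeroPoly zero    = 0ℚ , isPoly-const 0ℚ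
    zeroPoly (suc d) = 0ℚ , isPoly-raise (proj₂ (zeroPoly d))
  isPoly-partialSum f (suc n) p = _ , isPoly-+ (proj₂ (p 0 (s≤s z≤n)))
    (proj₂ (isPoly-partialSum (f ∘ suc) n (λ i i<n → p (suc i) (s≤s i<n))))

  s₀-isPoly : ∀ c e → ∃[ ℓ ] (λ x → s₀ e (x * c)) IsPoly[ e , ℓ ]
  s₀-isPoly c e = isPoly-partialSum (λ r x → (y (suc e) (suc r) * - 1/odd e) * Q r e (x * c)) (suc e)
    λ { r (s≤s r≤e) → _ , isPoly-scale (y (suc e) (suc r) * - 1/odd e) (Q-isPoly c r≤e) }

  *≡1⇒≢0 : ∀ {p q} → p * q ≡ 1ℚ → q ≢ 0ℚ
  *≡1⇒≢0 {p} pq≡1 refl = ℚ.1≢0 (trans (sym pq≡1) (ℚ.*-zeroʳ p))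

  *≢0 : ∀ {p q} → p ≢ 0ℚ → q ≢ 0ℚ → p * q ≢ 0ℚ
  *≢0 {p} {q} p≢0 q≢0 pq≡0 = q≢0 (begin
    q                   ≡⟨ ℚ.*-identityˡ q ⟨
    1ℚ * q              ≡⟨ cong (_* q) (ℚ.*-inverseˡ p) ⟨
    1/ p * p * q        ≡⟨ ℚ.*-assoc (1/ p) p q ⟩
    1/ p * (p * q)      ≡⟨ cong (1/ p *_) pq≡0 ⟩
    1/ p * 0ℚ           ≡⟨ ℚ.*-zeroʳ (1/ p) ⟩
    0ℚ                  ∎)
    where
    open ≡-Reasoning
    instance
      p-nonZero = ≢-nonZero p≢0

  nat-suc≢0 : ∀ n → nat (suc n) ≢ 0ℚ
  nat-suc≢0 n = *≡1⇒≢0 {1/1+ n} (1/1+-inverse-nat n)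

  leadΠ≢0 : ∀ {c} m → c ≢ 0ℚ → leadΠ c m ≢ 0ℚ
  leadΠ≢0 zero    c≢0 = ℚ.1≢0
  leadΠ≢0 (suc m) c≢0 = *≢0 (*≢0 (*≢0 { - 2ℚ} (λ ()) c≢0)
    (*≡1⇒≢0 {2n+1 (nat m)} (trans (ℚ.*-comm (2n+1 (nat m)) (1/odd m)) (1/odd-inverse m)))) (leadΠ≢0 m c≢0)

  module Coefficients (k e : ℕ) (d≡4k : suc e ≡ k ℕ.* 4) where
    open Telescope k e d≡4k

    c leadχ leadS : ℚ
    c     = nat (suc e)
    leadχ = (-¼ ^ k * ¼ ^ suc e - 1ℚ) * leadΠ c (suc e)
    leadS = - h (suc e) 0 * leadχ

    S-isPoly : (λ x → S (x * c)) IsPoly[ suc e , leadS ]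
    S-isPoly =
      isPoly-cong (λ x → identity (s₀ e (x * c)) (h (suc e) 0) (-¼ ^ k) (Q (suc e) (suc e) (x * c))
          (Π (suc e) (x * c)))
      (identity′ (h (suc e) 0) (-¼ ^ k) (¼ ^ suc e) (leadΠ c (suc e)))
      (isPoly-+ (isPoly-raise (proj₂ (s₀-isPoly c e)))
        (isPoly-scale (- h (suc e) 0) (isPoly-+ (isPoly-scale (-¼ ^ k) (Q-isPoly c {suc e} ℕ.≤-refl))
          (isPoly-scale (- 1ℚ) (Π-isPoly c (suc e))))))
      where
      identity : ∀ s h a q p → s + - h * (a * q + - 1ℚ * p) ≡ s - h * (a * q - p)
      identity = solve-∀ ring
      identity′ : ∀ h a q l → 0ℚ + - h * (a * (q * l) + - 1ℚ * l) ≡ - h * ((a * q - 1ℚ) * l)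
      identity′ = solve-∀ ring

    -- As `s₀` has degree `e`, only `χ` contributes. Its two terms cannot cancel, because
    -- `-¼ ^ k * ¼ ^ suc e` has absolute value at most 1/4.
    leadS≢0 : leadS ≢ 0ℚ
    leadS≢0 = *≢0 (λ -h≡0 → h≢0 (suc e) (s≤s z≤n) (ℚ.neg-injective -h≡0))
      (*≢0 (λ eq → <1⇒≢1 (-¼ ^ k) (¼ ^ suc e) (∣^∣≤1 { -¼} k (ℚ.≤ᵇ⇒≤ _))
        (∣*∣≤ {¼} {¼ ^ e} ℚ.≤-refl (∣^∣≤1 {¼} e (ℚ.≤ᵇ⇒≤ _))) eq) (leadΠ≢0 (suc e) (nat-suc≢0 e)))
      where
      <1⇒≢1 : ∀ p q → ∣ p ∣ ≤ 1ℚ → ∣ q ∣ ≤ ¼ * 1ℚ → p * q - 1ℚ ≢ 0ℚ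
      <1⇒≢1 p q p≤1 q≤¼ eq =
        contradiction (subst (λ x → ∣ x ∣ ≤ 1ℚ * (¼ * 1ℚ)) pq≡1 (∣*∣≤ p≤1 q≤¼))
          (from-no (∣ 1ℚ ∣ ℚ.≤? 1ℚ * (¼ * 1ℚ)))
        where
        pq≡1 : p * q ≡ 1ℚ
        pq≡1 = modulo 1ℚ eq (identity (p * q))
          where
          identity : ∀ x → x - 1ℚ ≡ 1ℚ * (x - 1ℚ - 0ℚ)
          identity = solve-∀ ring

    polynomial : Polynomial (suc e)
    polynomial = record
      { coefficients = _IsPoly[_,_].coefficients S-isPoly
      ; leading≢0    = λ eq → leadS≢0 (trans (sym (_IsPoly[_,_].leading S-isPoly)) eq)
      }

    eval-polynomial : ∀ x → eval polynomial x ≡ S (x * c)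
    eval-polynomial = _IsPoly[_,_].evaluates S-isPoly

-- The summands of the theorem expressed by `t` and `S`.

module Summands where

  open Arithmetic
  open Series
  open Polynomials

  β-! : ∀ N → β N * nat ((2 ℕ.* N) !) ≡ nat (N !) * nat (N !)
  β-! zero    = trans (ℚ.*-identityˡ (nat 1)) (sym (trans (cong (_* nat 1) (nat≡ 1)) (ℚ.*-identityˡ (nat 1))))
  β-! (suc N) = begin
    β N * ((1ℚ + nat N) * ½ * 1/odd N) * nat ((2 ℕ.* suc N) !)
      ≡⟨ cong (β N * ((1ℚ + nat N) * ½ * 1/odd N) *_) !≡ ⟩
    β N * ((1ℚ + nat N) * ½ * 1/odd N) * ((1ℚ + 2n+1 (nat N)) * (2n+1 (nat N) * F))
      ≡⟨ modulo ((1ℚ + nat N) * (1ℚ + nat N) * β N * F) (1/odd-inverse N)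
        (identity (β N) (nat N) (1/odd N) F) ⟩
    (1ℚ + nat N) * (1ℚ + nat N) * (β N * F)
      ≡⟨ cong ((1ℚ + nat N) * (1ℚ + nat N) *_) (β-! N) ⟩
    (1ℚ + nat N) * (1ℚ + nat N) * (nat (N !) * nat (N !))
      ≡⟨ regroup (1ℚ + nat N) (nat (N !)) ⟩
    ((1ℚ + nat N) * nat (N !)) * ((1ℚ + nat N) * nat (N !))
      ≡⟨ cong (λ x → x * x) (trans (nat-* (suc N) (N !)) (cong (_* nat (N !)) (nat-suc N))) ⟨
    nat (suc N !) * nat (suc N !) ∎
    where
    open ≡-Reasoning
    F : ℚ
    F = nat ((2 ℕ.* N) !)
    !≡ : nat ((2 ℕ.* suc N) !) ≡ (1ℚ + 2n+1 (nat N)) * (2n+1 (nat N) * F)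
    !≡ = begin
      nat ((2 ℕ.* suc N) !)
        ≡⟨ cong (λ m → nat (m !)) (ℕ.*-suc 2 N) ⟩
      nat (suc (suc (2 ℕ.* N)) ℕ.* (suc (2 ℕ.* N) ℕ.* (2 ℕ.* N) !))
        ≡⟨ trans (nat-* (suc (suc (2 ℕ.* N))) (suc (2 ℕ.* N) ℕ.* (2 ℕ.* N) !))
          (cong (nat (suc (suc (2 ℕ.* N))) *_) (nat-* (suc (2 ℕ.* N)) ((2 ℕ.* N) !))) ⟩
      nat (suc (suc (2 ℕ.* N))) * (nat (suc (2 ℕ.* N)) * F)
        ≡⟨ cong (_* (nat (suc (2 ℕ.* N)) * F)) (nat-suc (suc (2 ℕ.* N))) ⟩
      (1ℚ + nat (suc (2 ℕ.* N))) * (nat (suc (2 ℕ.* N)) * F)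
        ≡⟨ cong (λ x → (1ℚ + x) * (x * F)) (nat-odd N) ⟩
      (1ℚ + 2n+1 (nat N)) * (2n+1 (nat N) * F) ∎
    identity : ∀ B n j F →
        B * ((1ℚ + n) * ½ * j) * ((1ℚ + (2ℚ * n + 1ℚ)) * ((2ℚ * n + 1ℚ) * F)) - (1ℚ + n) * (1ℚ + n) * (B * F) ≡
      ((1ℚ + n) * (1ℚ + n) * B * F) * (j * (2ℚ * n + 1ℚ) - 1ℚ)
    identity = solve-∀ ring
    regroup : ∀ u f → u * u * (f * f) ≡ (u * f) * (u * f)
    regroup = solve-∀ ring

  nCk*k![n∸k]! : ∀ {n k} → k ℕ.≤ n → (n C k) ℕ.* (k ! ℕ.* (n ℕ.∸ k) !) ≡ n !
  nCk*k![n∸k]! {n} {k} k≤n =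
    trans (cong (ℕ._* (k ! ℕ.* (n ℕ.∸ k) !)) (nCk≡n!/k![n-k]! k≤n)) (ℕ.m/n*n≡m (k![n∸k]!∣n! k≤n))
    where
    instance
      _ = k ℕ.!* (n ℕ.∸ k) !≢0

  central-! : ∀ N → ((2 ℕ.* N) C N) ℕ.* (N ! ℕ.* N !) ≡ (2 ℕ.* N) !
  central-! N =
    trans (cong (λ m → ((2 ℕ.* N) C N) ℕ.* (N ! ℕ.* m !)) (sym 2N∸N≡N)) (nCk*k![n∸k]! (ℕ.m≤m+n N (N ℕ.+ 0)))
    where
    2N∸N≡N : 2 ℕ.* N ℕ.∸ N ≡ N
    2N∸N≡N = trans (ℕ.m+n∸m≡n N (N ℕ.+ 0)) (ℕ.+-identityʳ N)

  *-cancelʳ : ∀ {p q} r → r ≢ 0ℚ → p * r ≡ q * r → p ≡ q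
  *-cancelʳ {p} {q} r r≢0 eq = begin
    p                ≡⟨ expand p ⟩
    p * r * 1/ r     ≡⟨ cong (_* 1/ r) eq ⟩
    q * r * 1/ r     ≡⟨ expand q ⟨
    q                ∎
    where
    open ≡-Reasoning
    instance
      r-nonZero = ≢-nonZero r≢0
    expand : ∀ x → x ≡ x * r * 1/ r
    expand x = sym (trans (ℚ.*-assoc x r (1/ r)) (trans (cong (x *_) (ℚ.*-inverseʳ r)) (ℚ.*-identityʳ x)))

  β-central : ∀ N → β N * nat ((2 ℕ.* N) C N) ≡ 1ℚ
  β-central N = *-cancelʳ (nat (N ! ℕ.* N !)) N!²≢0 (begin
    β N * nat ((2 ℕ.* N) C N) * nat (N ! ℕ.* N !)
      ≡⟨ ℚ.*-assoc (β N) (nat ((2 ℕ.* N) C N)) (nat (N ! ℕ.* N !)) ⟩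
    β N * (nat ((2 ℕ.* N) C N) * nat (N ! ℕ.* N !))   ≡⟨ cong (β N *_) (nat-* ((2 ℕ.* N) C N) (N ! ℕ.* N !)) ⟨
    β N * nat (((2 ℕ.* N) C N) ℕ.* (N ! ℕ.* N !))     ≡⟨ cong (λ m → β N * nat m) (central-! N) ⟩
    β N * nat ((2 ℕ.* N) !)                           ≡⟨ β-! N ⟩
    nat (N !) * nat (N !)                             ≡⟨ nat-* (N !) (N !) ⟨
    nat (N ! ℕ.* N !)                                 ≡⟨ ℚ.*-identityˡ (nat (N ! ℕ.* N !)) ⟨
    1ℚ * nat (N ! ℕ.* N !)                            ∎)
    where
    open ≡-Reasoning
    N!²≢0 : nat (N ! ℕ.* N !) ≢ 0ℚ
    N!²≢0 eq =
      ℕ.≢-nonZero⁻¹ (N ! ℕ.* N !) {{N ℕ.!* N !≢0}}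
        (ℤ.+-injective (ℤ→ℚ-injective (trans (sym (nat≡ (N ! ℕ.* N !))) eq)))

  -¼^*-4^ : ∀ n → -¼ ^ n * ℤ→ℚ ((ℤ.- (ℤ.+ 4)) ℤ.^ n) ≡ 1ℚ
  -¼^*-4^ zero    = refl
  -¼^*-4^ (suc n) = begin
    -¼ ^ suc n * ℤ→ℚ ((ℤ.- (ℤ.+ 4)) ℤ.* (ℤ.- (ℤ.+ 4)) ℤ.^ n)
      ≡⟨ cong (-¼ ^ suc n *_) (ℤ→ℚ-* (ℤ.- (ℤ.+ 4)) ((ℤ.- (ℤ.+ 4)) ℤ.^ n)) ⟩
    -¼ ^ suc n * (-4ℚ * ℤ→ℚ ((ℤ.- (ℤ.+ 4)) ℤ.^ n))
      ≡⟨ identity (-¼ ^ n) (ℤ→ℚ ((ℤ.- (ℤ.+ 4)) ℤ.^ n)) ⟩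
    -¼ ^ n * ℤ→ℚ ((ℤ.- (ℤ.+ 4)) ℤ.^ n)
      ≡⟨ -¼^*-4^ n ⟩
    1ℚ ∎
    where
    open ≡-Reasoning
    identity : ∀ p q → -¼ * p * (-4ℚ * q) ≡ p * q
    identity = solve-∀ ring

  ÷-inverse : ∀ p q t .{{_ : NonZero q}} → t * q ≡ 1ℚ → p ÷ q ≡ t * p
  ÷-inverse p q t tq≡1 = begin
    p * 1/ q               ≡⟨ ℚ.*-identityˡ (p * 1/ q) ⟨
    1ℚ * (p * 1/ q)        ≡⟨ cong (_* (p * 1/ q)) tq≡1 ⟨
    t * q * (p * 1/ q)     ≡⟨ regroup t q p (1/ q) ⟩
    t * p * (q * 1/ q)     ≡⟨ cong (t * p *_) (ℚ.*-inverseʳ q) ⟩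
    t * p * 1ℚ             ≡⟨ ℚ.*-identityʳ (t * p) ⟩
    t * p                  ∎
    where
    open ≡-Reasoning
    regroup : ∀ t q p r → t * q * (p * r) ≡ t * p * (q * r)
    regroup = solve-∀ ring

  module _ (k e : ℕ) (d≡4k : suc e ≡ k ℕ.* 4) where
    open Coefficients k e d≡4k
    open Block k e d≡4k
    open Telescope k e d≡4k

    t-denominator : ∀ n → t n * ℤ→ℚ (denominator k n) ≡ 1ℚ
    t-denominator n = begin
      t n * ℤ→ℚ (denominator k n)
        ≡⟨ cong (t n *_) (trans
            (ℤ→ℚ-* (ℤ.+ ((8 ℕ.* k ℕ.* n) C (4 ℕ.* k ℕ.* n))) ((ℤ.- (ℤ.+ 4)) ℤ.^ (k ℕ.* n)))
             (cong (_* E) (sym (nat≡ ((8 ℕ.* k ℕ.* n) C (4 ℕ.* k ℕ.* n)))))) ⟩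
      t n * (nat ((8 ℕ.* k ℕ.* n) C (4 ℕ.* k ℕ.* n)) * E)
        ≡⟨ cong₂ (λ u v → t n * (nat (u C v) * E)) (trans (8kn k n) (cong (2 ℕ.*_) (sym N≡)))
          (trans (4kn k n) (sym N≡)) ⟩
      t n * (nat ((2 ℕ.* N n) C (N n)) * E)
        ≡⟨ cong (λ s → s * β (N n) * (nat ((2 ℕ.* N n) C (N n)) * E)) (^-assocʳ -¼ k n) ⟩
      -¼ ^ (k ℕ.* n) * β (N n) * (nat ((2 ℕ.* N n) C (N n)) * E)
        ≡⟨ regroup (-¼ ^ (k ℕ.* n)) (β (N n)) (nat ((2 ℕ.* N n) C (N n))) E ⟩
      (β (N n) * nat ((2 ℕ.* N n) C (N n))) * (-¼ ^ (k ℕ.* n) * E)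
        ≡⟨ cong₂ _*_ (β-central (N n)) (-¼^*-4^ (k ℕ.* n)) ⟩
      1ℚ * 1ℚ
        ≡⟨⟩
      1ℚ ∎
      where
      open ≡-Reasoning
      E : ℚ
      E = ℤ→ℚ ((ℤ.- (ℤ.+ 4)) ℤ.^ (k ℕ.* n))
      N≡ : N n ≡ n ℕ.* (k ℕ.* 4)
      N≡ = cong (n ℕ.*_) d≡4k
      8kn : ∀ k n → 8 ℕ.* k ℕ.* n ≡ 2 ℕ.* (n ℕ.* (k ℕ.* 4))
      8kn = ℕ-Solver.solve-∀
      4kn : ∀ k n → 4 ℕ.* k ℕ.* n ≡ n ℕ.* (k ℕ.* 4)
      4kn = ℕ-Solver.solve-∀
      regroup : ∀ s B c E → s * B * (c * E) ≡ (B * c) * (s * E)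
      regroup = solve-∀ ring

    summand-polynomial : ∀ n → summand k polynomial n ≡ t n * S (nat (N n))
    summand-polynomial n = trans
      (÷-inverse (eval polynomial (ℤ→ℚ (ℤ.+ n))) (ℤ→ℚ (denominator k n)) (t n)
          {{ℤ→ℚ-nonZero (denominator≢0 k n)}} (t-denominator n))
      (cong (t n *_) (trans (eval-polynomial (ℤ→ℚ (ℤ.+ n)))
        (cong S (trans (cong (_* c) (sym (nat≡ n))) (sym (nat-* n (suc e)))))))

-- Rational calculus on the unit interval and the expansion of 4 / (1 + x ^ 2).

module Calculus where

  open Arithmetic
  open Series

  record Unit (x : ℚ) : Set where
    constructor unit
    field
      0≤x : 0ℚ ≤ x
      x≤1 : x ≤ 1ℚ

  open Unit

  ∣∣≤1 : ∀ {x} → Unit x → ∣ x ∣ ≤ 1ℚ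
  ∣∣≤1 (unit 0≤x x≤1) = subst (_≤ 1ℚ) (sym (ℚ.0≤p⇒∣p∣≡p 0≤x)) x≤1

  ∣x-x′∣≤1 : ∀ {x x′} → Unit x → Unit x′ → ∣ x′ - x ∣ ≤ 1ℚ
  ∣x-x′∣≤1 {x} {x′} (unit 0≤x x≤1) (unit 0≤x′ x′≤1) = ∣∣≤
    (≤-+ ((1ℚ - x′) + x) (0≤+ (0≤∸ x′≤1) 0≤x) (identity x x′))
    (≤-+ ((1ℚ - x) + x′) (0≤+ (0≤∸ x≤1) 0≤x′) (identity′ x x′))
    where
    identity : ∀ x x′ → 1ℚ ≡ (x′ - x) + ((1ℚ - x′) + x)
    identity = solve-∀ ring
    identity′ : ∀ x x′ → 1ℚ ≡ - (x′ - x) + ((1ℚ - x) + x′)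
    identity′ = solve-∀ ring

  infix 4 _HasDerivative_

  -- Differentiability on the unit interval, with a uniform second-order error term.

  record _HasDerivative_ (F f : ℚ → ℚ) : Set where
    field
      B₀ B₁ C  : ℚ
      ∣F∣≤     : ∀ {x} → Unit x → ∣ F x ∣ ≤ B₀
      ∣f∣≤     : ∀ {x} → Unit x → ∣ f x ∣ ≤ B₁
      taylor   : ∀ {x x′} → Unit x → Unit x′ →
                 ∣ F x′ - F x - (x′ - x) * f x ∣ ≤ C * ((x′ - x) * (x′ - x))

  open _HasDerivative_

  derivative-cong : ∀ {F G f g} → (∀ x → F x ≡ G x) → (∀ x → f x ≡ g x) → F HasDerivative f →
      G HasDerivative g
  derivative-cong F≗G f≗g D = record
    { B₀ = B₀ D ; B₁ = B₁ D ; C = C D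
    ; ∣F∣≤ = λ {x} u → subst (λ z → ∣ z ∣ ≤ B₀ D) (F≗G x) (∣F∣≤ D u)
    ; ∣f∣≤ = λ {x} u → subst (λ z → ∣ z ∣ ≤ B₁ D) (f≗g x) (∣f∣≤ D u)
    ; taylor = λ {x} {x′} u u′ → subst (λ z → ∣ z ∣ ≤ C D * ((x′ - x) * (x′ - x)))
        (cong₂ (λ F f → F - (x′ - x) * f) (cong₂ _-_ (F≗G x′) (F≗G x)) (f≗g x)) (taylor D u u′)
    }

  derivative-const : ∀ c → (λ _ → c) HasDerivative (λ _ → 0ℚ)
  derivative-const c = record
    { B₀ = ∣ c ∣ ; B₁ = 0ℚ ; C = 0ℚ ; ∣F∣≤ = λ _ → ℚ.≤-refl ; ∣f∣≤ = λ _ → ℚ.≤-refl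
    ; taylor =
      λ {x} {x′} _ _ → ℚ.≤-reflexive
        (trans (cong ∣_∣ (identity c (x′ - x))) (sym (ℚ.*-zeroˡ ((x′ - x) * (x′ - x)))))
    }
    where
    identity : ∀ c δ → c - c - δ * 0ℚ ≡ 0ℚ
    identity = solve-∀ ring

  derivative-id : (λ x → x) HasDerivative (λ _ → 1ℚ)
  derivative-id = record
    { B₀ = 1ℚ ; B₁ = 1ℚ ; C = 0ℚ ; ∣F∣≤ = ∣∣≤1 ; ∣f∣≤ = λ _ → ℚ.≤-refl
    ; taylor =
      λ {x} {x′} _ _ → ℚ.≤-reflexive
        (trans (cong ∣_∣ (identity x x′)) (sym (ℚ.*-zeroˡ ((x′ - x) * (x′ - x)))))
    }
    where
    identity : ∀ x x′ → x′ - x - (x′ - x) * 1ℚ ≡ 0ℚ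
    identity = solve-∀ ring

  derivative-+ : ∀ {F f G g} → F HasDerivative f → G HasDerivative g →
                 (λ x → F x + G x) HasDerivative (λ x → f x + g x)
  derivative-+ {F} {f} {G} {g} D E = record
    { B₀ = B₀ D + B₀ E ; B₁ = B₁ D + B₁ E ; C = C D + C E
    ; ∣F∣≤ = λ u → ∣+∣≤ (∣F∣≤ D u) (∣F∣≤ E u)
    ; ∣f∣≤ = λ u → ∣+∣≤ (∣f∣≤ D u) (∣f∣≤ E u)
    ; taylor = λ {x} {x′} u u′ → subst₂ (λ a b → ∣ a ∣ ≤ b)
        (identity (F x) (F x′) (f x) (G x) (G x′) (g x) (x′ - x))
        (sym (ℚ.*-distribʳ-+ ((x′ - x) * (x′ - x)) (C D) (C E)))
        (∣+∣≤ (taylor D u u′) (taylor E u u′))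
    }
    where
    identity : ∀ F F′ f G G′ g δ → (F′ - F - δ * f) + (G′ - G - δ * g) ≡ (F′ + G′) - (F + G) - δ * (f + g)
    identity = solve-∀ ring

  derivative-* : ∀ {F f G g} → F HasDerivative f → G HasDerivative g →
                 (λ x → F x * G x) HasDerivative (λ x → f x * G x + F x * g x)
  derivative-* {F} {f} {G} {g} D E = record
    { B₀ = B₀ D * B₀ E ; B₁ = B₁ D * B₀ E + B₀ D * B₁ E
    -- The factor `1ℚ` bounds `∣ x′ - x ∣` and reduces the third-order part of the error to second
    -- order.
    ; C = C D * B₀ E + B₀ D * C E + 1ℚ * (B₁ D * C E) + B₁ D * B₁ E
    ; ∣F∣≤ = λ u → ∣*∣≤ (∣F∣≤ D u) (∣F∣≤ E u)
    ; ∣f∣≤ = λ u → ∣+∣≤ (∣*∣≤ (∣f∣≤ D u) (∣F∣≤ E u)) (∣*∣≤ (∣F∣≤ D u) (∣f∣≤ E u))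
    ; taylor = λ {x} {x′} u u′ → let δ = x′ - x in subst₂ (λ a b → ∣ a ∣ ≤ b)
        (identity (F x) (F x′) (f x) (G x) (G x′) (g x) δ)
        (collect (C D) (B₀ E) (B₀ D) (C E) (B₁ D) (B₁ E) (δ * δ))
        (∣+∣≤ (∣+∣≤ (∣+∣≤ (∣*∣≤ (taylor D u u′) (∣F∣≤ E u′)) (∣*∣≤ (∣F∣≤ D u) (taylor E u u′)))
          (∣*∣≤ (∣x-x′∣≤1 u u′) (∣*∣≤ (∣f∣≤ D u) (taylor E u u′))))
          (∣*∣≤ (∣*∣≤ (∣f∣≤ D u) (∣f∣≤ E u)) (ℚ.≤-reflexive (ℚ.0≤p⇒∣p∣≡p (0≤² δ)))))
    }
    where
    identity : ∀ F F′ f G G′ g δ →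
      (F′ - F - δ * f) * G′ + F * (G′ - G - δ * g) + δ * (f * (G′ - G - δ * g)) + (f * g) * (δ * δ) ≡
      F′ * G′ - F * G - δ * (f * G + F * g)
    identity = solve-∀ ring
    collect : ∀ C B′ B C′ b b′ s → C * s * B′ + B * (C′ * s) + 1ℚ * (b * (C′ * s)) + (b * b′) * s ≡
      (C * B′ + B * C′ + 1ℚ * (b * C′) + b * b′) * s
    collect = solve-∀ ring

  derivative-scale : ∀ {F f} c → F HasDerivative f → (λ x → c * F x) HasDerivative (λ x → c * f x)
  derivative-scale {F} {f} c D =
    derivative-cong (λ _ → refl) (λ x → identity (F x) c (f x)) (derivative-* (derivative-const c) D)
    where
    identity : ∀ F c f → 0ℚ * F + c * f ≡ c * f
    identity = solve-∀ ring

  derivative-partialSum : ∀ {F f : ℕ → ℚ → ℚ} n → (∀ i → F i HasDerivative f i) →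
    (λ x → partialSum (λ i → F i x) n) HasDerivative (λ x → partialSum (λ i → f i x) n)
  derivative-partialSum zero    D = derivative-const 0ℚ
  derivative-partialSum (suc n) D = derivative-+ (D 0) (derivative-partialSum n (D ∘ suc))

  w w′ : ℚ → ℚ
  w  x = x - x * x
  w′ x = 1ℚ - 2ℚ * x

  w-derivative : w HasDerivative w′
  w-derivative = derivative-cong shape identity
    (derivative-+ derivative-id (derivative-scale (- 1ℚ) (derivative-* derivative-id derivative-id)))
    where
    shape : ∀ x → x + - 1ℚ * (x * x) ≡ x - x * x
    shape = solve-∀ ring
    identity : ∀ x → 1ℚ + - 1ℚ * (1ℚ * x + x * 1ℚ) ≡ 1ℚ - 2ℚ * x
    identity = solve-∀ ring

  w′-derivative : w′ HasDerivative (λ _ → - 2ℚ)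
  w′-derivative =
    derivative-cong shape (λ _ → refl)
      (derivative-+ (derivative-const 1ℚ) (derivative-scale (- 2ℚ) derivative-id))
    where
    shape : ∀ x → 1ℚ + - 2ℚ * x ≡ 1ℚ - 2ℚ * x
    shape = solve-∀ ring

  w^-derivative : ∀ n → (λ x → w x ^ suc n) HasDerivative (λ x → nat (suc n) * (w′ x * w x ^ n))
  w^-derivative zero =
    derivative-cong (λ _ → refl) (λ x → trans (identity (w x) (w′ x)) (cong (_* (w′ x * 1ℚ)) (sym (nat≡ 1))))
    (derivative-* w-derivative (derivative-const 1ℚ))
    where
    identity : ∀ w v → v * 1ℚ + w * 0ℚ ≡ 1ℚ * (v * 1ℚ)
    identity = solve-∀ ring
  w^-derivative (suc n) = derivative-cong (λ _ → refl)
    (λ x → trans (identity (w x) (w′ x) (w x ^ n) (nat (suc n)))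
        (cong (_* (w′ x * w x ^ suc n)) (sym (nat-suc (suc n)))))
    (derivative-* w-derivative (w^-derivative n))
    where
    identity : ∀ w v p n → v * (w * p) + w * (n * (v * p)) ≡ (1ℚ + n) * (v * (w * p))
    identity = solve-∀ ring

  -- The recursion integrates by parts.

  ∫w^ : ℕ → ℚ → ℚ
  ∫w^ zero    x = x
  ∫w^ (suc N) x = (½ * 1/odd (suc N)) * ((1ℚ + nat N) * ∫w^ N x + - 1ℚ * (w′ x * w x ^ suc N))

  -- Since `w′ ^ 2 = 1 - 4 w`, the derivative of `w′ * w ^ (N + 1)` is
  -- `(N + 1) w ^ N - 2 (2N + 3) w ^ (N + 1)`.
  ∫w^-derivative : ∀ N → ∫w^ N HasDerivative (λ x → w x ^ N)
  ∫w^-derivative zero    = derivative-id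
  ∫w^-derivative (suc N) = derivative-cong (λ _ → refl)
    (λ x → trans (cong (λ n → (½ * i) * ((1ℚ + nat N) * w x ^ N + - 1ℚ * (- 2ℚ * w x ^ suc N + w′ x * (n * (w′ x * w x ^ N))))) (nat-suc N))
      (modulo (w x ^ suc N) (1/odd-suc-inverse N) (identity i (nat N) (w x ^ N) x)))
    (derivative-scale (½ * i) (derivative-+ (derivative-scale (1ℚ + nat N) (∫w^-derivative N))
      (derivative-scale (- 1ℚ) (derivative-* w′-derivative (w^-derivative N)))))
    where
    i : ℚ
    i = 1/odd (suc N)
    identity : ∀ i n p x →
      (½ * i) * ((1ℚ + n) * p + - 1ℚ * (- 2ℚ * ((x - x * x) * p) + (1ℚ - 2ℚ * x) * ((1ℚ + n) * ((1ℚ - 2ℚ * x) * p)))) - (x - x * x) * p ≡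
      ((x - x * x) * p) * (i * (2ℚ * (1ℚ + n) + 1ℚ) - 1ℚ)
    identity = solve-∀ ring

  ∫w^-0 : ∀ N → ∫w^ N 0ℚ ≡ 0ℚ
  ∫w^-0 zero    = refl
  ∫w^-0 (suc N) =
    trans (cong (λ z → (½ * 1/odd (suc N)) * ((1ℚ + nat N) * z + - 1ℚ * (1ℚ * (0ℚ * w 0ℚ ^ N)))) (∫w^-0 N))
    (identity (½ * 1/odd (suc N)) (1ℚ + nat N) (w 0ℚ ^ N))
    where
    identity : ∀ c n p → c * (n * 0ℚ + - 1ℚ * (1ℚ * (0ℚ * p))) ≡ 0ℚ
    identity = solve-∀ ring

  ∫w^-1 : ∀ N → ∫w^ N 1ℚ ≡ b N
  ∫w^-1 zero    = sym (trans (cong (1ℚ *_) 1/odd-zero) (ℚ.*-identityˡ 1ℚ))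
  ∫w^-1 (suc N) =
    trans (cong (λ z → (½ * 1/odd (suc N)) * ((1ℚ + nat N) * z + - 1ℚ * (- 1ℚ * (0ℚ * w 1ℚ ^ N)))) (∫w^-1 N))
    (identity (1/odd (suc N)) (nat N) (w 1ℚ ^ N) (β N) (1/odd N))
    where
    identity : ∀ i n p B j →
        (½ * i) * ((1ℚ + n) * (B * j) + - 1ℚ * (- 1ℚ * (0ℚ * p))) ≡ B * ((1ℚ + n) * ½ * j) * i
    identity = solve-∀ ring

  -- The power series of `2 / (w ^ 2 - 2 w + 2)`. It accompanies `w′` because
  -- `4 (x ^ 2 - 2 x + 2) = 6 - 4 w + 2 w′`.
  g : ℕ → ℚ
  g zero          = 1ℚ
  g (suc zero)    = 1ℚ
  g (suc (suc N)) = g (suc N) - ½ * g N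

  -- The coefficients of 4 / (1 + x ^ 2) = 4 (x ^ 2 - 2 x + 2) / (w ^ 2 - 2 w + 2)
  -- as a power series in w.

  a : ℕ → ℚ → ℚ
  a N x = y 0 (suc N) + g N * w′ x

  -- The part with `g` integrates to a power of `w` and so drops out at both endpoints.
  ∫a-term ∫a : ℕ → ℚ → ℚ
  ∫a-term N x = y 0 (suc N) * ∫w^ N x + (g N * 1/1+ N) * w x ^ suc N
  ∫a K x = partialSum (λ N → ∫a-term N x) K

  A : ℕ → ℚ → ℚ
  A K x = partialSum (λ N → a N x * w x ^ N) K

  ∫a-derivative : ∀ K → ∫a K HasDerivative A K
  ∫a-derivative K = derivative-partialSum K λ N → derivative-cong (λ _ → refl)
    (λ x → modulo (g N * w′ x * w x ^ N) (1/1+-inverse-nat N)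
      (identity (y 0 (suc N)) (g N) (1/1+ N) (nat (suc N)) (w′ x) (w x ^ N)))
    (derivative-+ (derivative-scale (y 0 (suc N)) (∫w^-derivative N))
        (derivative-scale (g N * 1/1+ N) (w^-derivative N)))
    where
    identity : ∀ y g i n v p → y * p + (g * i) * (n * (v * p)) - (y + g * v) * p ≡ (g * v * p) * (i * n - 1ℚ)
    identity = solve-∀ ring

  ∫a-0 : ∀ K → ∫a K 0ℚ ≡ 0ℚ
  ∫a-0 K =
    trans (partialSum-cong< K λ N _ → trans
        (cong (λ z → y 0 (suc N) * z + (g N * 1/1+ N) * (0ℚ * w 0ℚ ^ N)) (∫w^-0 N))
    (identity (y 0 (suc N)) (g N * 1/1+ N) (w 0ℚ ^ N))) (zeros K)
    where
    identity : ∀ y c p → y * 0ℚ + c * (0ℚ * p) ≡ 0ℚ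
    identity = solve-∀ ring
    zeros : ∀ K → partialSum (λ _ → 0ℚ) K ≡ 0ℚ
    zeros zero    = refl
    zeros (suc K) = cong (0ℚ +_) (zeros K)

  ∫a-1 : ∀ K → ∫a K 1ℚ ≡ partialSum (λ N → b N * y 0 (suc N)) K
  ∫a-1 K =
    partialSum-cong< K λ N _ → trans
      (cong (λ z → y 0 (suc N) * z + (g N * 1/1+ N) * (0ℚ * w 1ℚ ^ N)) (∫w^-1 N))
    (identity (y 0 (suc N)) (b N) (g N * 1/1+ N) (w 1ℚ ^ N))
    where
    identity : ∀ y b c p → y * b + c * (0ℚ * p) ≡ b * y
    identity = solve-∀ ring

  a-recurrence : ∀ N x → a (suc (suc N)) x ≡ a (suc N) x - ½ * a N x
  a-recurrence N x = identity (y 0 (suc N)) (y 0 (suc (suc N))) (g N) (g (suc N)) (w′ x)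
    where
    identity : ∀ y y′ g g′ v → (y′ - ½ * y) + (g′ - ½ * g) * v ≡ (y′ + g′ * v) - ½ * (y + g * v)
    identity = solve-∀ ring

  -- The tail of the series from `K` on, multiplied by `w ^ 2 - 2 w + 2`: the recurrence kills all
  -- coefficients but the first two.
  A-remainder : ℕ → ℚ → ℚ
  A-remainder K x = w x ^ K * (2ℚ * a K x + w x * (2ℚ * a (suc K) x - 2ℚ * a K x))

  A-identity : ∀ K x → (1ℚ + (1ℚ - x) * (1ℚ - x)) * (A K x * (1ℚ + x * x) - 4ℚ) ≡ - A-remainder K x
  A-identity zero    x = identity x
    where
    identity : ∀ x → (1ℚ + (1ℚ - x) * (1ℚ - x)) * (0ℚ * (1ℚ + x * x) - 4ℚ) ≡
      - (1ℚ * (2ℚ * (3ℚ + 1ℚ * (1ℚ - 2ℚ * x)) + (x - x * x) * (2ℚ * (3ℚ - ½ * 4ℚ + 1ℚ * (1ℚ - 2ℚ * x)) - 2ℚ * (3ℚ + 1ℚ * (1ℚ - 2ℚ * x)))))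
    identity = solve-∀ ring
  A-identity (suc K) x = begin
    (1ℚ + (1ℚ - x) * (1ℚ - x)) * (A (suc K) x * (1ℚ + x * x) - 4ℚ)
      ≡⟨ cong (λ s → (1ℚ + (1ℚ - x) * (1ℚ - x)) * (s * (1ℚ + x * x) - 4ℚ))
        (partialSum-suc (λ N → a N x * w x ^ N) K) ⟩
    (1ℚ + (1ℚ - x) * (1ℚ - x)) * ((A K x + a K x * w x ^ K) * (1ℚ + x * x) - 4ℚ)
      ≡⟨ expand x (A K x) (a K x) (w x ^ K) ⟩
    (1ℚ + (1ℚ - x) * (1ℚ - x)) * (A K x * (1ℚ + x * x) - 4ℚ) + (1ℚ + (1ℚ - x) * (1ℚ - x)) * (1ℚ + x * x) * (a K x * w x ^ K)
      ≡⟨ cong (_+ (1ℚ + (1ℚ - x) * (1ℚ - x)) * (1ℚ + x * x) * (a K x * w x ^ K)) (A-identity K x) ⟩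
    - A-remainder K x + (1ℚ + (1ℚ - x) * (1ℚ - x)) * (1ℚ + x * x) * (a K x * w x ^ K)
      ≡⟨ step x (w x ^ K) (a K x) (a (suc K) x) ⟩
    - (w x ^ suc K * (2ℚ * a (suc K) x + w x * (2ℚ * (a (suc K) x - ½ * a K x) - 2ℚ * a (suc K) x)))
      ≡⟨ cong (λ z → - (w x ^ suc K * (2ℚ * a (suc K) x + w x * (2ℚ * z - 2ℚ * a (suc K) x))))
        (a-recurrence K x) ⟨
    - A-remainder (suc K) x ∎
    where
    open ≡-Reasoning
    expand : ∀ x A a p → (1ℚ + (1ℚ - x) * (1ℚ - x)) * ((A + a * p) * (1ℚ + x * x) - 4ℚ) ≡
      (1ℚ + (1ℚ - x) * (1ℚ - x)) * (A * (1ℚ + x * x) - 4ℚ) + (1ℚ + (1ℚ - x) * (1ℚ - x)) * (1ℚ + x * x) * (a * p)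
    expand = solve-∀ ring
    step : ∀ x p a a′ →
      - (p * (2ℚ * a + (x - x * x) * (2ℚ * a′ - 2ℚ * a))) +
        (1ℚ + (1ℚ - x) * (1ℚ - x)) * (1ℚ + x * x) * (a * p) ≡
      - ((x - x * x) * p * (2ℚ * a′ + (x - x * x) * (2ℚ * (a′ - ½ * a) - 2ℚ * a′)))
    step = solve-∀ ring

  0≤2 : 0ℚ ≤ 2ℚ
  0≤2 = ℚ.nonNegative⁻¹ 2ℚ

  0≤½ : 0ℚ ≤ ½
  0≤½ = ℚ.nonNegative⁻¹ ½

  -- A crude growth bound suffices, since `∣ w x ∣ ≤ ¼` still leaves `½ ^ K`.
  ∣a∣≤ : ∀ K {x} → Unit x → ∣ a K x ∣ ≤ 4ℚ * 2ℚ ^ K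
  ∣a∣≤ zero {x} (unit 0≤x x≤1) = ∣∣≤
    (≤-+ (2ℚ * x) (0≤* 0≤2 0≤x) (identity x))
    (≤-+ (4ℚ + 4ℚ - 2ℚ * x)
        (0≤∸ (*-mono {2ℚ} {4ℚ + 4ℚ} {x} {1ℚ} (ℚ.nonNegative⁻¹ (4ℚ + 4ℚ)) 0≤x (ℚ.≤ᵇ⇒≤ _) x≤1)) (identity′ x))
    where
    identity : ∀ x → 4ℚ * 1ℚ ≡ 3ℚ + 1ℚ * (1ℚ - 2ℚ * x) + 2ℚ * x
    identity = solve-∀ ring
    identity′ : ∀ x → 4ℚ * 1ℚ ≡ - (3ℚ + 1ℚ * (1ℚ - 2ℚ * x)) + (4ℚ + 4ℚ - 2ℚ * x)
    identity′ = solve-∀ ring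
  ∣a∣≤ (suc zero) {x} (unit 0≤x x≤1) = ∣∣≤
    (≤-+ (4ℚ + 2ℚ + 2ℚ * x) (0≤+ (ℚ.nonNegative⁻¹ (4ℚ + 2ℚ)) (0≤* 0≤2 0≤x)) (identity x))
    (≤-+ (8ℚ + 2ℚ - 2ℚ * x)
        (0≤∸ (*-mono {2ℚ} {8ℚ + 2ℚ} {x} {1ℚ} (ℚ.nonNegative⁻¹ (8ℚ + 2ℚ)) 0≤x (ℚ.≤ᵇ⇒≤ _) x≤1)) (identity′ x))
    where
    identity : ∀ x → 4ℚ * (2ℚ * 1ℚ) ≡ 3ℚ - ½ * 4ℚ + 1ℚ * (1ℚ - 2ℚ * x) + (4ℚ + 2ℚ + 2ℚ * x)
    identity = solve-∀ ring
    identity′ : ∀ x → 4ℚ * (2ℚ * 1ℚ) ≡ - (3ℚ - ½ * 4ℚ + 1ℚ * (1ℚ - 2ℚ * x)) + (8ℚ + 2ℚ - 2ℚ * x)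
    identity′ = solve-∀ ring
  ∣a∣≤ (suc (suc K)) {x} u = begin
    ∣ a (suc (suc K)) x ∣                     ≡⟨ cong ∣_∣ (a-recurrence K x) ⟩
    ∣ a (suc K) x - ½ * a K x ∣
      ≤⟨ ∣-∣≤ (∣a∣≤ (suc K) u) (∣*∣≤ {½} {a K x} ℚ.≤-refl (∣a∣≤ K u)) ⟩
    4ℚ * (2ℚ * q) + ½ * (4ℚ * q)
      ≤⟨ ≤-+ ((4ℚ + 2ℚ) * q) (0≤* (ℚ.nonNegative⁻¹ (4ℚ + 2ℚ)) (0≤^ K 0≤2)) (identity q) ⟩
    4ℚ * (2ℚ * (2ℚ * q))                      ∎
    where
    open ℚ.≤-Reasoning
    q : ℚ
    q = 2ℚ ^ K
    identity : ∀ q → 4ℚ * (2ℚ * (2ℚ * q)) ≡ 4ℚ * (2ℚ * q) + ½ * (4ℚ * q) + (4ℚ + 2ℚ) * q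
    identity = solve-∀ ring

  ∣w∣≤¼ : ∀ {x} → Unit x → ∣ w x ∣ ≤ ¼
  ∣w∣≤¼ {x} (unit 0≤x x≤1) = ∣∣≤
    (≤-+ ((½ - x) * (½ - x)) (0≤² (½ - x)) (identity x))
    (≤-+ (¼ + x * (1ℚ - x)) (0≤+ (ℚ.nonNegative⁻¹ ¼) (0≤* 0≤x (0≤∸ x≤1))) (identity′ x))
    where
    identity : ∀ x → ¼ ≡ x - x * x + (½ - x) * (½ - x)
    identity = solve-∀ ring
    identity′ : ∀ x → ¼ ≡ - (x - x * x) + (¼ + x * (1ℚ - x))
    identity′ = solve-∀ ring

  ∣w^∣2^≤ : ∀ K {x} → Unit x → ∣ w x ^ K ∣ * 2ℚ ^ K ≤ ½ ^ K
  ∣w^∣2^≤ zero    u = ℚ.≤-refl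
  ∣w^∣2^≤ (suc K) {x} u = begin
    ∣ w x * w x ^ K ∣ * (2ℚ * 2ℚ ^ K)          ≡⟨ cong (_* (2ℚ * 2ℚ ^ K)) (ℚ.∣p*q∣≡∣p∣*∣q∣ (w x) (w x ^ K)) ⟩
    ∣ w x ∣ * ∣ w x ^ K ∣ * (2ℚ * 2ℚ ^ K)      ≡⟨ regroup ∣ w x ∣ ∣ w x ^ K ∣ (2ℚ ^ K) ⟩
    (∣ w x ∣ * 2ℚ) * (∣ w x ^ K ∣ * 2ℚ ^ K)
      ≤⟨ *-mono {∣ w x ∣ * 2ℚ} {½} 0≤½ (0≤* (ℚ.0≤∣p∣ (w x ^ K)) (0≤^ K 0≤2)) (*-monoˡ {2ℚ} 0≤2 (∣w∣≤¼ u))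
        (∣w^∣2^≤ K u) ⟩
    ½ * ½ ^ K                                  ∎
    where
    open ℚ.≤-Reasoning
    regroup : ∀ w p q → w * p * (2ℚ * q) ≡ (w * 2ℚ) * (p * q)
    regroup = solve-∀ ring

  ∣A-remainder∣≤ : ∀ K {x} → Unit x → ∣ A-remainder K x ∣ ≤ 32ℚ * ½ ^ K
  ∣A-remainder∣≤ K {x} u = begin
    ∣ w x ^ K * (2ℚ * a K x + w x * (2ℚ * a (suc K) x - 2ℚ * a K x)) ∣
      ≤⟨ ∣*∣≤ {w x ^ K} ℚ.≤-refl (∣+∣≤ (∣*∣≤ {2ℚ} {a K x} ℚ.≤-refl (∣a∣≤ K u))
           (∣*∣≤ (∣w∣≤¼ u) (∣-∣≤ (∣*∣≤ {2ℚ} {a (suc K) x} ℚ.≤-refl (∣a∣≤ (suc K) u))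
               (∣*∣≤ {2ℚ} {a K x} ℚ.≤-refl (∣a∣≤ K u))))) ⟩
    ∣ w x ^ K ∣ * (2ℚ * (4ℚ * q) + ¼ * (2ℚ * (4ℚ * (2ℚ * q)) + 2ℚ * (4ℚ * q)))
      ≡⟨ collect ∣ w x ^ K ∣ q ⟩
    (8ℚ + 4ℚ + 2ℚ) * (∣ w x ^ K ∣ * q)
      ≤⟨ *-mono {8ℚ + 4ℚ + 2ℚ} {32ℚ} (ℚ.nonNegative⁻¹ 32ℚ) (0≤* (ℚ.0≤∣p∣ (w x ^ K)) (0≤^ K 0≤2)) (ℚ.≤ᵇ⇒≤ _)
        (∣w^∣2^≤ K u) ⟩
    32ℚ * ½ ^ K ∎
    where
    open ℚ.≤-Reasoning
    q : ℚ
    q = 2ℚ ^ K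
    collect : ∀ p q → p * (2ℚ * (4ℚ * q) + ¼ * (2ℚ * (4ℚ * (2ℚ * q)) + 2ℚ * (4ℚ * q))) ≡
        (8ℚ + 4ℚ + 2ℚ) * (p * q)
    collect = solve-∀ ring

  -- The cofactor `1 + (1 - x) ^ 2` in `A-identity` is at least 1 and may be dropped.
  A-≈ : ∀ K {x} → Unit x → ∣ A K x * (1ℚ + x * x) - 4ℚ ∣ ≤ 32ℚ * ½ ^ K
  A-≈ K {x} u = begin
    ∣ z ∣
      ≡⟨ ℚ.*-identityˡ ∣ z ∣ ⟨
    1ℚ * ∣ z ∣
      ≤⟨ *-monoˡ (ℚ.0≤∣p∣ z) (≤-+ {1ℚ} ((1ℚ - x) * (1ℚ - x)) (0≤² (1ℚ - x)) refl) ⟩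
    (1ℚ + (1ℚ - x) * (1ℚ - x)) * ∣ z ∣
      ≡⟨ cong (_* ∣ z ∣) (ℚ.0≤p⇒∣p∣≡p (0≤+ {1ℚ} 0≤1 (0≤² (1ℚ - x)))) ⟨
    ∣ 1ℚ + (1ℚ - x) * (1ℚ - x) ∣ * ∣ z ∣
      ≡⟨ ℚ.∣p*q∣≡∣p∣*∣q∣ (1ℚ + (1ℚ - x) * (1ℚ - x)) z ⟨
    ∣ (1ℚ + (1ℚ - x) * (1ℚ - x)) * z ∣
      ≡⟨ cong ∣_∣ (A-identity K x) ⟩
    ∣ - A-remainder K x ∣
      ≡⟨ ℚ.∣-p∣≡∣p∣ (A-remainder K x) ⟩
    ∣ A-remainder K x ∣
      ≤⟨ ∣A-remainder∣≤ K u ⟩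
    32ℚ * ½ ^ K ∎
    where
    open ℚ.≤-Reasoning
    z : ℚ
    z = A K x * (1ℚ + x * x) - 4ℚ

-- Lattice points on a circle and thin sectors.

module Circle where

  open Arithmetic
  open Calculus hiding (a; A; g)

  indicator-yes : ∀ {m n} → m ℕ.≤ n → 1 ℕ.≤ indicator[ m ≤ n ]
  indicator-yes {m} {n} m≤n with m ℕ.≤ᵇ n | ℕ.≤⇒≤ᵇ m≤n
  ... | true | _ = ℕ.≤-refl

  indicator-no : ∀ {m n} → n ℕ.< m → indicator[ m ≤ n ] ≡ 0
  indicator-no {m} {n} n<m with m ℕ.≤ᵇ n | ℕ.≤ᵇ⇒≤ m n
  ... | false | _   = refl
  ... | true  | m≤n = contradiction (m≤n _) (ℕ.<⇒≱ n<m)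

  Σ-≥ : ∀ {f k n} → k ℕ.≤ n → (∀ j → j ℕ.< k → 1 ℕ.≤ f j) → k ℕ.≤ Σ< n f
  Σ-≥ z≤n       1≤f = z≤n
  Σ-≥ (s≤s k≤n) 1≤f = ℕ.+-mono-≤ (1≤f 0 (s≤s z≤n)) (Σ-≥ k≤n (λ j j<k → 1≤f (suc j) (s≤s j<k)))

  Σ-≤ : ∀ {f} k n → (∀ j → f j ℕ.≤ 1) → (∀ j → k ℕ.≤ j → f j ≡ 0) → Σ< n f ℕ.≤ k
  Σ-≤ k       zero    f≤1 f≡0 = z≤n
  Σ-≤ zero    (suc n) f≤1 f≡0 =
    ℕ.+-mono-≤ (ℕ.≤-reflexive (f≡0 0 z≤n)) (Σ-≤ zero n (f≤1 ∘ suc) (λ j _ → f≡0 (suc j) z≤n))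
  Σ-≤ (suc k) (suc n) f≤1 f≡0 = ℕ.+-mono-≤ (f≤1 0) (Σ-≤ k n (f≤1 ∘ suc) (λ j k≤j → f≡0 (suc j) (s≤s k≤j)))

  record OnCircle (N X Y : ℕ) : Set where
    constructor onCircle
    field
      equation : X ℕ.* X ℕ.+ Y ℕ.* Y ≡ N ℕ.* N

  insideColumn-≥ : ∀ {N X Y i} → OnCircle N X Y → i ℕ.< X → Y ℕ.≤ insideColumn N i
  insideColumn-≥ {N} {X} {Y} {i} (onCircle circle) i<X =
    Σ-≥ Y≤N λ j j<Y → indicator-yes (ℕ.≤-trans (sq-mono i<X j<Y) (ℕ.≤-reflexive circle))
    where
    Y≤N : Y ℕ.≤ N
    Y≤N with ℕ.≤-<-connex Y N
    ... | inj₁ Y≤N = Y≤N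
    ... | inj₂ N<Y =
      contradiction (ℕ.≤-trans (ℕ.m≤n+m (Y ℕ.* Y) (X ℕ.* X)) (ℕ.≤-reflexive circle))
        (ℕ.<⇒≱ (ℕ.*-mono-< N<Y N<Y))

  insideColumn-≤ : ∀ {N X Y i} → OnCircle N X Y → X ℕ.≤ i → insideColumn N i ℕ.≤ Y
  insideColumn-≤ {N} {X} {Y} {i} (onCircle circle) X≤i =
    Σ-≤ Y N (λ j → indicator≤1 (suc i ℕ.* suc i ℕ.+ suc j ℕ.* suc j) (N ℕ.* N)) λ j Y≤j →
    indicator-no (ℕ.≤-trans (ℕ.≤-reflexive (cong suc (sym circle)))
      (ℕ.+-mono-<-≤ (ℕ.*-mono-< (s≤s X≤i) (s≤s X≤i)) (ℕ.*-mono-≤ (ℕ.m≤n⇒m≤1+n Y≤j) (ℕ.m≤n⇒m≤1+n Y≤j))))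

  columns : ℕ → ℕ → ℕ
  columns N X = Σ< X (insideColumn N)

  columns-step-≥ : ∀ {N X Y} X′ → OnCircle N X Y → X′ ℕ.≤ X →
      columns N X′ ℕ.+ (X ℕ.∸ X′) ℕ.* Y ℕ.≤ columns N X
  columns-step-≥ {N} {X} {Y} X′ circle X′≤X = begin
    columns N X′ ℕ.+ v ℕ.* Y                              ≡⟨ cong (columns N X′ ℕ.+_) (Σ-const v Y) ⟨
    columns N X′ ℕ.+ Σ< v (λ _ → Y)
      ≤⟨ ℕ.+-monoʳ-≤ (columns N X′) (Σ-mono v {g = λ i → insideColumn N (X′ ℕ.+ i)} λ i i<v →
                                                               insideColumn-≥ circle
                                                                 (ℕ.≤-trans (ℕ.+-monoʳ-< X′ i<v)
                                                                     (ℕ.≤-reflexive (ℕ.m+[n∸m]≡n X′≤X)))) ⟩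
    columns N X′ ℕ.+ Σ< v (λ i → insideColumn N (X′ ℕ.+ i)) ≡⟨ Σ-++ X′ v (insideColumn N) ⟨
    columns N (X′ ℕ.+ v)                                  ≡⟨ cong (columns N) (ℕ.m+[n∸m]≡n X′≤X) ⟩
    columns N X                                           ∎
    where
    open ℕ.≤-Reasoning
    v : ℕ
    v = X ℕ.∸ X′

  columns-step-≤ : ∀ {N X X′ Y′} → OnCircle N X′ Y′ → X′ ℕ.≤ X →
      columns N X ℕ.≤ columns N X′ ℕ.+ (X ℕ.∸ X′) ℕ.* Y′
  columns-step-≤ {N} {X} {X′} {Y′} circle X′≤X = begin
    columns N X                                           ≡⟨ cong (columns N) (ℕ.m+[n∸m]≡n X′≤X) ⟨
    columns N (X′ ℕ.+ v)                                  ≡⟨ Σ-++ X′ v (insideColumn N) ⟩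
    columns N X′ ℕ.+ Σ< v (λ i → insideColumn N (X′ ℕ.+ i))
      ≤⟨ ℕ.+-monoʳ-≤ (columns N X′)
        (Σ-mono v {f = λ i → insideColumn N (X′ ℕ.+ i)} λ i _ → insideColumn-≤ circle (ℕ.m≤m+n X′ i)) ⟩
    columns N X′ ℕ.+ Σ< v (λ _ → Y′)                      ≡⟨ cong (columns N X′ ℕ.+_) (Σ-const v Y′) ⟩
    columns N X′ ℕ.+ v ℕ.* Y′                             ∎
    where
    open ℕ.≤-Reasoning
    v : ℕ
    v = X ℕ.∸ X′

  nat-∸ : ∀ {m n} → n ℕ.≤ m → nat (m ℕ.∸ n) ≡ nat m - nat n
  nat-∸ {m} {n} n≤m = trans (split (nat (m ℕ.∸ n)) (nat n))
    (cong (_- nat n) (trans (sym (nat-+ (m ℕ.∸ n) n)) (cong nat (ℕ.m∸n+n≡m n≤m))))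
    where
    split : ∀ d n → d ≡ d + n - n
    split = solve-∀ ring

  nat-cancel-≤ : ∀ {m n} → nat m ≤ nat n → m ℕ.≤ n
  nat-cancel-≤ {m} {n} le with ℕ.≤-<-connex m n
  ... | inj₁ m≤n = m≤n
  ... | inj₂ n<m =
    contradiction (ℚ.+-monoˡ-≤ (- nat n)
        (ℚ.≤-trans (ℚ.≤-reflexive (sym (nat-suc n))) (ℚ.≤-trans (nat-mono n<m) le)))
    λ le′ → from-no (1ℚ ℚ.≤? 0ℚ) (subst₂ _≤_ (identity (nat n)) (ℚ.+-inverseʳ (nat n)) le′)
    where
    identity : ∀ n → 1ℚ + n - n ≡ 1ℚ
    identity = solve-∀ ring

  -- Both points lie exactly on the circle, so the columns between them are enclosed by two
  -- rectangles without any rounding term in `N`.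
  columns-stepℚ : ∀ {N X Y X′ Y′} → OnCircle N X Y → OnCircle N X′ Y′ → X′ ℕ.≤ X →
    (nat X - nat X′) * nat Y ≤ nat (columns N X) - nat (columns N X′) ×
    nat (columns N X) - nat (columns N X′) ≤ (nat X - nat X′) * nat Y′
  columns-stepℚ {N} {X} {Y} {X′} {Y′} circle circle′ X′≤X =
    subst (_≤ P - P′) (trans (cancel P′ (nat ((X ℕ.∸ X′) ℕ.* Y))) (v*≡ Y))
      (ℚ.+-monoˡ-≤ (- P′) (ℚ.≤-trans (ℚ.≤-reflexive (sym (nat-+ (columns N X′) ((X ℕ.∸ X′) ℕ.* Y))))
          (nat-mono (columns-step-≥ X′ circle X′≤X)))) ,
    subst (P - P′ ≤_) (trans (cancel P′ (nat ((X ℕ.∸ X′) ℕ.* Y′))) (v*≡ Y′))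
      (ℚ.+-monoˡ-≤ (- P′) (ℚ.≤-trans (nat-mono (columns-step-≤ circle′ X′≤X))
          (ℚ.≤-reflexive (nat-+ (columns N X′) ((X ℕ.∸ X′) ℕ.* Y′)))))
    where
    P P′ : ℚ
    P  = nat (columns N X)
    P′ = nat (columns N X′)
    cancel : ∀ p v → p + v - p ≡ v
    cancel = solve-∀ ring
    v*≡ : ∀ Z → nat ((X ℕ.∸ X′) ℕ.* Z) ≡ (nat X - nat X′) * nat Z
    v*≡ Z = trans (nat-* (X ℕ.∸ X′) Z) (cong (_* nat Z) (nat-∸ X′≤X))

  -- (px t , py t) is the rational parametrisation of the unit circle.

  0<1+t² : ∀ t → 0ℚ < 1ℚ + t * t
  0<1+t² t = ℚ.+-mono-<-≤ 0<1 (0≤² t)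

  ρ px py : ℚ → ℚ
  ρ t  = (1/ (1ℚ + t * t)) {{≢-nonZero (λ eq → ℚ.<⇒≢ (0<1+t² t) (sym eq))}}
  px t = (1ℚ - t * t) * ρ t
  py t = 2ℚ * t * ρ t

  ρ-inverse : ∀ t → ρ t * (1ℚ + t * t) ≡ 1ℚ
  ρ-inverse t = ℚ.*-inverseˡ (1ℚ + t * t) {{≢-nonZero (λ eq → ℚ.<⇒≢ (0<1+t² t) (sym eq))}}

  ρ-unit : ∀ t → Unit (ρ t)
  ρ-unit t = unit 0≤ρ (≤-+ (ρ t * (t * t)) (0≤* 0≤ρ (0≤² t)) (trans (sym (ρ-inverse t)) (identity (ρ t) t)))
    where
    identity : ∀ r t → r * (1ℚ + t * t) ≡ r + r * (t * t)
    identity = solve-∀ ring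
    0≤ρ : 0ℚ ≤ ρ t
    0≤ρ =
      subst (0ℚ ≤_) (trans (regroup (ρ t) (1ℚ + t * t))
          (trans (cong (_* ρ t) (ρ-inverse t)) (ℚ.*-identityˡ (ρ t))))
      (0≤* (0≤² (ρ t)) (ℚ.<⇒≤ (0<1+t² t)))
      where
      regroup : ∀ r u → (r * r) * u ≡ (r * u) * r
      regroup = solve-∀ ring

  px-difference : ∀ t t′ → px t - px t′ ≡ 2ℚ * (t′ - t) * ((t + t′) * (ρ t * ρ t′))
  px-difference t t′ =
    modulo₂ (2ℚ * ρ t′ - 1ℚ) (1ℚ - 2ℚ * ρ t) (ρ-inverse t) (ρ-inverse t′) (identity t t′ (ρ t) (ρ t′))
    where
    identity : ∀ t t′ r r′ →
        ((1ℚ - t * t) * r - (1ℚ - t′ * t′) * r′) - 2ℚ * (t′ - t) * ((t + t′) * (r * r′)) ≡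
      (2ℚ * r′ - 1ℚ) * (r * (1ℚ + t * t) - 1ℚ) + (1ℚ - 2ℚ * r) * (r′ * (1ℚ + t′ * t′) - 1ℚ)
    identity = solve-∀ ring

  py-difference : ∀ t t′ → py t′ - py t ≡ 2ℚ * (t′ - t) * ((1ℚ - t * t′) * (ρ t * ρ t′))
  py-difference t t′ =
    modulo₂ (- (2ℚ * t′ * ρ t′)) (2ℚ * t * ρ t) (ρ-inverse t) (ρ-inverse t′) (identity t t′ (ρ t) (ρ t′))
    where
    identity : ∀ t t′ r r′ → (2ℚ * t′ * r′ - 2ℚ * t * r) - 2ℚ * (t′ - t) * ((1ℚ - t * t′) * (r * r′)) ≡
      - (2ℚ * t′ * r′) * (r * (1ℚ + t * t) - 1ℚ) + 2ℚ * t * r * (r′ * (1ℚ + t′ * t′) - 1ℚ)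
    identity = solve-∀ ring

  -- The left-hand expression is four times the area of the triangle spanned by the
  -- points of the circle with parameters t and t′.

  cross-≈ : ∀ {t t′} → Unit t → Unit t′ →
    ∣ 2ℚ * (px t * py t′ - px t′ * py t) - (t′ - t) * (4ℚ * ρ t) ∣ ≤ 4ℚ * ((t′ - t) * (t′ - t))
  cross-≈ {t} {t′} u u′ = begin
    ∣ 2ℚ * (px t * py t′ - px t′ * py t) - δ * (4ℚ * ρ t) ∣
      ≡⟨ cong ∣_∣ (modulo (4ℚ * δ * ρ t) (ρ-inverse t′) (identity t t′ (ρ t) (ρ t′))) ⟩
    ∣ (- 4ℚ * (δ * δ)) * (t′ * (ρ t * ρ t′)) ∣
      ≤⟨ ∣*∣≤ {b = 1ℚ} (∣*∣≤ { - 4ℚ} {δ * δ} {4ℚ} ℚ.≤-refl (ℚ.≤-reflexive (ℚ.0≤p⇒∣p∣≡p (0≤² δ))))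
           (∣*∣≤ {a = 1ℚ} {b = 1ℚ} (∣∣≤1 u′) (∣*∣≤ {a = 1ℚ} {b = 1ℚ} (∣∣≤1 (ρ-unit t)) (∣∣≤1 (ρ-unit t′)))) ⟩
    4ℚ * (δ * δ) * 1ℚ
      ≡⟨ ℚ.*-identityʳ (4ℚ * (δ * δ)) ⟩
    4ℚ * (δ * δ) ∎
    where
    open ℚ.≤-Reasoning
    δ : ℚ
    δ = t′ - t
    identity : ∀ t t′ r r′ →
      (2ℚ * ((1ℚ - t * t) * r * (2ℚ * t′ * r′) - (1ℚ - t′ * t′) * r′ * (2ℚ * t * r)) - (t′ - t) * (4ℚ * r)) -
      (- 4ℚ * ((t′ - t) * (t′ - t))) * (t′ * (r * r′)) ≡
      4ℚ * (t′ - t) * r * (r′ * (1ℚ + t′ * t′) - 1ℚ)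
    identity = solve-∀ ring

  -- The upper and the lower rectangle in `sector-step` miss the triangle by exactly this amount,
  -- with opposite signs. It is of second order because both differences carry the factor `t′ - t`.
  corner-≤ : ∀ {t t′} → Unit t → Unit t′ →
      2ℚ * ((px t - px t′) * (py t′ - py t)) ≤ 16ℚ * ((t′ - t) * (t′ - t))
  corner-≤ {t} {t′} u@(unit 0≤t t≤1) u′@(unit 0≤t′ t′≤1) = begin
    2ℚ * ((px t - px t′) * (py t′ - py t))
      ≡⟨ trans (cong₂ (λ a b → 2ℚ * (a * b)) (px-difference t t′) (py-difference t t′))
        (regroup (t′ - t) (t + t′) (1ℚ - t * t′) (ρ t * ρ t′)) ⟩
    8ℚ * ((t′ - t) * (t′ - t)) * ((t + t′) * ((1ℚ - t * t′) * ((ρ t * ρ t′) * (ρ t * ρ t′))))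
      ≤⟨ *-monoʳ (0≤* (ℚ.nonNegative⁻¹ 8ℚ) (0≤² (t′ - t))) (ℚ.≤-trans (p≤∣p∣ _)
           (∣*∣≤ {a = 2ℚ} {b = 1ℚ} (∣+∣≤ (∣∣≤1 u) (∣∣≤1 u′))
               (∣*∣≤ {a = 1ℚ} {b = 1ℚ} (∣∣≤1 1-tt′) (∣*∣≤ {a = 1ℚ} {b = 1ℚ} ρρ′ ρρ′)))) ⟩
    8ℚ * ((t′ - t) * (t′ - t)) * 2ℚ
      ≡⟨ collect ((t′ - t) * (t′ - t)) ⟩
    16ℚ * ((t′ - t) * (t′ - t)) ∎
    where
    open ℚ.≤-Reasoning
    regroup : ∀ δ a b c → 2ℚ * ((2ℚ * δ * (a * c)) * (2ℚ * δ * (b * c))) ≡ 8ℚ * (δ * δ) * (a * (b * (c * c)))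
    regroup = solve-∀ ring
    collect : ∀ s → 8ℚ * s * 2ℚ ≡ 16ℚ * s
    collect = solve-∀ ring
    ρρ′ : ∣ ρ t * ρ t′ ∣ ≤ 1ℚ
    ρρ′ = ∣*∣≤ {a = 1ℚ} {b = 1ℚ} (∣∣≤1 (ρ-unit t)) (∣∣≤1 (ρ-unit t′))
    1-tt′ : Unit (1ℚ - t * t′)
    1-tt′ =
      unit (0≤∸ (*-mono {q = 1ℚ} {s = 1ℚ} 0≤1 0≤t′ t≤1 t′≤1))
        (≤-+ (t * t′) (0≤* 0≤t 0≤t′) (identity (t * t′)))
      where
      identity : ∀ x → 1ℚ ≡ 1ℚ - x + x
      identity = solve-∀ ring

  -- ΔW is four times the area of the columns between two consecutive points of the
  -- circle; subtracting 2 x y turns it into four times the area of a sector.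

  sector-step : ∀ {Φ p ε t t′ ΔW} (D : Φ HasDerivative p) →
    (∀ {t} → Unit t → ∣ p t * (1ℚ + t * t) - 4ℚ ∣ ≤ ε) →
    Unit t → Unit t′ → t ≤ t′ →
    4ℚ * ((px t - px t′) * py t) ≤ ΔW → ΔW ≤ 4ℚ * ((px t - px t′) * py t′) →
    ∣ ΔW - 2ℚ * (px t * py t - px t′ * py t′) - (Φ t′ - Φ t) ∣ ≤
    (t′ - t) * ε + (20ℚ + _HasDerivative_.C D) * ((t′ - t) * (t′ - t))
  sector-step {Φ} {p} {ε} {t} {t′} {ΔW} D p≈ u u′ t≤t′ lower upper = begin
    ∣ ΔW - 2ℚ * (x * y - x′ * y′) - (Φ t′ - Φ t) ∣
      ≡⟨ cong ∣_∣ (split ΔW x y x′ y′ (Φ t′) (Φ t) δ (p t) (ρ t)) ⟩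
    ∣ (ΔW - 2ℚ * (x * y - x′ * y′) - 2ℚ * (x * y′ - x′ * y)) + (2ℚ * (x * y′ - x′ * y) - δ * (4ℚ * ρ t)) +
      δ * (4ℚ * ρ t - p t) - (Φ t′ - Φ t - δ * p t) ∣
      ≤⟨ ∣-∣≤ (∣+∣≤ (∣+∣≤ area (cross-≈ u u′)) (∣*∣≤ (ℚ.≤-reflexive (ℚ.0≤p⇒∣p∣≡p (0≤∸ t≤t′))) density))
        (_HasDerivative_.taylor D u u′) ⟩
    16ℚ * (δ * δ) + 4ℚ * (δ * δ) + δ * (1ℚ * ε) + C * (δ * δ)
      ≡⟨ collect δ ε C ⟩
    δ * ε + (20ℚ + C) * (δ * δ) ∎
    where
    open ℚ.≤-Reasoning
    x y x′ y′ δ C : ℚ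
    x  = px t
    y  = py t
    x′ = px t′
    y′ = py t′
    δ  = t′ - t
    C  = _HasDerivative_.C D
    split : ∀ W x y x′ y′ F′ F δ p r → W - 2ℚ * (x * y - x′ * y′) - (F′ - F) ≡
      (W - 2ℚ * (x * y - x′ * y′) - 2ℚ * (x * y′ - x′ * y)) + (2ℚ * (x * y′ - x′ * y) - δ * (4ℚ * r)) +
      δ * (4ℚ * r - p) - (F′ - F - δ * p)
    split = solve-∀ ring
    collect : ∀ δ ε C →
        16ℚ * (δ * δ) + 4ℚ * (δ * δ) + δ * (1ℚ * ε) + C * (δ * δ) ≡ δ * ε + (20ℚ + C) * (δ * δ)
    collect = solve-∀ ring
    upper≡ : ∀ x y x′ y′ →
        4ℚ * ((x - x′) * y′) - 2ℚ * (x * y - x′ * y′) - 2ℚ * (x * y′ - x′ * y) ≡ 2ℚ * ((x - x′) * (y′ - y))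
    upper≡ = solve-∀ ring
    lower≡ : ∀ x y x′ y′ →
        - (4ℚ * ((x - x′) * y) - 2ℚ * (x * y - x′ * y′) - 2ℚ * (x * y′ - x′ * y)) ≡ 2ℚ * ((x - x′) * (y′ - y))
    lower≡ = solve-∀ ring
    area : ∣ ΔW - 2ℚ * (x * y - x′ * y′) - 2ℚ * (x * y′ - x′ * y) ∣ ≤ 16ℚ * (δ * δ)
    area = ℚ.≤-trans (∣∣≤
      (ℚ.≤-trans (ℚ.+-monoˡ-≤ (- (2ℚ * (x * y′ - x′ * y))) (ℚ.+-monoˡ-≤ (- (2ℚ * (x * y - x′ * y′))) upper))
          (ℚ.≤-reflexive (upper≡ x y x′ y′)))
      (ℚ.≤-trans (ℚ.neg-antimono-≤ (ℚ.+-monoˡ-≤ (- (2ℚ * (x * y′ - x′ * y)))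
          (ℚ.+-monoˡ-≤ (- (2ℚ * (x * y - x′ * y′))) lower))) (ℚ.≤-reflexive (lower≡ x y x′ y′))))
      (corner-≤ u u′)
    density : ∣ 4ℚ * ρ t - p t ∣ ≤ 1ℚ * ε
    density = subst (λ z → ∣ z ∣ ≤ 1ℚ * ε)
      (modulo (- p t) (ρ-inverse t) (identity (ρ t) (p t) t))
      (∣*∣≤ (subst (_≤ 1ℚ) (sym (ℚ.∣-p∣≡∣p∣ (ρ t))) (∣∣≤1 (ρ-unit t))) (p≈ u))
      where
      identity : ∀ r p t → - r * (p * (1ℚ + t * t) - 4ℚ) - (4ℚ * r - p) ≡ - p * (r * (1ℚ + t * t) - 1ℚ)
      identity = solve-∀ ring

-- From sectors to the area of the disc.

module Area where

  open Arithmetic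
  open Calculus hiding (a; A; g)
  open Circle

  archimedean : ∀ p → ∃[ n ] p ≤ nat n
  archimedean p =
    ℤ.∣ i ∣ , subst (p ≤_) (sym (nat≡ ℤ.∣ i ∣))
      (ℚ.toℚᵘ-cancel-≤ (ℚᵘ.≤-respʳ-≃ (ℚᵘ.≃-sym (toℚᵘ-ℤ→ℚ (ℤ.+ ℤ.∣ i ∣)))
    (*≤* (ℤ.≤-trans (ℤ.≤-reflexive (ℤ.*-identityʳ i))
        (ℤ.≤-trans i≤∣i∣ (ℤ.≤-trans (ℤ.≤-reflexive (sym (ℤ.*-identityʳ (ℤ.+ ℤ.∣ i ∣))))
      (ℤ.*-monoˡ-≤-nonNeg (ℤ.+ ℤ.∣ i ∣) (ℤ.+≤+ (s≤s z≤n)))))))))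
    where
    i : ℤ
    i = ℚᵘ.↥ toℚᵘ p
    i≤∣i∣ : i ℤ.≤ ℤ.+ ℤ.∣ i ∣
    i≤∣i∣ = ≤∣∣ i
      where
      ≤∣∣ : ∀ i → i ℤ.≤ ℤ.+ ℤ.∣ i ∣
      ≤∣∣ (ℤ.+ n)      = ℤ.≤-refl
      ≤∣∣ (ℤ.-[1+ n ]) = ℤ.-≤+

  vanishing : ∀ K {ε} → 0ℚ < ε → ∃[ N ] (∀ m → N ℕ.≤ m → K * 1/1+ m ≤ ε)
  vanishing K {ε} 0<ε = let (N , K/ε≤N) = archimedean (K * 1/ ε) in N , λ m N≤m → begin
    K * 1/1+ m                            ≡⟨ cong (λ x → x * 1/1+ m) (sym (K/ε*ε)) ⟩
    K * 1/ ε * ε * 1/1+ m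
      ≤⟨ *-monoˡ (0≤1/1+ m) (*-monoˡ (ℚ.<⇒≤ 0<ε) (ℚ.≤-trans K/ε≤N (nat-mono (ℕ.m≤n⇒m≤1+n N≤m)))) ⟩
    nat (suc m) * ε * 1/1+ m              ≡⟨ regroup (nat (suc m)) ε (1/1+ m) ⟩
    1/1+ m * nat (suc m) * ε              ≡⟨ cong (_* ε) (1/1+-inverse-nat m) ⟩
    1ℚ * ε                                ≡⟨ ℚ.*-identityˡ ε ⟩
    ε                                     ∎
    where
    open ℚ.≤-Reasoning
    instance
      ε-nonZero : NonZero ε
      ε-nonZero = ≢-nonZero λ eq → ℚ.<⇒≢ 0<ε (sym eq)
    K/ε*ε : K * 1/ ε * ε ≡ K
    K/ε*ε = trans (ℚ.*-assoc K (1/ ε) ε) (trans (cong (K *_) (ℚ.*-inverseˡ ε)) (ℚ.*-identityʳ K))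
    regroup : ∀ n e i → n * e * i ≡ i * n * e
    regroup = solve-∀ ring

  ≤-limit : ∀ {p q} K → (∀ m → p ≤ q + K * 1/1+ m) → p ≤ q
  ≤-limit {p} {q} K le with ℚ.≤-total p q
  ... | inj₁ p≤q = p≤q
  ... | inj₂ q≤p with p ℚ.≟ q
  ... | yes p≡q = ℚ.≤-reflexive p≡q
  ... | no  p≢q = let (N , small) = vanishing K 0<ε in 0≤∸⁻¹ (subst (0ℚ ≤_) (double p q)
    (*-monoʳ {2ℚ} (ℚ.nonNegative⁻¹ 2ℚ) (0≤∸ (ℚ.≤-trans (le N) (ℚ.+-monoʳ-≤ q (small N ℕ.≤-refl))))))
    where
    0<ε : 0ℚ < (p - q) * ½
    0<ε =
      ℚ.≰⇒> λ ε≤0 → p≢q (ℚ.≤-antisym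
          (0≤∸⁻¹ (subst (0ℚ ≤_) (flip p q) (*-monoʳ {2ℚ} (ℚ.nonNegative⁻¹ 2ℚ) (ℚ.neg-antimono-≤ ε≤0)))) q≤p)
      where
      flip : ∀ p q → 2ℚ * - ((p - q) * ½) ≡ q - p
      flip = solve-∀ ring
    double : ∀ p q → 2ℚ * (q + (p - q) * ½ - p) ≡ q - p
    double = solve-∀ ring

  common-multiple : ∀ (f : ℕ → ℕ) n → ∃[ p ] (∀ j → j ℕ.< n → suc (f j) ∣ suc p)
  common-multiple f zero    = 0 , λ _ ()
  common-multiple f (suc n) =
    let (p , f∣p) = common-multiple f n in
    -- The successor of this number is `suc p ℕ.* suc (f n)` by computation.
    f n ℕ.+ p ℕ.* suc (f n) , λ j j<1+n →
      [ (λ j<n → ∣-trans (f∣p j j<n) (m∣m*n (suc (f n)))) , (λ { refl → n∣m*n (suc p) }) ]′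
        (ℕ.m<1+n⇒m<n∨m≡n j<1+n)

  innerArea-* : ∀ N .{{_ : ℕ.NonZero N}} → innerArea N * nat (N ℕ.* N) ≡ nat (4 ℕ.* squaresInside N)
  innerArea-* N@(suc n) = begin
    innerArea N * nat (N ℕ.* N)                     ≡⟨ cong (innerArea N *_) (nat≡ (N ℕ.* N)) ⟩
    innerArea N * ℤ→ℚ (ℤ.+ (N ℕ.* N))
      ≡⟨ /-*-cancel (ℤ.+ (4 ℕ.* squaresInside N)) (n ℕ.+ n ℕ.* N) ⟩
    ℤ→ℚ (ℤ.+ (4 ℕ.* squaresInside N))               ≡⟨ nat≡ (4 ℕ.* squaresInside N) ⟨
    nat (4 ℕ.* squaresInside N)                     ∎
    where open ≡-Reasoning

  -- N is divisible by the denominators of the points with parameters j / M, which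
  -- therefore become lattice points of the circle of radius N.

  module Grid (M′ n′ : ℕ) (∣N : ∀ j → j ℕ.≤ suc M′ → suc M′ ℕ.* suc M′ ℕ.+ j ℕ.* j ∣ 8 ℕ.* suc n′) where

    M N : ℕ
    M = suc M′
    N = 8 ℕ.* suc n′

    -- The Pythagorean triple generated by `M` and `j`, enlarged by `q j` so that its hypotenuse is
    -- `N`.
    q X Y : ℕ → ℕ
    q j = N ℕ./ (M ℕ.* M ℕ.+ j ℕ.* j)
    X j = q j ℕ.* (M ℕ.* M ℕ.∸ j ℕ.* j)
    Y j = q j ℕ.* (2 ℕ.* (j ℕ.* M))

    q*≡N : ∀ {j} → j ℕ.≤ M → q j ℕ.* (M ℕ.* M ℕ.+ j ℕ.* j) ≡ N
    q*≡N {j} j≤M = ℕ.m/n*n≡m (∣N j j≤M)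

    circle : ∀ {j} → j ℕ.≤ M → OnCircle N (X j) (Y j)
    circle {j} j≤M = onCircle (begin
      X j ℕ.* X j ℕ.+ Y j ℕ.* Y j
        ≡⟨ expand (q j) a j M ⟩
      q j ℕ.* q j ℕ.* (a ℕ.* a ℕ.+ 4 ℕ.* (j ℕ.* j) ℕ.* (M ℕ.* M))
        ≡⟨ cong (λ m → q j ℕ.* q j ℕ.* (a ℕ.* a ℕ.+ 4 ℕ.* (j ℕ.* j) ℕ.* m)) a+j²≡M² ⟨
      q j ℕ.* q j ℕ.* (a ℕ.* a ℕ.+ 4 ℕ.* (j ℕ.* j) ℕ.* (a ℕ.+ j ℕ.* j))
        ≡⟨ complete (q j) a (j ℕ.* j) ⟩
      (q j ℕ.* (a ℕ.+ j ℕ.* j ℕ.+ j ℕ.* j)) ℕ.* (q j ℕ.* (a ℕ.+ j ℕ.* j ℕ.+ j ℕ.* j))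
        ≡⟨ cong (λ m → m ℕ.* m) (trans (cong (λ m → q j ℕ.* (m ℕ.+ j ℕ.* j)) a+j²≡M²) (q*≡N j≤M)) ⟩
      N ℕ.* N ∎)
      where
      open ≡-Reasoning
      a : ℕ
      a = M ℕ.* M ℕ.∸ j ℕ.* j
      a+j²≡M² : a ℕ.+ j ℕ.* j ≡ M ℕ.* M
      a+j²≡M² = ℕ.m∸n+n≡m (ℕ.*-mono-≤ j≤M j≤M)
      expand : ∀ q a j m →
          (q ℕ.* a) ℕ.* (q ℕ.* a) ℕ.+ (q ℕ.* (2 ℕ.* (j ℕ.* m))) ℕ.* (q ℕ.* (2 ℕ.* (j ℕ.* m))) ≡
        q ℕ.* q ℕ.* (a ℕ.* a ℕ.+ 4 ℕ.* (j ℕ.* j) ℕ.* (m ℕ.* m))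
      expand = ℕ-Solver.solve-∀
      complete : ∀ q a s →
          q ℕ.* q ℕ.* (a ℕ.* a ℕ.+ 4 ℕ.* s ℕ.* (a ℕ.+ s)) ≡
            (q ℕ.* (a ℕ.+ s ℕ.+ s)) ℕ.* (q ℕ.* (a ℕ.+ s ℕ.+ s))
      complete = ℕ-Solver.solve-∀

    δ ν : ℚ
    δ = 1/1+ M′
    -- This is `1 / N`, as `8 ℕ.* suc n′` reduces to the successor of the argument.
    ν = 1/1+ (n′ ℕ.+ 7 ℕ.* suc n′)

    t : ℕ → ℚ
    t j = nat j * δ

    δ-inverse : δ * nat M ≡ 1ℚ
    δ-inverse = 1/1+-inverse-nat M′

    ν-inverse : ν * nat N ≡ 1ℚ
    ν-inverse = 1/1+-inverse-nat (n′ ℕ.+ 7 ℕ.* suc n′)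

    t*M : ∀ j → t j * nat M ≡ nat j
    t*M j = trans (ℚ.*-assoc (nat j) δ (nat M)) (trans (cong (nat j *_) δ-inverse) (ℚ.*-identityʳ (nat j)))

    ρ-N : ∀ {j} → j ℕ.≤ M → ρ (t j) * nat N ≡ nat (q j) * (nat M * nat M)
    ρ-N {j} j≤M = trans (cong (ρ (t j) *_) nat-N) (modulo (nat (q j) * (nat M * nat M)) (ρ-inverse (t j))
      (identity (ρ (t j)) (nat (q j)) (nat M) (t j)))
      where
      nat-N : nat N ≡ nat (q j) * (nat M * nat M + (t j * nat M) * (t j * nat M))
      nat-N =
        trans (cong nat (sym (q*≡N j≤M))) (trans (nat-* (q j) (M ℕ.* M ℕ.+ j ℕ.* j)) (cong (nat (q j) *_)
        (trans (nat-+ (M ℕ.* M) (j ℕ.* j))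
            (cong₂ _+_ (nat-* M M) (trans (nat-* j j) (cong (λ x → x * x) (sym (t*M j))))))))
      identity : ∀ r q m t →
          r * (q * (m * m + (t * m) * (t * m))) - q * (m * m) ≡ (q * (m * m)) * (r * (1ℚ + t * t) - 1ℚ)
      identity = solve-∀ ring

    nat-X : ∀ {j} → j ℕ.≤ M → nat (X j) ≡ px (t j) * nat N
    nat-X {j} j≤M = begin
      nat (X j)
        ≡⟨ nat-* (q j) (M ℕ.* M ℕ.∸ j ℕ.* j) ⟩
      nat (q j) * nat (M ℕ.* M ℕ.∸ j ℕ.* j)
        ≡⟨ cong (nat (q j) *_)
          (trans (nat-∸ (ℕ.*-mono-≤ j≤M j≤M))
              (cong₂ _-_ (nat-* M M) (trans (nat-* j j) (cong (λ x → x * x) (sym (t*M j)))))) ⟩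
      nat (q j) * (nat M * nat M - (t j * nat M) * (t j * nat M))
        ≡⟨ factor (nat (q j)) (nat M) (t j) ⟩
      (1ℚ - t j * t j) * (nat (q j) * (nat M * nat M))
        ≡⟨ cong ((1ℚ - t j * t j) *_) (ρ-N j≤M) ⟨
      (1ℚ - t j * t j) * (ρ (t j) * nat N)
        ≡⟨ ℚ.*-assoc (1ℚ - t j * t j) (ρ (t j)) (nat N) ⟨
      px (t j) * nat N ∎
      where
      open ≡-Reasoning
      factor : ∀ q m t → q * (m * m - (t * m) * (t * m)) ≡ (1ℚ - t * t) * (q * (m * m))
      factor = solve-∀ ring

    nat-Y : ∀ {j} → j ℕ.≤ M → nat (Y j) ≡ py (t j) * nat N
    nat-Y {j} j≤M = begin
      nat (Y j)
        ≡⟨ trans (nat-* (q j) (2 ℕ.* (j ℕ.* M)))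
          (cong (nat (q j) *_) (trans (nat-* 2 (j ℕ.* M)) (cong₂ _*_ (nat≡ 2) (nat-* j M)))) ⟩
      nat (q j) * (2ℚ * (nat j * nat M))
        ≡⟨ cong (λ x → nat (q j) * (2ℚ * (x * nat M))) (t*M j) ⟨
      nat (q j) * (2ℚ * (t j * nat M * nat M))
        ≡⟨ factor (nat (q j)) (nat M) (t j) ⟩
      2ℚ * t j * (nat (q j) * (nat M * nat M))
        ≡⟨ cong (2ℚ * t j *_) (ρ-N j≤M) ⟨
      2ℚ * t j * (ρ (t j) * nat N)
        ≡⟨ ℚ.*-assoc (2ℚ * t j) (ρ (t j)) (nat N) ⟨
      py (t j) * nat N ∎
      where
      open ≡-Reasoning
      factor : ∀ q m t → q * (2ℚ * (t * m * m)) ≡ 2ℚ * t * (q * (m * m))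
      factor = solve-∀ ring

    0≤δ : 0ℚ ≤ δ
    0≤δ = 0≤1/1+ M′

    t-unit : ∀ {j} → j ℕ.≤ M → Unit (t j)
    t-unit {j} j≤M = unit (0≤* (0≤nat j) 0≤δ)
      (ℚ.≤-trans (*-monoˡ 0≤δ (nat-mono j≤M)) (ℚ.≤-reflexive (trans (ℚ.*-comm (nat M) δ) δ-inverse)))

    t-step : ∀ j → t (suc j) - t j ≡ δ
    t-step j = trans (cong (λ x → x * δ - t j) (nat-suc j)) (identity (nat j) δ)
      where
      identity : ∀ j δ → (1ℚ + j) * δ - j * δ ≡ δ
      identity = solve-∀ ring

    t-mono : ∀ j → t j ≤ t (suc j)
    t-mono j = 0≤∸⁻¹ (subst (0ℚ ≤_) (sym (t-step j)) 0≤δ)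

    px-antitone : ∀ {j} → suc j ℕ.≤ M → px (t (suc j)) ≤ px (t j)
    px-antitone {j} j<M = 0≤∸⁻¹ (subst (0ℚ ≤_) (sym (px-difference (t j) (t (suc j))))
      (0≤* (0≤* (ℚ.nonNegative⁻¹ 2ℚ) (0≤∸ (t-mono j)))
          (0≤* (0≤+ (Unit.0≤x (t-unit (ℕ.<⇒≤ j<M))) (Unit.0≤x (t-unit j<M)))
        (0≤* (Unit.0≤x (ρ-unit (t j))) (Unit.0≤x (ρ-unit (t (suc j))))))))

    X-antitone : ∀ {j} → suc j ℕ.≤ M → X (suc j) ℕ.≤ X j
    X-antitone j<M =
      nat-cancel-≤ (subst₂ _≤_ (sym (nat-X j<M)) (sym (nat-X (ℕ.<⇒≤ j<M)))
          (*-monoˡ (0≤nat N) (px-antitone j<M)))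

    -- Removing the triangle below the radius to the point with parameter `t j` leaves the sector
    -- between that radius and the vertical axis. Thus `V` runs from the whole area at `j = 0` down
    -- to 0 at `j = M`.
    W V : ℕ → ℚ
    W j = 4ℚ * nat (columns N (X j)) * (ν * ν)
    V j = W j - 2ℚ * (px (t j) * py (t j))

    0≤4νν : 0ℚ ≤ 4ℚ * (ν * ν)
    0≤4νν = 0≤* (ℚ.nonNegative⁻¹ 4ℚ) (0≤² ν)

    W-step : ∀ {j} → suc j ℕ.≤ M →
      4ℚ * ((px (t j) - px (t (suc j))) * py (t j)) ≤ W j - W (suc j) ×
      W j - W (suc j) ≤ 4ℚ * ((px (t j) - px (t (suc j))) * py (t (suc j)))
    W-step {j} j<M =
      let (lower , upper) = columns-stepℚ (circle j≤M) (circle j<M) (X-antitone j<M) in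
      subst₂ _≤_ (rescale (nat-Y j≤M)) (expand P P′ ν) (*-monoʳ 0≤4νν lower) ,
      subst₂ _≤_ (expand P P′ ν) (rescale (nat-Y j<M)) (*-monoʳ 0≤4νν upper)
      where
      j≤M : j ℕ.≤ M
      j≤M = ℕ.<⇒≤ j<M
      P P′ : ℚ
      P  = nat (columns N (X j))
      P′ = nat (columns N (X (suc j)))
      expand : ∀ P P′ ν → 4ℚ * (ν * ν) * (P - P′) ≡ 4ℚ * P * (ν * ν) - 4ℚ * P′ * (ν * ν)
      expand = solve-∀ ring
      identity : ∀ ν x x′ y n →
          4ℚ * (ν * ν) * ((x * n - x′ * n) * (y * n)) ≡ 4ℚ * ((x - x′) * y) * ((ν * n) * (ν * n))
      identity = solve-∀ ring
      rescale : ∀ {Z y} → nat Z ≡ y * nat N →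
          4ℚ * (ν * ν) * ((nat (X j) - nat (X (suc j))) * nat Z) ≡ 4ℚ * ((px (t j) - px (t (suc j))) * y)
      rescale {Z} {y} Z≡ = begin
        4ℚ * (ν * ν) * ((nat (X j) - nat (X (suc j))) * nat Z)
          ≡⟨ cong₂ (λ u v → 4ℚ * (ν * ν) * (u * v)) (cong₂ _-_ (nat-X j≤M) (nat-X j<M)) Z≡ ⟩
        4ℚ * (ν * ν) * ((px (t j) * nat N - px (t (suc j)) * nat N) * (y * nat N))
          ≡⟨ identity ν (px (t j)) (px (t (suc j))) y (nat N) ⟩
        4ℚ * ((px (t j) - px (t (suc j))) * y) * ((ν * nat N) * (ν * nat N))
          ≡⟨ cong (λ z → 4ℚ * ((px (t j) - px (t (suc j))) * y) * (z * z)) ν-inverse ⟩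
        4ℚ * ((px (t j) - px (t (suc j))) * y) * (1ℚ * 1ℚ)
          ≡⟨ ℚ.*-identityʳ (4ℚ * ((px (t j) - px (t (suc j))) * y)) ⟩
        4ℚ * ((px (t j) - px (t (suc j))) * y) ∎
        where open ≡-Reasoning

    innerArea-N : innerArea N ≡ 4ℚ * nat (squaresInside N) * (ν * ν)
    innerArea-N = begin
      innerArea N
        ≡⟨ unscale (innerArea N) ⟩
      innerArea N * (nat N * nat N) * (ν * ν)
        ≡⟨ cong (λ x → innerArea N * x * (ν * ν)) (nat-* N N) ⟨
      innerArea N * nat (N ℕ.* N) * (ν * ν)
        ≡⟨ cong (_* (ν * ν)) (innerArea-* N) ⟩
      nat (4 ℕ.* squaresInside N) * (ν * ν)
        ≡⟨ cong (_* (ν * ν)) (trans (nat-* 4 (squaresInside N)) (cong (_* nat (squaresInside N)) (nat≡ 4))) ⟩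
      4ℚ * nat (squaresInside N) * (ν * ν) ∎
      where
      open ≡-Reasoning
      regroup : ∀ x n v → x * (n * n) * (v * v) ≡ x * ((v * n) * (v * n))
      regroup = solve-∀ ring
      unscale : ∀ x → x ≡ x * (nat N * nat N) * (ν * ν)
      unscale x =
        sym (trans (regroup x (nat N) ν) (trans (cong (λ z → x * (z * z)) ν-inverse) (ℚ.*-identityʳ x)))

    t0 : t 0 ≡ 0ℚ
    t0 = trans (cong (_* δ) (nat≡ 0)) (ℚ.*-zeroˡ δ)

    tM : t M ≡ 1ℚ
    tM = trans (ℚ.*-comm (nat M) δ) δ-inverse

    V0 : V 0 ≡ innerArea N
    V0 = begin
      W 0 - 2ℚ * (px (t 0) * py (t 0))
        ≡⟨ cong (λ s → W 0 - 2ℚ * (px s * py s)) t0 ⟩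
      W 0 - 2ℚ * (px 0ℚ * (2ℚ * 0ℚ * ρ 0ℚ))
        ≡⟨ identity (W 0) (px 0ℚ) (ρ 0ℚ) ⟩
      W 0
        ≡⟨ cong (λ m → 4ℚ * nat (columns N m) * (ν * ν)) X0 ⟩
      4ℚ * nat (squaresInside N) * (ν * ν)
        ≡⟨ innerArea-N ⟨
      innerArea N ∎
      where
      open ≡-Reasoning
      identity : ∀ w x r → w - 2ℚ * (x * (2ℚ * 0ℚ * r)) ≡ w
      identity = solve-∀ ring
      X0 : X 0 ≡ N
      X0 = trans (cong (q 0 ℕ.*_) (sym (ℕ.+-identityʳ (M ℕ.* M)))) (q*≡N z≤n)

    VM : V M ≡ 0ℚ
    VM = begin
      W M - 2ℚ * (px (t M) * py (t M))
        ≡⟨ cong₂ (λ m s → 4ℚ * nat (columns N m) * (ν * ν) - 2ℚ * (px s * py s)) XM tM ⟩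
      4ℚ * nat 0 * (ν * ν) - 2ℚ * ((1ℚ - 1ℚ * 1ℚ) * ρ 1ℚ * py 1ℚ)
        ≡⟨ cong (λ z → 4ℚ * z * (ν * ν) - 2ℚ * ((1ℚ - 1ℚ * 1ℚ) * ρ 1ℚ * py 1ℚ)) (nat≡ 0) ⟩
      4ℚ * 0ℚ * (ν * ν) - 2ℚ * ((1ℚ - 1ℚ * 1ℚ) * ρ 1ℚ * py 1ℚ)
        ≡⟨ identity (ν * ν) (ρ 1ℚ) (py 1ℚ) ⟩
      0ℚ ∎
      where
      open ≡-Reasoning
      identity : ∀ v r y → 4ℚ * 0ℚ * v - 2ℚ * ((1ℚ - 1ℚ * 1ℚ) * r * y) ≡ 0ℚ
      identity = solve-∀ ring
      XM : X M ≡ 0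
      XM = trans (cong (q M ℕ.*_) (ℕ.n∸n≡0 (M ℕ.* M))) (ℕ.*-zeroʳ (q M))

    module _ {Φ p : ℚ → ℚ} {ε : ℚ} (D : Φ HasDerivative p) (p≈ : ∀ {x} → Unit x → ∣ p x * (1ℚ + x * x) - 4ℚ ∣ ≤ ε) where

      C step : ℚ
      C    = 20ℚ + _HasDerivative_.C D
      step = δ * ε + C * (δ * δ)

      V-step : ∀ {j} → suc j ℕ.≤ M → ∣ V j - V (suc j) - (Φ (t (suc j)) - Φ (t j)) ∣ ≤ step
      V-step {j} j<M = subst₂ (λ a b → ∣ a ∣ ≤ b)
        (identity (W j) (W (suc j)) (px (t j) * py (t j)) (px (t (suc j)) * py (t (suc j)))
            (Φ (t (suc j)) - Φ (t j)))
        (cong (λ s → s * ε + C * (s * s)) (t-step j))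
        (sector-step D p≈ (t-unit (ℕ.<⇒≤ j<M)) (t-unit j<M) (t-mono j) (proj₁ (W-step j<M))
            (proj₂ (W-step j<M)))
        where
        identity : ∀ w w′ z z′ f → w - w′ - 2ℚ * (z - z′) - f ≡ (w - 2ℚ * z) - (w′ - 2ℚ * z′) - f
        identity = solve-∀ ring

      V-steps : ∀ m → m ℕ.≤ M → ∣ V 0 - V m - (Φ (t m) - Φ (t 0)) ∣ ≤ nat m * step
      V-steps zero    _ =
        ℚ.≤-reflexive (trans (cong ∣_∣ (identity (V 0) (Φ (t 0))))
            (sym (trans (cong (_* step) (nat≡ 0)) (ℚ.*-zeroˡ step))))
        where
        identity : ∀ v f → v - v - (f - f) ≡ 0ℚ
        identity = solve-∀ ring
      V-steps (suc m) m<M = subst₂ (λ a b → ∣ a ∣ ≤ b)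
        (identity (V 0) (V m) (V (suc m)) (Φ (t 0)) (Φ (t m)) (Φ (t (suc m))))
        (trans (collect (nat m) step) (cong (_* step) (sym (nat-suc m))))
        (∣+∣≤ (V-steps m (ℕ.<⇒≤ m<M)) (V-step m<M))
        where
        identity : ∀ v₀ v v′ f₀ f f′ → (v₀ - v - (f - f₀)) + (v - v′ - (f′ - f)) ≡ v₀ - v′ - (f′ - f₀)
        identity = solve-∀ ring
        collect : ∀ m s → m * s + s ≡ (1ℚ + m) * s
        collect = solve-∀ ring

      -- The `M` errors `step` add up by `δ * nat M ≡ 1ℚ`. The bound does not involve `N`, which can
      -- therefore be chosen after `M`.
      innerArea-≈ : ∣ innerArea N - (Φ 1ℚ - Φ 0ℚ) ∣ ≤ ε + C * δ
      innerArea-≈ = subst₂ (λ a b → ∣ a ∣ ≤ b)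
        (trans (cong₂ (λ v f → V 0 - v - f) VM (cong₂ (λ s s′ → Φ s - Φ s′) tM t0)) (trans
          (cong (λ v → v - 0ℚ - (Φ 1ℚ - Φ 0ℚ)) V0) (cong (_- (Φ 1ℚ - Φ 0ℚ)) (ℚ.+-identityʳ (innerArea N)))))
        (modulo (ε + C * δ) δ-inverse (collect (nat M) δ ε C))
        (V-steps M ℕ.≤-refl)
        where
        collect : ∀ m δ ε C → m * (δ * ε + C * (δ * δ)) - (ε + C * δ) ≡ (ε + C * δ) * (δ * m - 1ℚ)
        collect = solve-∀ ring

  -- For every mesh `1 / M` a suitable radius `N` exists. The error of the mesh and that of
  -- comparing two approximations of `π` are both `O(1 / M)`, and `≤-limit` removes them.
  π-≈ : ∀ {Φ p ε} → Φ HasDerivative p → (∀ {x} → Unit x → ∣ p x * (1ℚ + x * x) - 4ℚ ∣ ≤ ε) →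
        ∣_-_∣≤_ (Φ 1ℚ - Φ 0ℚ) π ε
  π-≈ {Φ} {p} {ε} D p≈ n = ≤-limit (20ℚ + _HasDerivative_.C D + 1ℚ) bound
    where
    bound : ∀ M′ → ∣ Φ 1ℚ - Φ 0ℚ - ℝ.approx π n ∣ ≤ ε + 1/1+ n + (20ℚ + _HasDerivative_.C D + 1ℚ) * 1/1+ M′
    bound M′ = begin
      ∣ Φ 1ℚ - Φ 0ℚ - ℝ.approx π n ∣
        ≤⟨ ∣-∣-triangle {Φ 1ℚ - Φ 0ℚ} {ℝ.approx π n} (innerArea (8 ℕ.* suc n′))
             (subst (_≤ ε + (20ℚ + C) * 1/1+ M′) (∣p-q∣≡∣q-p∣ (innerArea (8 ℕ.* suc n′)) (Φ 1ℚ - Φ 0ℚ))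
                 (Grid.innerArea-≈ M′ n′ ∣N D p≈))
             (ℝ.regular π n′ n) ⟩
      ε + (20ℚ + C) * 1/1+ M′ + (1/1+ n′ + 1/1+ n)
        ≤⟨ ℚ.+-monoʳ-≤ (ε + (20ℚ + C) * 1/1+ M′) (ℚ.+-monoˡ-≤ (1/1+ n) 1/n′≤1/M′) ⟩
      ε + (20ℚ + C) * 1/1+ M′ + (1/1+ M′ + 1/1+ n)
        ≡⟨ collect ε (20ℚ + C) (1/1+ M′) (1/1+ n) ⟩
      ε + 1/1+ n + (20ℚ + C + 1ℚ) * 1/1+ M′ ∎
      where
      open ℚ.≤-Reasoning
      C : ℚ
      C = _HasDerivative_.C D
      collect : ∀ e c d n → e + c * d + (d + n) ≡ e + n + (c + 1ℚ) * d
      collect = solve-∀ ring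
      multiple : ∃[ k ] (∀ j → j ℕ.< suc (suc M′) → suc M′ ℕ.* suc M′ ℕ.+ j ℕ.* j ∣ suc k)
      multiple = common-multiple (λ j → M′ ℕ.+ M′ ℕ.* suc M′ ℕ.+ j ℕ.* j) (suc (suc M′))
      k n′ : ℕ
      k  = proj₁ multiple
      -- Then `suc n′` is `suc M′ ℕ.* suc k`: the divisors of `suc k` are kept, and `n′` is at least
      -- `M′`.
      n′ = k ℕ.+ M′ ℕ.* suc k
      ∣N : ∀ j → j ℕ.≤ suc M′ → suc M′ ℕ.* suc M′ ℕ.+ j ℕ.* j ∣ 8 ℕ.* suc n′
      ∣N j j≤M = ∣-trans (proj₂ multiple j (s≤s j≤M)) (∣-trans (n∣m*n (suc M′)) (n∣m*n 8))
      M′≤n′ : M′ ℕ.≤ n′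
      M′≤n′ = ℕ.≤-trans (ℕ.m≤m*n M′ (suc k)) (ℕ.m≤n+m (M′ ℕ.* suc k) k)
      1/n′≤1/M′ : 1/1+ n′ ≤ 1/1+ M′
      1/n′≤1/M′ = begin
        1/1+ n′                            ≡⟨ unscale (1/1+ n′) (1/1+-inverse-nat M′) ⟩
        1/1+ n′ * 1/1+ M′ * nat (suc M′)   ≤⟨ *-monoʳ (0≤* (0≤1/1+ n′) (0≤1/1+ M′)) (nat-mono (s≤s M′≤n′)) ⟩
        1/1+ n′ * 1/1+ M′ * nat (suc n′)   ≡⟨ cong (_* nat (suc n′)) (ℚ.*-comm (1/1+ n′) (1/1+ M′)) ⟩
        1/1+ M′ * 1/1+ n′ * nat (suc n′)   ≡⟨ unscale (1/1+ M′) (1/1+-inverse-nat n′) ⟨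
        1/1+ M′                            ∎
        where
        unscale : ∀ x {i n} → i * n ≡ 1ℚ → x ≡ x * i * n
        unscale x {i} {n} eq = sym (trans (ℚ.*-assoc x i n) (trans (cong (x *_) eq) (ℚ.*-identityʳ x)))

-- Assembling the sum.

module Convergence where

  open Arithmetic
  open Series
  open Polynomials using (module Coefficients)
  open Summands using (summand-polynomial)
  open Calculus using (∫a; ∫a-0; ∫a-1; ∫a-derivative; A-≈)
  open Area using (vanishing; π-≈)

  ½^≤ : ∀ m → ½ ^ m ≤ 1/1+ m
  ½^≤ m = begin
    ½ ^ m                              ≡⟨ ℚ.*-identityʳ (½ ^ m) ⟨
    ½ ^ m * 1ℚ                         ≡⟨ cong (½ ^ m *_) (1/1+-inverse-nat m) ⟨
    ½ ^ m * (1/1+ m * nat (suc m))     ≡⟨ regroup (½ ^ m) (1/1+ m) (nat (suc m)) ⟩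
    nat (suc m) * ½ ^ m * 1/1+ m       ≤⟨ *-monoˡ (0≤1/1+ m) (bernoulli m) ⟩
    1ℚ * 1/1+ m                        ≡⟨ ℚ.*-identityˡ (1/1+ m) ⟩
    1/1+ m                             ∎
    where
    open ℚ.≤-Reasoning
    regroup : ∀ a b c → a * (b * c) ≡ c * a * b
    regroup = solve-∀ ring
    bernoulli : ∀ m → nat (suc m) * ½ ^ m ≤ 1ℚ
    bernoulli zero    = ℚ.≤-reflexive (trans (ℚ.*-identityʳ (nat 1)) (nat≡ 1))
    bernoulli (suc m) = ℚ.≤-trans
      (≤-+ (½ * nat m * ½ ^ m) (0≤* (0≤* (ℚ.nonNegative⁻¹ ½) (0≤nat m)) (0≤^ m (ℚ.nonNegative⁻¹ ½)))
        (trans (cong (_* ½ ^ m) (nat-suc m)) (trans (identity (nat m) (½ ^ m))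
          (cong (λ n → n * (½ * ½ ^ m) + ½ * nat m * ½ ^ m)
              (sym (trans (nat-suc (suc m)) (cong (1ℚ +_) (nat-suc m))))))))
      (bernoulli m)
      where
      identity : ∀ m h → (1ℚ + m) * h ≡ (1ℚ + (1ℚ + m)) * (½ * h) + ½ * m * h
      identity = solve-∀ ring

  ½^-*-≤ : ∀ m e → ½ ^ (m ℕ.* suc e) ≤ ½ ^ m
  ½^-*-≤ m e = begin
    ½ ^ (m ℕ.* suc e)          ≡⟨ cong (½ ^_) (ℕ.*-suc m e) ⟩
    ½ ^ (m ℕ.+ m ℕ.* e)        ≡⟨ ^-homo-* ½ m (m ℕ.* e) ⟩
    ½ ^ m * ½ ^ (m ℕ.* e)
      ≤⟨ *-monoʳ (0≤^ m (ℚ.nonNegative⁻¹ ½))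
        (ℚ.≤-trans (p≤∣p∣ (½ ^ (m ℕ.* e))) (∣^∣≤1 {½} (m ℕ.* e) (ℚ.≤ᵇ⇒≤ _))) ⟩
    ½ ^ m * 1ℚ                 ≡⟨ ℚ.*-identityʳ (½ ^ m) ⟩
    ½ ^ m                      ∎
    where open ℚ.≤-Reasoning

  π-series : ∀ K → ∣_-_∣≤_ (partialSum (λ N → b N * y 0 (suc N)) K) π (32ℚ * ½ ^ K)
  π-series K = subst (λ s → ∣_-_∣≤_ s π (32ℚ * ½ ^ K)) value (π-≈ (∫a-derivative K) (A-≈ K))
    where
    value : ∫a K 1ℚ - ∫a K 0ℚ ≡ partialSum (λ N → b N * y 0 (suc N)) K
    value = trans (cong₂ _-_ (∫a-1 K) (∫a-0 K)) (ℚ.+-identityʳ (partialSum (λ N → b N * y 0 (suc N)) K))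

  module _ (k e : ℕ) (1≤k : 1 ℕ.≤ k) (d≡4k : suc e ≡ k ℕ.* 4) where
    open Block k e d≡4k
    open Telescope k e d≡4k
    open Coefficients k e d≡4k

    -- The first `m` summands are compared with the first `m ℕ.* suc e` terms of `F`, that is, with
    -- `m` whole blocks. Geometric rates are weakened to `1/1+ m`, the rate that `vanishing`
    -- handles.
    hasSum : HasSum (summand k polynomial) π
    hasSum ε 0<ε = let (N₀ , small) = vanishing (∣ error-bound ∣ + 32ℚ) 0<ε in N₀ , λ m N₀≤m n → begin
      ∣ partialSum (summand k polynomial) m - ℝ.approx π n ∣
        ≡⟨ cong (λ s → ∣ s - ℝ.approx π n ∣) (partialSum-cong< m λ i _ → summand-polynomial k e d≡4k i) ⟩
      ∣ partialSum (λ n → t n * S (nat (N n))) m - ℝ.approx π n ∣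
        ≤⟨ ∣-∣-triangle {partialSum (λ n → t n * S (nat (N n))) m} {ℝ.approx π n} (partialSum F (m ℕ.* suc e))
             (partialSum-S-≈ 1≤k m) (π-series (m ℕ.* suc e) n) ⟩
      ¼ ^ m * error-bound + (32ℚ * ½ ^ (m ℕ.* suc e) + 1/1+ n)
        ≤⟨ ℚ.+-mono-≤
             (ℚ.≤-trans (*-monoʳ (0≤^ m (ℚ.nonNegative⁻¹ ¼)) (p≤∣p∣ error-bound))
               (*-monoˡ (ℚ.0≤∣p∣ error-bound)
                   (ℚ.≤-trans (^-mono {¼} {½} m (ℚ.nonNegative⁻¹ ¼) (ℚ.≤ᵇ⇒≤ _)) (½^≤ m))))
             (ℚ.+-monoˡ-≤ (1/1+ n) (*-monoʳ {32ℚ} (ℚ.nonNegative⁻¹ 32ℚ) (ℚ.≤-trans (½^-*-≤ m e) (½^≤ m)))) ⟩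
      1/1+ m * ∣ error-bound ∣ + (32ℚ * 1/1+ m + 1/1+ n)
        ≡⟨ collect (1/1+ m) ∣ error-bound ∣ 32ℚ (1/1+ n) ⟩
      (∣ error-bound ∣ + 32ℚ) * 1/1+ m + 1/1+ n
        ≤⟨ ℚ.+-monoˡ-≤ (1/1+ n) (small m N₀≤m) ⟩
      ε + 1/1+ n ∎
      where
      open ℚ.≤-Reasoning
      collect : ∀ i E c n → i * E + (c * i + n) ≡ (E + c) * i + n
      collect = solve-∀ ring

open import Data.Nat.Base using (ℕ; _≤_; _*_)
open import Data.Product.Base using (Σ-syntax)

theorem1 : ∀ (k : ℕ) → 1 ≤ k → Σ[ S ∈ Polynomial (4 * k) ] HasSum (summand k S) π
theorem1 (suc k) 1≤k = subst (λ d → Σ[ S ∈ Polynomial d ] HasSum (summand (suc k) S) π) (ℕ.*-comm (suc k) 4)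
  -- Here `e` is `3 ℕ.+ k * 4`, whose successor is `suc k * 4` by computation.
  (Polynomials.Coefficients.polynomial (suc k) (3 ℕ.+ k * 4) refl ,
   Convergence.hasSum (suc k) (3 ℕ.+ k * 4) 1≤k refl)
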